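{- Let $C>0$. For each $n\ge1$ let $\{A_j\}$ be a partition of the sphere $\{\mathbf x\in\mathbb R^3:|\mathbf x|=\sqrt n\}$ into sets each of diameter at most $C n^{1/4}$. Then for every $\epsilon>0$, $$\sum_j\big(\#(A_j\cap\mathcal E(n))\big)^2\ll_{C,\epsilon} n^{1/2+\epsilon}.$$
   Context: $\mathcal E(n)=\{\mathbf x\in\mathbb Z^3:|\mathbf x|^2=n\}$. -}

module Defs where

open import Data.Integer as ℤ using (ℤ; +_; -[1+_])
import Data.Integer.Properties as ℤ
import Data.Integer.Tactic.RingSolver as ℤSolver
open import Data.List using (length)
open import Data.List.Membership.Propositional using () renaming (_∈_ to _∈ˡ_)
open import Data.List.Relation.Unary.Unique.Propositional using (Unique)
open import Data.Nat as ℕ using (ℕ; zero; suc; NonZero)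
import Data.Nat.Properties as ℕ
import Data.Nat.Tactic.RingSolver as ℕSolver
open import Data.Product using (∃-syntax; _×_; _,_)
open import Data.Rational as ℚ using (ℚ; 0ℚ; 1ℚ; ½; mkℚ; ↥_; ↧ₙ_; toℚᵘ)
import Data.Rational.Properties as ℚ
open import Data.Rational.Solver using (module +-*-Solver)
open import Data.Rational.Unnormalised as ℚᵘ using (mkℚᵘ)
import Data.Rational.Unnormalised.Properties as ℚᵘ
open import Data.Sum as Sum using (_⊎_; inj₁; inj₂)
open import Data.Vec using (Vec; []; _∷_; map; zipWith)
open import Data.Vec.Relation.Binary.Pointwise.Inductive using (Pointwise)
open import Function using (_⇔_)
open import Level using (_⊔_)
open import Relation.Binary using (Setoid)
open import Relation.Binary.PropositionalEquality using (_≡_; refl; sym; trans; cong; cong₂; subst; subst₂)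
open import Relation.Nullary using (¬_; yes; no; contradiction)
open import Relation.Unary using (Pred; Decidable; _∈_; _⊆_)

------------------------------------------------------------------------
-- Real numbers, as Cauchy sequences of rationals modulo _≈_

infix 4 _≤_ _<_ _≈_
infixl 6 _+_ _-_
infixl 7 _*_
infix 8 _^_

record ℝ : Set where
  constructor mkℝ
  field
    seq    : ℕ → ℚ
    cauchy : ∀ δ → 0ℚ ℚ.< δ →
             ∃[ N ] ∀ k l → N ℕ.≤ k → N ℕ.≤ l → ℚ.∣ seq k ℚ.- seq l ∣ ℚ.≤ δ

open ℝ public

_≤_ : ℝ → ℝ → Set
x ≤ y = ∀ δ → 0ℚ ℚ.< δ → ∃[ N ] ∀ k → N ℕ.≤ k → seq x k ℚ.≤ seq y k ℚ.+ δ

_<_ : ℝ → ℝ → Set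
x < y = ∃[ δ ] 0ℚ ℚ.< δ × ∃[ N ] ∀ k → N ℕ.≤ k → seq x k ℚ.+ δ ℚ.≤ seq y k

_≈_ : ℝ → ℝ → Set
x ≈ y = x ≤ y × y ≤ x

module Aux where

  ≤⇒dist≤ : ∀ {p q δ} → p ℚ.≤ q ℚ.+ δ → q ℚ.≤ p ℚ.+ δ → ℚ.∣ p ℚ.- q ∣ ℚ.≤ δ
  ≤⇒dist≤ {p} {q} {δ} a b with ℚ.∣p∣≡p∨∣p∣≡-p (p ℚ.- q)
  ... | inj₁ e = subst (ℚ._≤ δ) (sym e)
        (subst (p ℚ.- q ℚ.≤_) (solve 2 (λ q δ → (q :+ δ) :- q := δ) refl q δ) (ℚ.+-monoˡ-≤ (ℚ.- q) a))
    where open +-*-Solver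
  ... | inj₂ e = subst (ℚ._≤ δ) (sym (trans e (solve 2 (λ p q → :- (p :- q) := q :- p) refl p q)))
        (subst (q ℚ.- p ℚ.≤_) (solve 2 (λ q δ → (q :+ δ) :- q := δ) refl p δ) (ℚ.+-monoˡ-≤ (ℚ.- p) b))
    where open +-*-Solver

  p≤∣p∣ : ∀ p → p ℚ.≤ ℚ.∣ p ∣
  p≤∣p∣ p with ℚ.≤-total 0ℚ p
  ... | inj₁ h = ℚ.≤-reflexive (sym (ℚ.0≤p⇒∣p∣≡p h))
  ... | inj₂ h = ℚ.≤-trans h (ℚ.0≤∣p∣ p)

  dist≤⇒≤ : ∀ {p q δ} → ℚ.∣ p ℚ.- q ∣ ℚ.≤ δ → p ℚ.≤ q ℚ.+ δ
  dist≤⇒≤ {p} {q} {δ} h =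
    subst (ℚ._≤ q ℚ.+ δ) (solve 2 (λ p q → q :+ (p :- q) := p) refl p q)
      (ℚ.+-monoʳ-≤ q (ℚ.≤-trans (p≤∣p∣ (p ℚ.- q)) h))
    where open +-*-Solver

  oneSided : (s : ℕ → ℚ) →
             (∀ δ → 0ℚ ℚ.< δ → ∃[ N ] ∀ k l → N ℕ.≤ k → N ℕ.≤ l → s k ℚ.≤ s l ℚ.+ δ) → ℝ
  oneSided s h = mkℝ s λ δ δ>0 → let (N , f) = h δ δ>0 in
    N , λ k l a b → ≤⇒dist≤ {s k} (f k l a b) (f l k b a)

  *-pos : ∀ {p q} → 0ℚ ℚ.< p → 0ℚ ℚ.< q → 0ℚ ℚ.< p ℚ.* q
  *-pos {p} {q} a b = ℚ.positive⁻¹ _ {{ℚ.pos*pos⇒pos p {{ℚ.positive a}} q {{ℚ.positive b}}}}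

  0<½ : 0ℚ ℚ.< ½
  0<½ = ℚ.positive⁻¹ ½

  halves : ∀ δ → ½ ℚ.* δ ℚ.+ ½ ℚ.* δ ≡ δ
  halves δ = trans (sym (ℚ.*-distribʳ-+ δ ½ ½)) (ℚ.*-identityˡ δ)

  *-mono-≤ : ∀ {p q r s} → 0ℚ ℚ.≤ r → 0ℚ ℚ.≤ q → p ℚ.≤ q → r ℚ.≤ s → p ℚ.* r ℚ.≤ q ℚ.* s
  *-mono-≤ {p} {q} {r} {s} r≥0 q≥0 a b = ℚ.≤-trans
    (ℚ.*-monoʳ-≤-nonNeg r {{ℚ.nonNegative r≥0}} a) (ℚ.*-monoˡ-≤-nonNeg q {{ℚ.nonNegative q≥0}} b)

  evBound : ∀ x → ∃[ B ] 0ℚ ℚ.< B × ∃[ N ] ∀ k → N ℕ.≤ k → ℚ.∣ seq x k ∣ ℚ.≤ B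
  evBound x = let (N , f) = cauchy x 1ℚ (ℚ.positive⁻¹ 1ℚ); s = seq x in
    ℚ.∣ s N ∣ ℚ.+ 1ℚ
    , ℚ.positive⁻¹ _ {{ℚ.nonNeg+pos⇒pos ℚ.∣ s N ∣ {{ℚ.∣-∣-nonNeg (s N)}} 1ℚ}}
    , N , λ k N≤k → subst (ℚ._≤ ℚ.∣ s N ∣ ℚ.+ 1ℚ)
        (cong ℚ.∣_∣ (solve 2 (λ p q → q :+ (p :- q) := p) refl (s k) (s N)))
        (ℚ.≤-trans (ℚ.∣p+q∣≤∣p∣+∣q∣ (s N) (s k ℚ.- s N))
                   (ℚ.+-monoʳ-≤ ℚ.∣ s N ∣ (f k N N≤k ℕ.≤-refl)))
    where open +-*-Solver

open Aux

fromℚ : ℚ → ℝ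
fromℚ q = mkℝ (λ _ → q) λ δ δ>0 →
  0 , λ _ _ _ _ → subst (λ r → ℚ.∣ r ∣ ℚ.≤ δ) (sym (ℚ.+-inverseʳ q)) (ℚ.<⇒≤ δ>0)

fromℤ : ℤ → ℝ
fromℤ z = fromℚ (z ℚ./ 1)

fromℕ : ℕ → ℝ
fromℕ n = fromℤ (+ n)

0ℝ : ℝ
0ℝ = fromℚ 0ℚ

_+_ : ℝ → ℝ → ℝ
x + y = mkℝ (λ k → seq x k ℚ.+ seq y k) λ δ δ>0 →
  let (N , f) = cauchy x (½ ℚ.* δ) (*-pos 0<½ δ>0)
      (M , g) = cauchy y (½ ℚ.* δ) (*-pos 0<½ δ>0) in
  N ℕ.⊔ M , λ k l a b → subst₂ ℚ._≤_
    (cong ℚ.∣_∣ (solve 4 (λ p q r s → (p :- q) :+ (r :- s) := (p :+ r) :- (q :+ s)) refl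
      (seq x k) (seq x l) (seq y k) (seq y l)))
    (halves δ)
    (ℚ.≤-trans (ℚ.∣p+q∣≤∣p∣+∣q∣ (seq x k ℚ.- seq x l) (seq y k ℚ.- seq y l))
      (ℚ.+-mono-≤ (f k l (ℕ.m⊔n≤o⇒m≤o N M a) (ℕ.m⊔n≤o⇒m≤o N M b))
                  (g k l (ℕ.m⊔n≤o⇒n≤o N M a) (ℕ.m⊔n≤o⇒n≤o N M b))))
  where open +-*-Solver

-_ : ℝ → ℝ
- x = mkℝ (λ k → ℚ.- seq x k) λ δ δ>0 →
  let (N , f) = cauchy x δ δ>0 in
  N , λ k l a b → subst (λ r → ℚ.∣ r ∣ ℚ.≤ δ)
    (solve 2 (λ p q → p :- q := (:- q) :- (:- p)) refl (seq x l) (seq x k)) (f l k b a)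
  where open +-*-Solver

_-_ : ℝ → ℝ → ℝ
x - y = x + (- y)

_*_ : ℝ → ℝ → ℝ
x * y = mkℝ (λ k → seq x k ℚ.* seq y k) λ δ δ>0 →
  let (B , B>0 , N₁ , f₁) = evBound x
      (D , D>0 , N₂ , f₂) = evBound y
      instance
        B≢0 = ℚ.pos⇒nonZero B {{ℚ.positive B>0}}
        D≢0 = ℚ.pos⇒nonZero D {{ℚ.positive D>0}}
      1/B>0 = ℚ.positive⁻¹ (ℚ.1/ B) {{ℚ.1/pos⇒pos B {{ℚ.positive B>0}}}}
      1/D>0 = ℚ.positive⁻¹ (ℚ.1/ D) {{ℚ.1/pos⇒pos D {{ℚ.positive D>0}}}}
      η = ½ ℚ.* δ
      η>0 = *-pos 0<½ δ>0
      (N₃ , f₃) = cauchy y (ℚ.1/ B ℚ.* η) (*-pos 1/B>0 η>0)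
      (N₄ , f₄) = cauchy x (ℚ.1/ D ℚ.* η) (*-pos 1/D>0 η>0)
      cancelB = trans (sym (ℚ.*-assoc B (ℚ.1/ B) η)) (trans (cong (ℚ._* η) (ℚ.*-inverseʳ B)) (ℚ.*-identityˡ η))
      cancelD = trans (sym (ℚ.*-assoc D (ℚ.1/ D) η)) (trans (cong (ℚ._* η) (ℚ.*-inverseʳ D)) (ℚ.*-identityˡ η))
  in
  (N₁ ℕ.⊔ N₂) ℕ.⊔ (N₃ ℕ.⊔ N₄) , λ k l a b →
    let a₁ = ℕ.m⊔n≤o⇒m≤o (N₁ ℕ.⊔ N₂) (N₃ ℕ.⊔ N₄) a
        a₂ = ℕ.m⊔n≤o⇒n≤o (N₁ ℕ.⊔ N₂) (N₃ ℕ.⊔ N₄) a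
        b₁ = ℕ.m⊔n≤o⇒m≤o (N₁ ℕ.⊔ N₂) (N₃ ℕ.⊔ N₄) b
        b₂ = ℕ.m⊔n≤o⇒n≤o (N₁ ℕ.⊔ N₂) (N₃ ℕ.⊔ N₄) b
        p = seq x k; q = seq x l; r = seq y k; s = seq y l
        u = *-mono-≤ (ℚ.0≤∣p∣ (r ℚ.- s)) (ℚ.<⇒≤ B>0)
              (f₁ k (ℕ.m⊔n≤o⇒m≤o N₁ N₂ a₁)) (f₃ k l (ℕ.m⊔n≤o⇒m≤o N₃ N₄ a₂) (ℕ.m⊔n≤o⇒m≤o N₃ N₄ b₂))
        v = *-mono-≤ (ℚ.0≤∣p∣ (p ℚ.- q)) (ℚ.<⇒≤ D>0)
              (f₂ l (ℕ.m⊔n≤o⇒n≤o N₁ N₂ b₁)) (f₄ k l (ℕ.m⊔n≤o⇒n≤o N₃ N₄ a₂) (ℕ.m⊔n≤o⇒n≤o N₃ N₄ b₂))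
    in subst₂ ℚ._≤_
      (cong ℚ.∣_∣ (solve 4 (λ p q r s → p :* (r :- s) :+ s :* (p :- q) := p :* r :- q :* s) refl p q r s))
      (trans (cong₂ ℚ._+_ cancelB cancelD) (halves δ))
      (ℚ.≤-trans (ℚ.∣p+q∣≤∣p∣+∣q∣ (p ℚ.* (r ℚ.- s)) (s ℚ.* (p ℚ.- q)))
        (ℚ.+-mono-≤ (ℚ.≤-trans (ℚ.≤-reflexive (ℚ.∣p*q∣≡∣p∣*∣q∣ p (r ℚ.- s))) u)
                    (ℚ.≤-trans (ℚ.≤-reflexive (ℚ.∣p*q∣≡∣p∣*∣q∣ s (p ℚ.- q))) v)))
  where open +-*-Solver

------------------------------------------------------------------------
-- Square roots and powers

greatest : {P : ℕ → Set} → Decidable P → ℕ → ℕ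
greatest P? zero    = zero
greatest P? (suc b) with P? (suc b)
... | yes _ = suc b
... | no  _ = greatest P? b

_⁺ _⁻ : ℤ → ℕ
(+ n)    ⁺ = n
-[1+ n ] ⁺ = 0
(+ n)    ⁻ = 0
-[1+ n ] ⁻ = suc n

frac : ℕ → ℕ → ℚ
frac m k = + m ℚ./ suc k

-- The greatest multiple m / (k + 1) whose square is at most q (0 if q < 0).
√-num : ℚ → ℕ → ℕ
√-num q k = greatest (λ m → (frac m k ℚ.* frac m k) ℚ.≤? q) (suc ℤ.∣ ↥ q ∣ ℕ.* suc k)

-- With q = a / b, the greatest multiple m / (k + 1) with (m / (k + 1)) ^ b ≤ n ^ a.
^-num : ℕ → ℚ → ℕ → ℕ
^-num n q k = greatest
  (λ m → (m ℕ.^ ↧ₙ q ℕ.* n ℕ.^ ((↥ q) ⁻)) ℕ.≤? (n ℕ.^ ((↥ q) ⁺) ℕ.* suc k ℕ.^ ↧ₙ q))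
  (n ℕ.^ ((↥ q) ⁺) ℕ.* suc k)

module RootAux where

  greatest-sat : ∀ {P} (P? : Decidable P) b → P (greatest P? b) ⊎ greatest P? b ≡ 0
  greatest-sat P? zero = inj₂ refl
  greatest-sat P? (suc b) with P? (suc b)
  ... | yes p = inj₁ p
  ... | no  _ = greatest-sat P? b

  greatest-max : ∀ {P} (P? : Decidable P) b → (∀ m → b ℕ.< m → ¬ P m) →
                 ∀ m → greatest P? b ℕ.< m → ¬ P m
  greatest-max P? zero h = h
  greatest-max {P} P? (suc b) h with P? (suc b)
  ... | yes p = h
  ... | no ¬p = greatest-max P? b λ m b<m → step m (ℕ.m≤n⇒m<n∨m≡n b<m)
    where
    step : ∀ m → suc b ℕ.< m ⊎ suc b ≡ m → ¬ P m
    step m (inj₁ lt)   = h m lt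
    step m (inj₂ refl) = ¬p

  frac-≃ : ∀ m k → toℚᵘ (frac m k) ℚᵘ.≃ mkℚᵘ (+ m) k
  frac-≃ m k = ℚ.toℚᵘ-fromℚᵘ (mkℚᵘ (+ m) k)

  frac-mono : ∀ {m k m′ k′} → m ℕ.* suc k′ ℕ.≤ m′ ℕ.* suc k → frac m k ℚ.≤ frac m′ k′
  frac-mono {m} {k} {m′} {k′} h = ℚ.toℚᵘ-cancel-≤
    (ℚᵘ.≤-respˡ-≃ (ℚᵘ.≃-sym (frac-≃ m k)) (ℚᵘ.≤-respʳ-≃ (ℚᵘ.≃-sym (frac-≃ m′ k′))
      (ℚᵘ.*≤* (subst₂ ℤ._≤_ (ℤ.pos-* m (suc k′)) (ℤ.pos-* m′ (suc k)) (ℤ.+≤+ h)))))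

  frac-≤-+ : ∀ {m k m′ l d} → m ℕ.* (suc l ℕ.* suc d) ℕ.≤ (m′ ℕ.* suc d ℕ.+ 1 ℕ.* suc l) ℕ.* suc k →
             frac m k ℚ.≤ frac m′ l ℚ.+ frac 1 d
  frac-≤-+ {m} {k} {m′} {l} {d} h = ℚ.toℚᵘ-cancel-≤
    (ℚᵘ.≤-respˡ-≃ (ℚᵘ.≃-sym (frac-≃ m k)) (ℚᵘ.≤-respʳ-≃ (ℚᵘ.≃-sym
      (ℚᵘ.≃-trans (ℚ.toℚᵘ-homo-+ (frac m′ l) (frac 1 d)) (ℚᵘ.+-cong (frac-≃ m′ l) (frac-≃ 1 d))))
      (ℚᵘ.*≤* (subst₂ ℤ._≤_ (ℤ.pos-* m (suc l ℕ.* suc d)) eq (ℤ.+≤+ h)))))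
    where
    eq : + ((m′ ℕ.* suc d ℕ.+ 1 ℕ.* suc l) ℕ.* suc k) ≡
         (+ m′ ℤ.* + suc d ℤ.+ + 1 ℤ.* + suc l) ℤ.* + suc k
    eq = trans (ℤ.pos-* (m′ ℕ.* suc d ℕ.+ 1 ℕ.* suc l) (suc k))
         (cong (ℤ._* + suc k) (trans (ℤ.pos-+ (m′ ℕ.* suc d) (1 ℕ.* suc l))
           (cong₂ ℤ._+_ (ℤ.pos-* m′ (suc d)) (ℤ.pos-* 1 (suc l)))))

  frac-suc : ∀ m k → frac (suc m) k ℚ.≤ frac m k ℚ.+ frac 1 k
  frac-suc m k = frac-≤-+ {suc m} {k} {m} {k} {k} (ℕ.≤-reflexive (lem m (suc k)))
    where
    lem : ∀ m K → suc m ℕ.* (K ℕ.* K) ≡ (m ℕ.* K ℕ.+ 1 ℕ.* K) ℕ.* K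
    lem = ℕSolver.solve-∀

  frac-pos : ∀ k → 0ℚ ℚ.< frac 1 k
  frac-pos k = ℚ.positive⁻¹ _ {{ℚ.normalize-pos 1 (suc k)}}

  0≤frac : ∀ m k → 0ℚ ℚ.≤ frac m k
  0≤frac m k = ℚ.nonNegative⁻¹ _ {{ℚ.normalize-nonNeg m (suc k)}}

  unit≤ : ∀ δ → 0ℚ ℚ.< δ → ∃[ d ] frac 1 d ℚ.≤ δ
  unit≤ (mkℚ (+ zero) d c) (ℚ.*<* h) = contradiction (subst (ℤ._< + 0) refl h) (ℤ.<-irrefl refl)
  unit≤ (mkℚ -[1+ p ] d c) (ℚ.*<* ())
  unit≤ δ@(mkℚ (+ suc p) d c) h = d , ℚ.toℚᵘ-cancel-≤ (ℚᵘ.≤-respˡ-≃ (ℚᵘ.≃-sym (frac-≃ 1 d))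
    (ℚᵘ.*≤* (ℤ.*-monoʳ-≤-nonNeg (+ suc d) {+ 1} {+ suc p} (ℤ.+≤+ (ℕ.s≤s ℕ.z≤n)))))

  <⇒≱ : ∀ {p q} → p ℚ.< q → ¬ (q ℚ.≤ p)
  <⇒≱ p<q q≤p = ℚ.<-irrefl refl (ℚ.<-≤-trans p<q q≤p)

  sq-cancel : ∀ {p q} → 0ℚ ℚ.≤ q → p ℚ.* p ℚ.≤ q ℚ.* q → p ℚ.≤ q
  sq-cancel {p} {q} q≥0 h with p ℚ.≤? q
  ... | yes p≤q = p≤q
  ... | no  p≰q = contradiction h (<⇒≱ (ℚ.≤-<-trans
          (ℚ.*-monoˡ-≤-nonNeg q {{ℚ.nonNegative q≥0}} (ℚ.<⇒≤ q<p))
          (ℚ.*-monoˡ-<-pos p {{ℚ.positive (ℚ.≤-<-trans q≥0 q<p)}} q<p)))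
    where q<p = ℚ.≰⇒> p≰q

  ≤num : ∀ q → q ℚ.≤ frac ℤ.∣ ↥ q ∣ 0
  ≤num q@(mkℚ a b c) = ℚ.toℚᵘ-cancel-≤ (ℚᵘ.≤-respʳ-≃ (ℚᵘ.≃-sym (frac-≃ ℤ.∣ a ∣ 0)) (ℚᵘ.*≤* (lem a)))
    where
    lem : ∀ a → a ℤ.* + 1 ℤ.≤ + ℤ.∣ a ∣ ℤ.* + suc b
    lem (+ a)    = subst₂ ℤ._≤_ (sym (ℤ.*-identityʳ (+ a))) (ℤ.pos-* a (suc b)) (ℤ.+≤+ (ℕ.m≤m*n a (suc b)))
    lem -[1+ a ] = ℤ.-≤+

  √-lo : ∀ q k → let v = frac (√-num q k) k in v ℚ.* v ℚ.≤ q ⊎ v ≡ 0ℚ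
  √-lo q k = Sum.map₂ (λ e → trans (cong (λ m → frac m k) e) (ℚ.0/n≡0 (suc k)))
    (greatest-sat {P = λ m → frac m k ℚ.* frac m k ℚ.≤ q} (λ m → (frac m k ℚ.* frac m k) ℚ.≤? q) (suc ℤ.∣ ↥ q ∣ ℕ.* suc k))

  √-hi : ∀ q k → let w = frac (suc (√-num q k)) k in q ℚ.≤ w ℚ.* w
  √-hi q k = ℚ.<⇒≤ (ℚ.≰⇒> (greatest-max {P = λ m → frac m k ℚ.* frac m k ℚ.≤ q} (λ m → (frac m k ℚ.* frac m k) ℚ.≤? q)
      (suc ℤ.∣ ↥ q ∣ ℕ.* suc k) big (suc (√-num q k)) ℕ.≤-refl))
    where
    T = suc ℤ.∣ ↥ q ∣
    big : ∀ m → T ℕ.* suc k ℕ.< m → ¬ (frac m k ℚ.* frac m k ℚ.≤ q)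
    big m lt h = <⇒≱ q<v² h
      where
      v = frac m k
      t = frac T 0
      t≤v : t ℚ.≤ v
      t≤v = frac-mono {T} {0} {m} {k} (subst (T ℕ.* suc k ℕ.≤_) (sym (ℕ.*-identityʳ m)) (ℕ.<⇒≤ lt))
      1≤v : 1ℚ ℚ.≤ v
      1≤v = ℚ.≤-trans (frac-mono {1} {0} {T} {0} (ℕ.s≤s ℕ.z≤n)) t≤v
      v≤v² : v ℚ.≤ v ℚ.* v
      v≤v² = subst (ℚ._≤ v ℚ.* v) (ℚ.*-identityˡ v) (ℚ.*-monoʳ-≤-nonNeg v {{ℚ.nonNegative (0≤frac m k)}} 1≤v)
      q<t : q ℚ.< t
      q<t = ℚ.≤-<-trans (≤num q) (ℚ.toℚᵘ-cancel-< (ℚᵘ.<-respˡ-≃ (ℚᵘ.≃-sym (frac-≃ ℤ.∣ ↥ q ∣ 0))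
        (ℚᵘ.<-respʳ-≃ (ℚᵘ.≃-sym (frac-≃ T 0)) (ℚᵘ.*<* (ℤ.*-monoʳ-<-pos (+ 1) {+ ℤ.∣ ↥ q ∣} {+ T} (ℤ.+<+ ℕ.≤-refl))))))
      q<v² = ℚ.<-≤-trans q<t (ℚ.≤-trans t≤v v≤v²)

  ^-cancelˡ-≤ : ∀ {a b} e .{{_ : NonZero e}} → a ℕ.^ e ℕ.≤ b ℕ.^ e → a ℕ.≤ b
  ^-cancelˡ-≤ {a} {b} e h with a ℕ.≤? b
  ... | yes a≤b = a≤b
  ... | no  a≰b = contradiction h (ℕ.<⇒≱ (ℕ.^-monoˡ-< e (ℕ.≰⇒> a≰b)))

  bernoulli : ∀ M n j → M ℕ.^ j ℕ.* (M ℕ.+ j ℕ.* n) ℕ.≤ M ℕ.* (M ℕ.+ n) ℕ.^ j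
  bernoulli M n zero    = ℕ.≤-reflexive (lem M)
    where
    lem : ∀ M → 1 ℕ.* (M ℕ.+ 0) ≡ M ℕ.* 1
    lem = ℕSolver.solve-∀
  bernoulli M n (suc j) = begin
    M ℕ.* X ℕ.* (M ℕ.+ (n ℕ.+ j ℕ.* n))                       ≤⟨ ℕ.m≤m+n _ (X ℕ.* (j ℕ.* n ℕ.* n)) ⟩
    M ℕ.* X ℕ.* (M ℕ.+ (n ℕ.+ j ℕ.* n)) ℕ.+ X ℕ.* (j ℕ.* n ℕ.* n) ≡⟨ lem M X n (j ℕ.* n) ⟩
    (M ℕ.+ n) ℕ.* (X ℕ.* (M ℕ.+ j ℕ.* n))                     ≤⟨ ℕ.*-monoʳ-≤ (M ℕ.+ n) (bernoulli M n j) ⟩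
    (M ℕ.+ n) ℕ.* (M ℕ.* (M ℕ.+ n) ℕ.^ j)                     ≡⟨ lem₂ (M ℕ.+ n) M ((M ℕ.+ n) ℕ.^ j) ⟩
    M ℕ.* ((M ℕ.+ n) ℕ.* (M ℕ.+ n) ℕ.^ j)                     ∎
    where
    open ℕ.≤-Reasoning
    X = M ℕ.^ j
    lem : ∀ M X n y → M ℕ.* X ℕ.* (M ℕ.+ (n ℕ.+ y)) ℕ.+ X ℕ.* (y ℕ.* n) ≡ (M ℕ.+ n) ℕ.* (X ℕ.* (M ℕ.+ y))
    lem = ℕSolver.solve-∀
    lem₂ : ∀ a M Y → a ℕ.* (M ℕ.* Y) ≡ M ℕ.* (a ℕ.* Y)
    lem₂ = ℕSolver.solve-∀

  n*M^M≤ : ∀ M n .{{_ : NonZero M}} → n ℕ.* M ℕ.^ M ℕ.≤ (M ℕ.+ n) ℕ.^ M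
  n*M^M≤ M n = ℕ.*-cancelˡ-≤ M (begin
    M ℕ.* (n ℕ.* M ℕ.^ M)                 ≤⟨ ℕ.m≤m+n _ (M ℕ.^ M ℕ.* M) ⟩
    M ℕ.* (n ℕ.* M ℕ.^ M) ℕ.+ M ℕ.^ M ℕ.* M ≡⟨ lem M n (M ℕ.^ M) ⟩
    M ℕ.^ M ℕ.* (M ℕ.+ M ℕ.* n)           ≤⟨ bernoulli M n M ⟩
    M ℕ.* (M ℕ.+ n) ℕ.^ M                 ∎)
    where
    open ℕ.≤-Reasoning
    lem : ∀ M n X → M ℕ.* (n ℕ.* X) ℕ.+ X ℕ.* M ≡ X ℕ.* (M ℕ.+ M ℕ.* n)
    lem = ℕSolver.solve-∀

  *-^ : ∀ a b e → (a ℕ.* b) ℕ.^ e ≡ a ℕ.^ e ℕ.* b ℕ.^ e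
  *-^ a b zero    = refl
  *-^ a b (suc e) = trans (cong (a ℕ.* b ℕ.*_) (*-^ a b e)) (lem a b (a ℕ.^ e) (b ℕ.^ e))
    where
    lem : ∀ a b x y → a ℕ.* b ℕ.* (x ℕ.* y) ≡ a ℕ.* x ℕ.* (b ℕ.* y)
    lem = ℕSolver.solve-∀

  raise : ∀ {a b n x y e} f → a ℕ.^ e ℕ.* n ℕ.^ x ℕ.≤ n ℕ.^ y ℕ.* b ℕ.^ e →
          a ℕ.^ (e ℕ.* f) ℕ.* n ℕ.^ (x ℕ.* f) ℕ.≤ n ℕ.^ (y ℕ.* f) ℕ.* b ℕ.^ (e ℕ.* f)
  raise {a} {b} {n} {x} {y} {e} f h = subst₂ ℕ._≤_
    (trans (*-^ (a ℕ.^ e) (n ℕ.^ x) f) (cong₂ ℕ._*_ (ℕ.^-*-assoc a e f) (ℕ.^-*-assoc n x f)))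
    (trans (*-^ (n ℕ.^ y) (b ℕ.^ e) f) (cong₂ ℕ._*_ (ℕ.^-*-assoc n y f) (ℕ.^-*-assoc b e f)))
    (ℕ.^-monoˡ-≤ f h)

  raise′ : ∀ {a b n x y e} f → n ℕ.^ y ℕ.* b ℕ.^ e ℕ.≤ a ℕ.^ e ℕ.* n ℕ.^ x →
           n ℕ.^ (y ℕ.* f) ℕ.* b ℕ.^ (e ℕ.* f) ℕ.≤ a ℕ.^ (e ℕ.* f) ℕ.* n ℕ.^ (x ℕ.* f)
  raise′ {a} {b} {n} {x} {y} {e} f h = subst₂ ℕ._≤_
    (trans (*-^ (n ℕ.^ y) (b ℕ.^ e) f) (cong₂ ℕ._*_ (ℕ.^-*-assoc n y f) (ℕ.^-*-assoc b e f)))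
    (trans (*-^ (a ℕ.^ e) (n ℕ.^ x) f) (cong₂ ℕ._*_ (ℕ.^-*-assoc a e f) (ℕ.^-*-assoc n x f)))
    (ℕ.^-monoˡ-≤ f h)

  key : ∀ n .{{_ : NonZero n}} {b c M K L m w x y x′ y′} .{{_ : NonZero b}} .{{_ : NonZero c}} .{{_ : NonZero M}} →
        m ℕ.^ b ℕ.* n ℕ.^ x ℕ.≤ n ℕ.^ y ℕ.* K ℕ.^ b →
        n ℕ.^ y′ ℕ.* L ℕ.^ c ℕ.≤ w ℕ.^ c ℕ.* n ℕ.^ x′ →
        y ℕ.* (c ℕ.* M) ℕ.+ x′ ℕ.* (b ℕ.* M) ℕ.≤ y′ ℕ.* (b ℕ.* M) ℕ.+ x ℕ.* (c ℕ.* M) ℕ.+ b ℕ.* c →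
        m ℕ.* L ℕ.* M ℕ.≤ w ℕ.* K ℕ.* (M ℕ.+ n)
  key n {b} {c} {M} {K} {L} {m} {w} {x} {y} {x′} {y′} h₁ h₂ h₃ =
    ^-cancelˡ-≤ e {{ℕ.m*n≢0 b (c ℕ.* M) {{it}} {{ℕ.m*n≢0 c M}}}} (begin
      (m ℕ.* L ℕ.* M) ℕ.^ e                              ≡⟨ trans (*-^ (m ℕ.* L) M e) (cong (ℕ._* M ℕ.^ e) (*-^ m L e)) ⟩
      m ℕ.^ e ℕ.* L ℕ.^ e ℕ.* M ℕ.^ e                    ≤⟨ ℕ.*-monoˡ-≤ (M ℕ.^ e) mid ⟩
      n ℕ.^ (b ℕ.* c) ℕ.* (w ℕ.^ e ℕ.* K ℕ.^ e) ℕ.* M ℕ.^ e ≡⟨ lem₁ (n ℕ.^ (b ℕ.* c)) (w ℕ.^ e ℕ.* K ℕ.^ e) (M ℕ.^ e) ⟩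
      w ℕ.^ e ℕ.* K ℕ.^ e ℕ.* (n ℕ.^ (b ℕ.* c) ℕ.* M ℕ.^ e) ≤⟨ ℕ.*-monoʳ-≤ (w ℕ.^ e ℕ.* K ℕ.^ e) bern ⟩
      w ℕ.^ e ℕ.* K ℕ.^ e ℕ.* (M ℕ.+ n) ℕ.^ e            ≡⟨ sym (trans (*-^ (w ℕ.* K) (M ℕ.+ n) e) (cong (ℕ._* (M ℕ.+ n) ℕ.^ e) (*-^ w K e))) ⟩
      (w ℕ.* K ℕ.* (M ℕ.+ n)) ℕ.^ e                      ∎)
    where
    open ℕ.≤-Reasoning
    open import Function using (it)
    e = b ℕ.* (c ℕ.* M)
    X = n ℕ.^ (x ℕ.* (c ℕ.* M))
    Y = n ℕ.^ (y ℕ.* (c ℕ.* M))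
    X′ = n ℕ.^ (x′ ℕ.* (b ℕ.* M))
    Y′ = n ℕ.^ (y′ ℕ.* (b ℕ.* M))
    lem₁ : ∀ p q r → p ℕ.* q ℕ.* r ≡ q ℕ.* (p ℕ.* r)
    lem₁ = ℕSolver.solve-∀
    cbM : c ℕ.* (b ℕ.* M) ≡ e
    cbM = lem b c M where
      lem : ∀ b c M → c ℕ.* (b ℕ.* M) ≡ b ℕ.* (c ℕ.* M)
      lem = ℕSolver.solve-∀
    bcM : M ℕ.* (b ℕ.* c) ≡ e
    bcM = lem b c M where
      lem : ∀ b c M → M ℕ.* (b ℕ.* c) ≡ b ℕ.* (c ℕ.* M)
      lem = ℕSolver.solve-∀
    r₁ : m ℕ.^ e ℕ.* X ℕ.≤ Y ℕ.* K ℕ.^ e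
    r₁ = raise {m} {K} {n} {x} {y} {b} (c ℕ.* M) h₁
    r₂ : Y′ ℕ.* L ℕ.^ e ℕ.≤ w ℕ.^ e ℕ.* X′
    r₂ = subst (λ e → Y′ ℕ.* L ℕ.^ e ℕ.≤ w ℕ.^ e ℕ.* X′) cbM (raise′ {w} {L} {n} {x′} {y′} {c} (b ℕ.* M) h₂)
    r₃ : Y ℕ.* X′ ℕ.≤ Y′ ℕ.* X ℕ.* n ℕ.^ (b ℕ.* c)
    r₃ = subst₂ ℕ._≤_ (ℕ.^-distribˡ-+-* n (y ℕ.* (c ℕ.* M)) (x′ ℕ.* (b ℕ.* M)))
      (trans (ℕ.^-distribˡ-+-* n (y′ ℕ.* (b ℕ.* M) ℕ.+ x ℕ.* (c ℕ.* M)) (b ℕ.* c))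
        (cong (ℕ._* n ℕ.^ (b ℕ.* c)) (ℕ.^-distribˡ-+-* n (y′ ℕ.* (b ℕ.* M)) (x ℕ.* (c ℕ.* M)))))
      (ℕ.^-monoʳ-≤ n h₃)
    mid : m ℕ.^ e ℕ.* L ℕ.^ e ℕ.≤ n ℕ.^ (b ℕ.* c) ℕ.* (w ℕ.^ e ℕ.* K ℕ.^ e)
    mid = ℕ.*-cancelˡ-≤ (Y′ ℕ.* X)
      {{ℕ.m*n≢0 Y′ X {{ℕ.m^n≢0 n (y′ ℕ.* (b ℕ.* M))}} {{ℕ.m^n≢0 n (x ℕ.* (c ℕ.* M))}}}} (begin
      Y′ ℕ.* X ℕ.* (m ℕ.^ e ℕ.* L ℕ.^ e)                ≡⟨ l₁ Y′ X (m ℕ.^ e) (L ℕ.^ e) ⟩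
      m ℕ.^ e ℕ.* X ℕ.* (Y′ ℕ.* L ℕ.^ e)                ≤⟨ ℕ.*-mono-≤ r₁ r₂ ⟩
      Y ℕ.* K ℕ.^ e ℕ.* (w ℕ.^ e ℕ.* X′)                ≡⟨ l₂ Y (K ℕ.^ e) (w ℕ.^ e) X′ ⟩
      Y ℕ.* X′ ℕ.* (w ℕ.^ e ℕ.* K ℕ.^ e)                ≤⟨ ℕ.*-monoˡ-≤ (w ℕ.^ e ℕ.* K ℕ.^ e) r₃ ⟩
      Y′ ℕ.* X ℕ.* n ℕ.^ (b ℕ.* c) ℕ.* (w ℕ.^ e ℕ.* K ℕ.^ e) ≡⟨ ℕ.*-assoc (Y′ ℕ.* X) (n ℕ.^ (b ℕ.* c)) (w ℕ.^ e ℕ.* K ℕ.^ e) ⟩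
      Y′ ℕ.* X ℕ.* (n ℕ.^ (b ℕ.* c) ℕ.* (w ℕ.^ e ℕ.* K ℕ.^ e)) ∎)
      where
      l₁ : ∀ y x m l → y ℕ.* x ℕ.* (m ℕ.* l) ≡ m ℕ.* x ℕ.* (y ℕ.* l)
      l₁ = ℕSolver.solve-∀
      l₂ : ∀ y k w x → y ℕ.* k ℕ.* (w ℕ.* x) ≡ y ℕ.* x ℕ.* (w ℕ.* k)
      l₂ = ℕSolver.solve-∀
    bern : n ℕ.^ (b ℕ.* c) ℕ.* M ℕ.^ e ℕ.≤ (M ℕ.+ n) ℕ.^ e
    bern = subst₂ ℕ._≤_
      (trans (*-^ n (M ℕ.^ M) (b ℕ.* c)) (cong (n ℕ.^ (b ℕ.* c) ℕ.*_) (trans (ℕ.^-*-assoc M M (b ℕ.* c)) (cong (M ℕ.^_) bcM))))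
      (trans (ℕ.^-*-assoc (M ℕ.+ n) M (b ℕ.* c)) (cong ((M ℕ.+ n) ℕ.^_) bcM))
      (ℕ.^-monoˡ-≤ (b ℕ.* c) (n*M^M≤ M n))

  ^-lo : ∀ n q k → ^-num n q k ℕ.^ ↧ₙ q ℕ.* n ℕ.^ ((↥ q) ⁻) ℕ.≤ n ℕ.^ ((↥ q) ⁺) ℕ.* suc k ℕ.^ ↧ₙ q
  ^-lo n (mkℚ a b _) k = Sum.[ (λ p → p) , (λ e → subst P (sym e) ℕ.z≤n) ]′
      (greatest-sat {P = P} (λ m → _ ℕ.≤? _) (n ℕ.^ (a ⁺) ℕ.* suc k))
    where
    P : ℕ → Set
    P m = m ℕ.^ suc b ℕ.* n ℕ.^ (a ⁻) ℕ.≤ n ℕ.^ (a ⁺) ℕ.* suc k ℕ.^ suc b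

  ^-hi : ∀ n .{{_ : NonZero n}} q k →
         n ℕ.^ ((↥ q) ⁺) ℕ.* suc k ℕ.^ ↧ₙ q ℕ.≤ suc (^-num n q k) ℕ.^ ↧ₙ q ℕ.* n ℕ.^ ((↥ q) ⁻)
  ^-hi n q@(mkℚ a b _) k = ℕ.<⇒≤ (ℕ.≰⇒> (greatest-max
    {P = λ m → m ℕ.^ suc b ℕ.* n ℕ.^ (a ⁻) ℕ.≤ n ℕ.^ (a ⁺) ℕ.* suc k ℕ.^ suc b}
    (λ m → (m ℕ.^ suc b ℕ.* n ℕ.^ (a ⁻)) ℕ.≤? (n ℕ.^ (a ⁺) ℕ.* suc k ℕ.^ suc b)) (n ℕ.^ (a ⁺) ℕ.* suc k)
    big (suc (^-num n q k)) ℕ.≤-refl))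
    where
    open ℕ.≤-Reasoning
    N = n ℕ.^ (a ⁺)
    instance
      N≢0 : NonZero N
      N≢0 = ℕ.m^n≢0 n (a ⁺)
    big : ∀ m → N ℕ.* suc k ℕ.< m → ¬ (m ℕ.^ suc b ℕ.* n ℕ.^ (a ⁻) ℕ.≤ N ℕ.* suc k ℕ.^ suc b)
    big m lt = ℕ.<⇒≱ (begin-strict
      N ℕ.* suc k ℕ.^ suc b            ≤⟨ ℕ.*-monoˡ-≤ (suc k ℕ.^ suc b) (ℕ.m≤m*n N (N ℕ.^ b) {{ℕ.m^n≢0 N b}}) ⟩
      N ℕ.^ suc b ℕ.* suc k ℕ.^ suc b  ≡⟨ sym (*-^ N (suc k) (suc b)) ⟩
      (N ℕ.* suc k) ℕ.^ suc b          <⟨ ℕ.^-monoˡ-< (suc b) lt ⟩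
      m ℕ.^ suc b                      ≤⟨ ℕ.m≤m*n (m ℕ.^ suc b) (n ℕ.^ (a ⁻)) {{ℕ.m^n≢0 n (a ⁻)}} ⟩
      m ℕ.^ suc b ℕ.* n ℕ.^ (a ⁻)      ∎)

  ⁺-⁻ : ∀ a → a ≡ + (a ⁺) ℤ.- + (a ⁻)
  ⁺-⁻ (+ n)    = sym (ℤ.+-identityʳ (+ n))
  ⁺-⁻ -[1+ n ] = refl

  ^-bound : ∀ n .{{_ : NonZero n}} q k E → q ℚ.≤ frac E 0 → ^-num n q k ℕ.≤ n ℕ.^ E ℕ.* suc k
  ^-bound n q@(mkℚ a b _) k E h = ^-cancelˡ-≤ (suc b) (ℕ.*-cancelʳ-≤ _ _ (n ℕ.^ (a ⁻)) {{ℕ.m^n≢0 n (a ⁻)}} (begin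
    ^-num n q k ℕ.^ suc b ℕ.* n ℕ.^ (a ⁻)                         ≤⟨ ^-lo n q k ⟩
    n ℕ.^ (a ⁺) ℕ.* suc k ℕ.^ suc b                               ≤⟨ ℕ.*-monoˡ-≤ (suc k ℕ.^ suc b) (ℕ.^-monoʳ-≤ n bd) ⟩
    n ℕ.^ (E ℕ.* suc b ℕ.+ a ⁻) ℕ.* suc k ℕ.^ suc b               ≡⟨ cong (ℕ._* suc k ℕ.^ suc b) (ℕ.^-distribˡ-+-* n (E ℕ.* suc b) (a ⁻)) ⟩
    n ℕ.^ (E ℕ.* suc b) ℕ.* n ℕ.^ (a ⁻) ℕ.* suc k ℕ.^ suc b       ≡⟨ cong (λ z → z ℕ.* n ℕ.^ (a ⁻) ℕ.* suc k ℕ.^ suc b) (sym (ℕ.^-*-assoc n E (suc b))) ⟩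
    (n ℕ.^ E) ℕ.^ suc b ℕ.* n ℕ.^ (a ⁻) ℕ.* suc k ℕ.^ suc b       ≡⟨ lem ((n ℕ.^ E) ℕ.^ suc b) (n ℕ.^ (a ⁻)) (suc k ℕ.^ suc b) ⟩
    (n ℕ.^ E) ℕ.^ suc b ℕ.* suc k ℕ.^ suc b ℕ.* n ℕ.^ (a ⁻)       ≡⟨ cong (ℕ._* n ℕ.^ (a ⁻)) (sym (*-^ (n ℕ.^ E) (suc k) (suc b))) ⟩
    (n ℕ.^ E ℕ.* suc k) ℕ.^ suc b ℕ.* n ℕ.^ (a ⁻)                 ∎))
    where
    open ℕ.≤-Reasoning
    lem : ∀ x y z → x ℕ.* y ℕ.* z ≡ x ℕ.* z ℕ.* y
    lem = ℕSolver.solve-∀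
    aux : a ℤ.* + 1 ℤ.≤ + E ℤ.* + suc b
    aux with ℚᵘ.≤-respʳ-≃ (frac-≃ E 0) (ℚ.toℚᵘ-mono-≤ h)
    ... | ℚᵘ.*≤* r = r
    bd′ : ∀ a → a ℤ.* + 1 ℤ.≤ + E ℤ.* + suc b → a ⁺ ℕ.≤ E ℕ.* suc b ℕ.+ a ⁻
    bd′ (+ a) r = subst (a ℕ.≤_) (sym (ℕ.+-identityʳ (E ℕ.* suc b)))
      (ℤ.drop‿+≤+ (subst₂ ℤ._≤_ (ℤ.*-identityʳ (+ a)) (sym (ℤ.pos-* E (suc b))) r))
    bd′ -[1+ a ] r = ℕ.z≤n
    bd = bd′ a aux

  exponents : ∀ p q M → p ℚ.≤ q ℚ.+ frac 1 M →
              (↥ p) ⁺ ℕ.* (↧ₙ q ℕ.* suc M) ℕ.+ (↥ q) ⁻ ℕ.* (↧ₙ p ℕ.* suc M) ℕ.≤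
              (↥ q) ⁺ ℕ.* (↧ₙ p ℕ.* suc M) ℕ.+ (↥ p) ⁻ ℕ.* (↧ₙ q ℕ.* suc M) ℕ.+ ↧ₙ p ℕ.* ↧ₙ q
  exponents p@(mkℚ a b _) q@(mkℚ a′ c _) M h = ℤ.drop‿+≤+ (subst₂ ℤ._≤_ e₁ e₂
      (ℤ.+-monoˡ-≤ ((+ (a ⁻)) ℤ.* (C ℤ.* Mz) ℤ.+ + (a′ ⁻) ℤ.* (B ℤ.* Mz)) main))
    where
    B = + suc b
    C = + suc c
    Mz = + suc M
    raw : a ℤ.* (+ (suc c ℕ.* suc M)) ℤ.≤ (a′ ℤ.* Mz ℤ.+ + 1 ℤ.* C) ℤ.* B
    raw with ℚᵘ.≤-respʳ-≃ (ℚᵘ.≃-trans (ℚ.toℚᵘ-homo-+ q (frac 1 M)) (ℚᵘ.+-congʳ (toℚᵘ q) (frac-≃ 1 M))) (ℚ.toℚᵘ-mono-≤ h)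
    ... | ℚᵘ.*≤* r = r
    main : (+ (a ⁺) ℤ.- + (a ⁻)) ℤ.* (C ℤ.* Mz) ℤ.≤ ((+ (a′ ⁺) ℤ.- + (a′ ⁻)) ℤ.* Mz ℤ.+ + 1 ℤ.* C) ℤ.* B
    main = subst₂ ℤ._≤_ (cong₂ ℤ._*_ (⁺-⁻ a) (ℤ.pos-* (suc c) (suc M)))
      (cong (λ z → (z ℤ.* Mz ℤ.+ + 1 ℤ.* C) ℤ.* B) (⁺-⁻ a′)) raw
    push : ∀ u v w → + u ℤ.* (+ v ℤ.* + w) ≡ + (u ℕ.* (v ℕ.* w))
    push u v w = trans (cong (+ u ℤ.*_) (sym (ℤ.pos-* v w))) (sym (ℤ.pos-* u (v ℕ.* w)))
    s₁ : ∀ p m q D E → (p ℤ.- m) ℤ.* D ℤ.+ (m ℤ.* D ℤ.+ q ℤ.* E) ≡ p ℤ.* D ℤ.+ q ℤ.* E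
    s₁ = ℤSolver.solve-∀
    s₂ : ∀ p m p′ B C M → ((p′ ℤ.- m) ℤ.* M ℤ.+ + 1 ℤ.* C) ℤ.* B ℤ.+ (p ℤ.* (C ℤ.* M) ℤ.+ m ℤ.* (B ℤ.* M)) ≡
         p′ ℤ.* (B ℤ.* M) ℤ.+ p ℤ.* (C ℤ.* M) ℤ.+ B ℤ.* C
    s₂ = ℤSolver.solve-∀
    e₁ = trans (s₁ (+ (a ⁺)) (+ (a ⁻)) (+ (a′ ⁻)) (C ℤ.* Mz) (B ℤ.* Mz))
      (cong₂ ℤ._+_ (push (a ⁺) (suc c) (suc M)) (push (a′ ⁻) (suc b) (suc M)))
    e₂ = trans (s₂ (+ (a ⁻)) (+ (a′ ⁻)) (+ (a′ ⁺)) B C Mz)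
      (cong₂ ℤ._+_ (cong₂ ℤ._+_ (push (a′ ⁺) (suc b) (suc M)) (push (a ⁻) (suc c) (suc M))) (sym (ℤ.pos-* (suc b) (suc c))))

  combine : ∀ n E d {m m′ K L} → let D = suc ((n ℕ.^ E ℕ.+ 1) ℕ.* n); M = D ℕ.* suc d in
            m ℕ.* L ℕ.* M ℕ.≤ suc m′ ℕ.* K ℕ.* (M ℕ.+ n) → m′ ℕ.≤ n ℕ.^ E ℕ.* L → M ℕ.≤ L → 1 ℕ.≤ L →
            m ℕ.* (L ℕ.* suc d) ℕ.≤ (m′ ℕ.* suc d ℕ.+ 1 ℕ.* L) ℕ.* K
  combine n E d {m} {m′} {K} {L} h h′ M≤L 1≤L = ℕ.*-cancelˡ-≤ D (begin
    D ℕ.* (m ℕ.* (L ℕ.* suc d))                                    ≡⟨ l₁ D m L (suc d) ⟩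
    m ℕ.* L ℕ.* M                                                  ≤⟨ h ⟩
    suc m′ ℕ.* K ℕ.* (M ℕ.+ n)                                     ≡⟨ l₂ m′ K M n ⟩
    m′ ℕ.* K ℕ.* M ℕ.+ K ℕ.* M ℕ.+ (m′ ℕ.+ 1) ℕ.* (K ℕ.* n)        ≤⟨ ℕ.+-mono-≤ (ℕ.+-monoʳ-≤ (m′ ℕ.* K ℕ.* M) (ℕ.*-monoʳ-≤ K M≤L)) (ℕ.*-monoˡ-≤ (K ℕ.* n) (ℕ.+-mono-≤ h′ 1≤L)) ⟩
    m′ ℕ.* K ℕ.* M ℕ.+ K ℕ.* L ℕ.+ (n ℕ.^ E ℕ.* L ℕ.+ L) ℕ.* (K ℕ.* n) ≡⟨ l₃ m′ K L n (n ℕ.^ E) (suc d) ⟩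
    D ℕ.* ((m′ ℕ.* suc d ℕ.+ 1 ℕ.* L) ℕ.* K)                       ∎)
    where
    open ℕ.≤-Reasoning
    D = suc ((n ℕ.^ E ℕ.+ 1) ℕ.* n)
    M = D ℕ.* suc d
    l₁ : ∀ D m L d → D ℕ.* (m ℕ.* (L ℕ.* d)) ≡ m ℕ.* L ℕ.* (D ℕ.* d)
    l₁ = ℕSolver.solve-∀
    l₂ : ∀ m K M n → suc m ℕ.* K ℕ.* (M ℕ.+ n) ≡ m ℕ.* K ℕ.* M ℕ.+ K ℕ.* M ℕ.+ (m ℕ.+ 1) ℕ.* (K ℕ.* n)
    l₂ = ℕSolver.solve-∀
    l₃ : ∀ m K L n N d → m ℕ.* K ℕ.* (suc ((N ℕ.+ 1) ℕ.* n) ℕ.* d) ℕ.+ K ℕ.* L ℕ.+ (N ℕ.* L ℕ.+ L) ℕ.* (K ℕ.* n) ≡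
         suc ((N ℕ.+ 1) ℕ.* n) ℕ.* ((m ℕ.* d ℕ.+ 1 ℕ.* L) ℕ.* K)
    l₃ = ℕSolver.solve-∀

open RootAux

√_ : ℝ → ℝ
√ x = oneSided (λ k → frac (√-num (seq x k) k) k) λ δ δ>0 →
  let η = ½ ℚ.* δ
      η>0 = *-pos 0<½ δ>0
      (d , 1/d≤η) = unit≤ η η>0
      (N , f) = cauchy x (η ℚ.* η) (*-pos η>0 η>0)
  in N ℕ.⊔ d , λ k l a b →
    let v = frac (√-num (seq x k) k) k
        u = frac (√-num (seq x l) l) l
        w = frac (suc (√-num (seq x l) l)) l
        u≥0 = 0≤frac (√-num (seq x l) l) l
        w≥0 = 0≤frac (suc (√-num (seq x l) l)) l
        d≤l = ℕ.m⊔n≤o⇒n≤o N d b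
        w≤u+η = ℚ.≤-trans (frac-suc (√-num (seq x l) l) l) (ℚ.+-monoʳ-≤ u
          (ℚ.≤-trans (frac-mono {1} {l} {1} {d} (ℕ.*-monoʳ-≤ 1 (ℕ.s≤s d≤l))) 1/d≤η))
        w+η≤u+δ = subst (w ℚ.+ η ℚ.≤_) (trans (ℚ.+-assoc u η η) (cong (u ℚ.+_) (halves δ)))
          (ℚ.+-monoˡ-≤ η w≤u+η)
        qk≤ = dist≤⇒≤ {seq x k} {seq x l} (f k l (ℕ.m⊔n≤o⇒m≤o N d a) (ℕ.m⊔n≤o⇒m≤o N d b))
        square = ℚ.≤-trans qk≤ (ℚ.≤-trans (ℚ.+-monoˡ-≤ (η ℚ.* η) (√-hi (seq x l) l))
          (sumSq w η w≥0 (ℚ.<⇒≤ η>0)))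
    in close v u (w ℚ.+ η) (seq x k) δ (√-lo (seq x k) k) square (ℚ.+-mono-≤ w≥0 (ℚ.<⇒≤ η>0)) w+η≤u+δ
          (ℚ.+-mono-≤ u≥0 (ℚ.<⇒≤ δ>0))
  where
  sumSq : ∀ w η → 0ℚ ℚ.≤ w → 0ℚ ℚ.≤ η → w ℚ.* w ℚ.+ η ℚ.* η ℚ.≤ (w ℚ.+ η) ℚ.* (w ℚ.+ η)
  sumSq w η w≥0 η≥0 = subst₂ ℚ._≤_ (ℚ.+-identityʳ _)
    (solve 2 (λ w η → w :* w :+ η :* η :+ (w :* η :+ w :* η) := (w :+ η) :* (w :+ η)) refl w η)
    (ℚ.+-monoʳ-≤ (w ℚ.* w ℚ.+ η ℚ.* η) (ℚ.+-mono-≤ wη≥0 wη≥0))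
    where
    open +-*-Solver
    wη≥0 : 0ℚ ℚ.≤ w ℚ.* η
    wη≥0 = ℚ.nonNegative⁻¹ _ {{ℚ.nonNeg*nonNeg⇒nonNeg w {{ℚ.nonNegative w≥0}} η {{ℚ.nonNegative η≥0}}}}
  close : ∀ v u t q δ → v ℚ.* v ℚ.≤ q ⊎ v ≡ 0ℚ → q ℚ.≤ t ℚ.* t → 0ℚ ℚ.≤ t → t ℚ.≤ u ℚ.+ δ →
          0ℚ ℚ.≤ u ℚ.+ δ → v ℚ.≤ u ℚ.+ δ
  close v u t q δ (inj₁ h) q≤t² t≥0 t≤ _ = ℚ.≤-trans (sq-cancel t≥0 (ℚ.≤-trans h q≤t²)) t≤
  close v u t q δ (inj₂ e) _ _ _ r = subst (ℚ._≤ u ℚ.+ δ) (sym e) r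

_^_ : (n : ℕ) .{{_ : NonZero n}} → ℝ → ℝ
n ^ x = oneSided (λ k → frac (^-num n (seq x k) k) k) λ δ δ>0 →
  let (d , 1/d≤δ) = unit≤ δ δ>0
      (B , _ , N₁ , f₁) = evBound x
      E = ℤ.∣ ↥ B ∣
      D₀ = (n ℕ.^ E ℕ.+ 1) ℕ.* n
      M₀ = d ℕ.+ D₀ ℕ.* suc d
      (N₂ , f₂) = cauchy x (frac 1 M₀) (frac-pos M₀)
  in (N₁ ℕ.⊔ N₂) ℕ.⊔ M₀ , λ k l a b →
    let p = seq x k
        q = seq x l
        b₁ = ℕ.m⊔n≤o⇒m≤o (N₁ ℕ.⊔ N₂) M₀ b
        a₁ = ℕ.m⊔n≤o⇒m≤o (N₁ ℕ.⊔ N₂) M₀ a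
        p≤q = dist≤⇒≤ {p} {q} (f₂ k l (ℕ.m⊔n≤o⇒n≤o N₁ N₂ a₁) (ℕ.m⊔n≤o⇒n≤o N₁ N₂ b₁))
        q≤E = ℚ.≤-trans (ℚ.≤-trans (p≤∣p∣ q) (f₁ l (ℕ.m⊔n≤o⇒m≤o N₁ N₂ b₁))) (≤num B)
        main = key n {↧ₙ p} {↧ₙ q} {suc M₀} {suc k} {suc l} {^-num n p k} {suc (^-num n q l)}
                 {(↥ p) ⁻} {(↥ p) ⁺} {(↥ q) ⁻} {(↥ q) ⁺}
                 (^-lo n p k) (^-hi n q l) (exponents p q M₀ p≤q)
    in ℚ.≤-trans
         (frac-≤-+ {^-num n p k} {k} {^-num n q l} {l} {d}
           (combine n E d {^-num n p k} {^-num n q l} {suc k} {suc l} main (^-bound n q l E q≤E)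
             (ℕ.s≤s (ℕ.m⊔n≤o⇒n≤o (N₁ ℕ.⊔ N₂) M₀ b)) (ℕ.s≤s ℕ.z≤n)))
         (ℚ.+-monoʳ-≤ (frac (^-num n q l) l) 1/d≤δ)

------------------------------------------------------------------------
-- Euclidean space and lattice points

ℝ³ ℤ³ : Set
ℝ³ = Vec ℝ 3
ℤ³ = Vec ℤ 3

toℝ³ : ℤ³ → ℝ³
toℝ³ = map fromℤ

_≋_ : ℝ³ → ℝ³ → Set
_≋_ = Pointwise _≈_

∥_∥ : ℝ³ → ℝ
∥ x ∷ y ∷ z ∷ [] ∥ = √ (x * x + y * y + z * z)

dist : ℝ³ → ℝ³ → ℝ
dist x y = ∥ zipWith _-_ x y ∥

Sphere : ℝ → Pred ℝ³ _
Sphere r x = ∥ x ∥ ≈ r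

𝓔 : ℕ → Pred ℤ³ _
𝓔 n (x ∷ y ∷ z ∷ []) = x ℤ.* x ℤ.+ y ℤ.* y ℤ.+ z ℤ.* z ≡ + n

DiameterAtMost : ∀ {a} → Pred ℝ³ a → ℝ → Set a
DiameterAtMost A D = ∀ {x y} → x ∈ A → y ∈ A → dist x y ≤ D

-- The index type is a setoid so that, for instance, the partition into singletons can be
-- indexed by the points of S up to _≋_.  Covering is stated with ¬ ¬ because constructively
-- a point of S cannot in general be located in one of several pieces that share a boundary.
record IsPartition {j ℓ s a} (J : Setoid j ℓ) (S : Pred ℝ³ s) (A : Setoid.Carrier J → Pred ℝ³ a)
                   : Set (j ⊔ ℓ ⊔ s ⊔ a) where
  private module J = Setoid J
  field
    respects : ∀ {i j x y} → i J.≈ j → x ≋ y → x ∈ A i → y ∈ A j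
    pieces⊆  : ∀ j → A j ⊆ S
    covers   : ∀ {x} → x ∈ S → ¬ ¬ (∃[ j ] x ∈ A j)
    disjoint : ∀ {i j x} → x ∈ A i → x ∈ A j → i J.≈ j

HasCardinality : ∀ {a p} {X : Set a} → Pred X p → ℕ → Set (a ⊔ p)
HasCardinality P k = ∃[ xs ] Unique xs × (∀ x → x ∈ˡ xs ⇔ P x) × length xs ≡ k

{-# OPTIONS --safe #-}
-- The sum counts pairs (x, y) of lattice points in a common piece, hence pairs on the sphere with
-- 0 ≤ n − x·y ≪ √n.  Pairs with y = ± x are counted by r₃(n) ≪ n^(1/2+ε).  For the others write x = g a with a
-- coprime, y = k a + l b with (a, b) a basis of the saturated lattice spanned by x and y and 0 ≤ k < l.  The Gram
-- matrix (A B; B C) of (a, b), of determinant m, is determined by x·y, g, l and k.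
--
-- The number of bases with a given Gram matrix is O(τ(m)).  Modulo m one has a × b ≡ ρ a + σ b with
-- ρ² ≡ −C, ρσ ≡ B, σ² ≡ −A, and gcd(ρ, σ, m) = 1; two solutions of these congruences agree modulo a divisor e
-- of m and are opposite modulo m / e, so e determines (ρ, σ) up to factors of 2.  When the invariants of two
-- bases agree up to a factor of 2, twice the rational rotation taking one basis to the other is integral, and
-- there are finitely many such matrices.
--
-- It remains to sum over the O(√n) values of x·y.  The parameters g, l and A = n / g² divide numbers at most n²,
-- which costs n^ε by the divisor bound.  Given these, k has d = gcd(A, l) possible values, and d divides
-- (n − x·y) / g, so that d is compensated by the smaller number of admissible values of x·y.  The bound for
-- r₃(n) is the same count for the pairs (e₁, y) with e₁·y prescribed.
module Submission where

open import Data.Integer as ℤ using (ℤ; +_; -[1+_]; 0ℤ; 1ℤ; -1ℤ)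
import Data.Integer.DivMod as ℤD
open import Data.Integer.Divisibility.Signed as ℤ using (_∣_; divides)
import Data.Integer.Properties as ℤ
import Data.Integer.Tactic.RingSolver as ℤSolver
open import Data.List as List using (List; []; _∷_; filter; length; map; sum; upTo)
open import Data.List.Membership.Propositional using () renaming (_∈_ to _∈ˡ_)
import Data.List.Membership.Propositional.Properties as Mem
import Data.List.Properties as List
open import Data.List.Relation.Unary.All as All using (All; []; _∷_)
import Data.List.Relation.Unary.All.Properties as All
open import Data.List.Relation.Unary.AllPairs using ([]; _∷_)
open import Data.List.Relation.Unary.Any using (here; there)
open import Data.List.Relation.Unary.Unique.Propositional using () renaming (Unique to Uniqueˡ)
import Data.List.Relation.Unary.Unique.Propositional.Properties as Uniqueₚ
open import Data.List.Relation.Unary.Unique.Setoid using (Unique)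
open import Data.Nat as ℕ using (ℕ; zero; suc; NonZero; NonTrivial; nonTrivial⇒n>1)
import Data.Nat.Coprimality as ℕC
import Data.Nat.DivMod as ℕ
import Data.Nat.Divisibility as ℕ
open import Data.Nat.GCD as GCD using (gcd; module Bézout)
open import Data.Nat.Induction using (<-rec)
open import Data.Nat.Primality
open import Data.Nat.Primality.Factorisation using (factorise)
import Data.Nat.Properties as ℕ
import Data.Nat.Tactic.RingSolver as ℕSolver
open import Data.Product as Product using (∃-syntax; Σ-syntax; _×_; _,_; proj₁; proj₂)
open import Data.Rational as ℚ using (ℚ; ½; mkℚ; ↥_; ↧ₙ_; toℚᵘ)
import Data.Rational.Properties as ℚ
open import Data.Rational.Unnormalised as ℚᵘ using (mkℚᵘ)
import Data.Rational.Unnormalised.Properties as ℚᵘ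
open import Data.Sum as Sum using (_⊎_; inj₁; inj₂)
open import Data.Vec using ([]; _∷_)
open import Function using (Equivalence)
open import Level using (Level)
open import Relation.Binary using (Setoid)
open import Relation.Binary.PropositionalEquality using (_≡_; _≢_; refl; sym; trans; cong; cong₂; subst; subst₂; module ≡-Reasoning)
open import Relation.Nullary using (¬_; yes; no; contradiction)
open import Relation.Unary using (Pred; Decidable; _∈_; _⊆_; _∩_; _∪_)
open import Defs using (greatest; module RootAux)
open RootAux using (*-^; greatest-sat; greatest-max)

-- Counting

-- The pieces have diameter ≪ n^(1/4) and |x - y|² = 2 (n - x·y), so n - x·y has O(√n) values. These
-- alone exhaust the bound: everything else may cost only n^ε, and k is the one parameter that could
-- cost more. Agreement modulo e and opposition modulo m / e are Gauss's lemma: the product of ρ -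
-- ρ₀ + (σ - σ₀) T and ρ + ρ₀ + (σ + σ₀) T has coefficients ρ² - ρ₀², 2 (ρσ - ρ₀σ₀) and σ² - σ₀²,
-- all 0 modulo m, and e is the gcd of m with the coefficients of the first factor. A common divisor
-- of e and m / e divides m, 2ρ₀ and 2σ₀, hence 2; this is the source of the factor 2. The rotation
-- is nearly integral for this reason: m z = p a + q b + γ (a × b) with p ≡ -γρ and q ≡ -γσ modulo
-- m, so the same coefficients applied to a basis with the same invariant again give a vector
-- divisible by m. The loss n^ε enters as a natural number t with t^k ≤ c n². All counting thus
-- takes place in ℕ, and real numbers occur only in reading off the distance bound and in the final
-- comparison.

private variable
  ℓ₁ ℓ₂ ℓ₃ : Level

-- Cardinality is tested on duplicate-free lists, which makes sense for undecidable predicates and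
-- requires no enumeration of them.
AtMost : {X : Set ℓ₁} → Pred X ℓ₂ → ℕ → Set _
AtMost P b = ∀ xs → Uniqueˡ xs → All P xs → length xs ℕ.≤ b

atMost-mono : ∀ {X : Set ℓ₁} {P : Pred X ℓ₂} {Q : Pred X ℓ₃} {b c} → P ⊆ Q → b ℕ.≤ c → AtMost Q b → AtMost P c
atMost-mono P⊆Q b≤c h xs u ps = ℕ.≤-trans (h xs u (All.map P⊆Q ps)) b≤c

atMost-one : ∀ {X : Set ℓ₁} {P : Pred X ℓ₂} → (∀ {x y} → P x → P y → x ≡ y) → AtMost P 1
atMost-one h []           _                  _             = ℕ.z≤n
atMost-one h (x ∷ [])     _                  _             = ℕ.≤-refl
atMost-one h (x ∷ y ∷ xs) ((x≢y ∷ _) ∷ _) (px ∷ py ∷ _) = contradiction (h px py) x≢y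

-- Without an element there is nothing to count. This is how a reference object, with which all
-- others are compared, enters each count.
atMost-witness : ∀ {X : Set ℓ₁} {P : Pred X ℓ₂} {b} → (∀ x → P x → AtMost P b) → AtMost P b
atMost-witness h []       u ps          = ℕ.z≤n
atMost-witness h (x ∷ xs) u ps@(px ∷ _) = h x px (x ∷ xs) u ps

private
  -- Each element goes to the side named by its proof, as neither predicate is decidable. The last
  -- clause carries freshness through the recursion.
  separate : {X : Set ℓ₁} {P : Pred X ℓ₂} {Q : Pred X ℓ₃} (xs : List X) → Uniqueˡ xs → All (P ∪ Q) xs →
    ∃[ ys ] ∃[ zs ] Uniqueˡ ys × All P ys × Uniqueˡ zs × All Q zs × length xs ≡ length ys ℕ.+ length zs ×
      (∀ x → All (x ≢_) xs → All (x ≢_) ys × All (x ≢_) zs)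
  separate []       _        _        = [] , [] , [] , [] , [] , [] , refl , λ _ _ → [] , []
  separate (x ∷ xs) (x∉ ∷ u) (p ∷ ps) with separate xs u ps
  ... | ys , zs , uy , py , uz , qz , eq , fresh with p
  ...   | inj₁ px = x ∷ ys , zs , proj₁ (fresh x x∉) ∷ uy , px ∷ py , uz , qz , cong ℕ.suc eq ,
                    λ { v (n ∷ ns) → n ∷ proj₁ (fresh v ns) , proj₂ (fresh v ns) }
  ...   | inj₂ qx = ys , x ∷ zs , uy , py , proj₂ (fresh x x∉) ∷ uz , qx ∷ qz ,
                    trans (cong ℕ.suc eq) (sym (ℕ.+-suc (length ys) (length zs))) ,
                    λ { v (n ∷ ns) → proj₁ (fresh v ns) , n ∷ proj₂ (fresh v ns) }

atMost-∪ : ∀ {X : Set ℓ₁} {P : Pred X ℓ₂} {Q : Pred X ℓ₃} {b c} → AtMost P b → AtMost Q c → AtMost (P ∪ Q) (b ℕ.+ c)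
atMost-∪ f g xs u ps =
  let (ys , zs , uy , py , uz , qz , eq , _) = separate xs u ps
  in subst (ℕ._≤ _) (sym eq) (ℕ.+-mono-≤ (f ys uy py) (g zs uz qz))

atMost-⋃ : ∀ {X : Set ℓ₁} {Y : Set ℓ₂} {R : Y → Pred X ℓ₃} {b} (ys : List Y) →
           (∀ {y} → y ∈ˡ ys → AtMost (R y) b) →
           AtMost (λ x → ∃[ y ] y ∈ˡ ys × R y x) (length ys ℕ.* b)
atMost-⋃ [] h []      _ _                    = ℕ.z≤n
atMost-⋃ [] h (_ ∷ _) _ ((_ , () , _) ∷ _)
atMost-⋃ {R = R} (y ∷ ys) h = atMost-mono first∪rest ℕ.≤-refl
  (atMost-∪ (h (here refl)) (atMost-⋃ ys (λ y∈ → h (there y∈))))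
  where
  first∪rest : ∀ {x} → (∃[ v ] v ∈ˡ (y ∷ ys) × R v x) → R y x ⊎ (∃[ v ] v ∈ˡ ys × R v x)
  first∪rest (_ , here refl , r) = inj₁ r
  first∪rest (v , there v∈ , r)  = inj₂ (v , v∈ , r)

-- Pick a preimage of each element: the images are distinct, hence so are the preimages.
atMost-image : ∀ {X : Set ℓ₁} {Y : Set ℓ₂} {Q : Pred Y ℓ₃} {b} (f : Y → X) → AtMost Q b →
               AtMost (λ x → ∃[ y ] Q y × x ≡ f y) b
atMost-image {X = X} {Y} {Q} f h xs u ps =
  let (ys , eq , qs) = preimages xs ps
  in subst (ℕ._≤ _) (trans (sym (List.length-map f ys)) (cong length (sym eq)))
       (h ys (Uniqueₚ.map⁻ (subst Uniqueˡ eq u)) qs)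
  where
  preimages : ∀ xs → All (λ x → ∃[ y ] Q y × x ≡ f y) xs → ∃[ ys ] xs ≡ List.map f ys × All Q ys
  preimages []       []                     = [] , refl , []
  preimages (x ∷ xs) ((y , q , e) ∷ ps) = let (ys , eq , qs) = preimages xs ps in y ∷ ys , cong₂ _∷_ e eq , q ∷ qs

-- The divisor bound

divisors : ℕ → List ℕ
divisors n = filter (ℕ._∣? n) (upTo (suc n))

∈-divisors : ∀ {d n} .{{_ : NonZero n}} → d ℕ.∣ n → d ∈ˡ divisors n
∈-divisors d∣n = Mem.∈-filter⁺ (ℕ._∣? _) (Mem.∈-upTo⁺ (ℕ.s≤s (ℕ.∣⇒≤ d∣n))) d∣n

length-divisors : ∀ {n t} → AtMost (ℕ._∣ n) t → length (divisors n) ℕ.≤ t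
length-divisors {n} h = h (divisors n)
  (Uniqueₚ.filter⁺ (ℕ._∣? n) (Uniqueₚ.upTo⁺ (suc n))) (All.all-filter (ℕ._∣? n) (upTo (suc n)))

private
  ∣p*n : ∀ {p d n} → Prime p → d ℕ.∣ p ℕ.* n → d ℕ.∣ n ⊎ ∃[ e ] d ≡ p ℕ.* e × e ℕ.∣ n
  ∣p*n {p} {d} {n} pr d∣pn with p ℕ.∣? d
  ... | yes (ℕ.divides e eq) = inj₂ (e , d≡pe , ℕ.*-cancelˡ-∣ p {{prime⇒nonZero pr}} (subst (ℕ._∣ p ℕ.* n) d≡pe d∣pn))
    where d≡pe = trans eq (ℕ.*-comm e p)
  ... | no p∤d = inj₁ (ℕC.coprime-divisor coprime d∣pn)
    where
    coprime : ℕC.Coprime d p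
    coprime {i} (i∣d , i∣p) with prime⇒irreducible pr i∣p
    ... | inj₁ i≡1 = i≡1
    ... | inj₂ i≡p = contradiction (subst (ℕ._∣ d) i≡p i∣d) p∤d

  ∣p^a*n : ∀ {p d n} → Prime p → ∀ a → d ℕ.∣ p ℕ.^ a ℕ.* n → ∃[ i ] i ℕ.≤ a × ∃[ e ] e ℕ.∣ n × d ≡ p ℕ.^ i ℕ.* e
  ∣p^a*n {d = d} {n} pr zero    h = 0 , ℕ.z≤n , d , subst (d ℕ.∣_) (ℕ.*-identityˡ n) h , sym (ℕ.*-identityˡ d)
  ∣p^a*n {p} {d} {n} pr (suc a) h with ∣p*n pr (subst (d ℕ.∣_) (ℕ.*-assoc p (p ℕ.^ a) n) h)
  ... | inj₁ h′ = let (i , i≤a , rest) = ∣p^a*n pr a h′ in i , ℕ.m≤n⇒m≤1+n i≤a , rest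
  ... | inj₂ (e , eq , h′) = let (i , i≤a , e′ , e′∣n , eq′) = ∣p^a*n pr a h′ in
        suc i , ℕ.s≤s i≤a , e′ , e′∣n , trans eq (trans (cong (p ℕ.*_) eq′) (sym (ℕ.*-assoc p (p ℕ.^ i) e′)))

atMost-∣p^a*n : ∀ {p n t} → Prime p → ∀ a → AtMost (ℕ._∣ n) t → AtMost (ℕ._∣ (p ℕ.^ a ℕ.* n)) (suc a ℕ.* t)
atMost-∣p^a*n {p} {n} {t} pr a h = atMost-mono
  (λ d∣ → let (i , i≤a , w) = ∣p^a*n pr a d∣ in i , Mem.∈-upTo⁺ (ℕ.s≤s i≤a) , w)
  (ℕ.≤-reflexive (cong (ℕ._* t) (List.length-upTo (suc a))))
  (atMost-⋃ (upTo (suc a)) (λ {i} _ → atMost-image (p ℕ.^ i ℕ.*_) h))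

removePower : ∀ p .{{_ : NonTrivial p}} n .{{_ : NonZero n}} → ∃[ a ] ∃[ n′ ] n ≡ p ℕ.^ a ℕ.* n′ × p ℕ.∤ n′
removePower p n = <-rec (λ n → .{{_ : NonZero n}} → ∃[ a ] ∃[ n′ ] n ≡ p ℕ.^ a ℕ.* n′ × p ℕ.∤ n′) step n
  where
  step : ∀ n → (∀ {i} → i ℕ.< n → .{{_ : NonZero i}} → ∃[ a ] ∃[ n′ ] i ≡ p ℕ.^ a ℕ.* n′ × p ℕ.∤ n′) →
         .{{_ : NonZero n}} → ∃[ a ] ∃[ n′ ] n ≡ p ℕ.^ a ℕ.* n′ × p ℕ.∤ n′
  step n rec with p ℕ.∣? n
  ... | no p∤n = 0 , n , sym (ℕ.*-identityˡ n) , p∤n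
  ... | yes p∣n@(ℕ.divides q eq) =
    let (a , n′ , eq′ , p∤n′) = rec (ℕ.quotient-< p∣n) {{ℕ.m*n≢0⇒m≢0 q {{subst NonZero eq it}}}}
    in suc a , n′ , trans eq (trans (ℕ.*-comm q p) (trans (cong (p ℕ.*_) eq′) (sym (ℕ.*-assoc p (p ℕ.^ a) n′)))) , p∤n′
    where
    it : NonZero n
    it = ℕ.>-nonZero (ℕ.n≢0⇒n>0 (ℕ.≢-nonZero⁻¹ n))

-- A rough number is a product of primes p ≥ 2 ^ k, each of which at most doubles the number of divisors.
roughDivisors : ∀ k n .{{_ : NonZero n}} → (2 ℕ.^ k) Rough n → ∃[ t ] AtMost (ℕ._∣ n) t × t ℕ.^ k ℕ.≤ n
roughDivisors k n = <-rec (λ n → .{{_ : NonZero n}} → (2 ℕ.^ k) Rough n → ∃[ t ] AtMost (ℕ._∣ n) t × t ℕ.^ k ℕ.≤ n) step n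
  where
  step : ∀ n → (∀ {i} → i ℕ.< n → .{{_ : NonZero i}} → (2 ℕ.^ k) Rough i → ∃[ t ] AtMost (ℕ._∣ i) t × t ℕ.^ k ℕ.≤ i) →
         .{{_ : NonZero n}} → (2 ℕ.^ k) Rough n → ∃[ t ] AtMost (ℕ._∣ n) t × t ℕ.^ k ℕ.≤ n
  step n rec rough with factorise n
  ... | record { factors = [] ; isFactorisation = refl } =
        1 , atMost-one (λ d e → trans (ℕ.∣1⇒≡1 d) (sym (ℕ.∣1⇒≡1 e))) , ℕ.≤-reflexive (ℕ.^-zeroˡ k)
  ... | record { factors = p ∷ ps ; isFactorisation = refl ; factorsPrime = pr ∷ prs } =
        let m = List.foldr ℕ._*_ 1 ps
            instance
              m≢0 : NonZero m
              m≢0 = productOfPrimes≢0 prs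
              p≢1 : NonTrivial p
              p≢1 = prime⇒nonTrivial pr
            (t , h , t^k≤m) = rec (subst (m ℕ.<_) (ℕ.*-comm m p) (ℕ.m<m*n m p (nonTrivial⇒n>1 p))) (rough∧∣⇒rough rough (ℕ.n∣m*n p))
            2^k≤p = rough⇒≤ (rough∧∣⇒rough rough (ℕ.m∣m*n {p} m))
        in 2 ℕ.* t
         , subst (λ z → AtMost (ℕ._∣ z) (2 ℕ.* t)) (cong (ℕ._* m) (ℕ.*-identityʳ p)) (atMost-∣p^a*n pr 1 h)
         , subst (ℕ._≤ p ℕ.* m) (sym (*-^ 2 t k)) (ℕ.*-mono-≤ 2^k≤p t^k≤m)

n<2^n : ∀ n → suc n ℕ.≤ 2 ℕ.^ n
n<2^n zero    = ℕ.≤-refl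
n<2^n (suc n) = subst (suc (suc n) ℕ.≤_) (cong (2 ℕ.^ n ℕ.+_) (sym (ℕ.+-identityʳ (2 ℕ.^ n))))
  (ℕ.+-mono-≤ (ℕ.m^n>0 2 n) (n<2^n n))

-- Writing a = r + q k with r < k, one has a + 1 ≤ k (q + 1) ≤ k 2 ^ q.
[1+a]^k≤ : ∀ k .{{_ : NonZero k}} a → suc a ℕ.^ k ℕ.≤ k ℕ.^ k ℕ.* 2 ℕ.^ a
[1+a]^k≤ k a = begin
  suc a ℕ.^ k                    ≤⟨ ℕ.^-monoˡ-≤ k a<k2^q ⟩
  (k ℕ.* 2 ℕ.^ q) ℕ.^ k          ≡⟨ *-^ k (2 ℕ.^ q) k ⟩
  k ℕ.^ k ℕ.* (2 ℕ.^ q) ℕ.^ k    ≡⟨ cong (k ℕ.^ k ℕ.*_) (ℕ.^-*-assoc 2 q k) ⟩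
  k ℕ.^ k ℕ.* 2 ℕ.^ (q ℕ.* k)    ≤⟨ ℕ.*-monoʳ-≤ (k ℕ.^ k) (ℕ.^-monoʳ-≤ 2 (ℕ.m/n*n≤m a k)) ⟩
  k ℕ.^ k ℕ.* 2 ℕ.^ a            ∎
  where
  open ℕ.≤-Reasoning
  q = a ℕ./ k
  a<k2^q : suc a ℕ.≤ k ℕ.* 2 ℕ.^ q
  a<k2^q = begin
    suc a                        ≡⟨ cong suc (ℕ.m≡m%n+[m/n]*n a k) ⟩
    suc (a ℕ.% k) ℕ.+ q ℕ.* k    ≤⟨ ℕ.+-monoˡ-≤ (q ℕ.* k) (ℕ.m%n<n a k) ⟩
    suc q ℕ.* k                  ≡⟨ ℕ.*-comm (suc q) k ⟩
    k ℕ.* suc q                  ≤⟨ ℕ.*-monoʳ-≤ k (n<2^n q) ⟩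
    k ℕ.* 2 ℕ.^ q                ∎

private
  -- The `f` candidates from `j` up to 2 ^ k + 1 are still to be removed. If `j` divides the
  -- `j`-rough `n`, then `j` is prime, and removing j ^ a costs only the factor k ^ k because (a +
  -- 1) ^ k ≤ k ^ k * 2 ^ a ≤ k ^ k * j ^ a. What is left at the end is 2 ^ k-rough.
  roughDivisors′ : ∀ k .{{_ : NonZero k}} f j → 2 ℕ.≤ j → j ℕ.+ f ≡ 2 ℕ.+ 2 ℕ.^ k → ∀ n .{{_ : NonZero n}} → j Rough n →
    ∃[ t ] AtMost (ℕ._∣ n) t × t ℕ.^ k ℕ.≤ (k ℕ.^ k) ℕ.^ f ℕ.* n
  roughDivisors′ k zero j _ eq n rough =
    let (t , h , b) = roughDivisors k n (λ divisor → rough (ℕ.hasNonTrivialDivisor-≤ divisor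
          (subst (2 ℕ.^ k ℕ.≤_) (trans (sym eq) (ℕ.+-identityʳ j)) (ℕ.m≤n+m (2 ℕ.^ k) 2))))
    in t , h , subst (t ℕ.^ k ℕ.≤_) (sym (ℕ.*-identityˡ n)) b
  roughDivisors′ k (suc f) j 2≤j eq n rough with j ℕ.∣? n
  ... | no j∤n =
    let (t , h , b) = roughDivisors′ k f (suc j) (ℕ.m≤n⇒m≤1+n 2≤j) (trans (sym (ℕ.+-suc j f)) eq) n (∤⇒rough-suc j∤n rough)
    in t , h , ℕ.≤-trans b (ℕ.*-monoˡ-≤ n (ℕ.m≤n*m ((k ℕ.^ k) ℕ.^ f) (k ℕ.^ k) {{ℕ.m^n≢0 k k}}))
  ... | yes j∣n with removePower j {{ℕ.n>1⇒nonTrivial 2≤j}} n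
  ...   | a , n′ , refl , j∤n′ =
    let instance
          j≢1 : NonTrivial j
          j≢1 = ℕ.n>1⇒nonTrivial 2≤j
          n′≢0 : NonZero n′
          n′≢0 = ℕ.m*n≢0⇒n≢0 (j ℕ.^ a)
        (t , h , b) = roughDivisors′ k f (suc j) (ℕ.m≤n⇒m≤1+n 2≤j) (trans (sym (ℕ.+-suc j f)) eq) n′
                        (∤⇒rough-suc j∤n′ (rough∧∣⇒rough rough (ℕ.n∣m*n (j ℕ.^ a))))
    in suc a ℕ.* t , atMost-∣p^a*n (rough∧∣⇒prime rough j∣n) a h , (begin
      (suc a ℕ.* t) ℕ.^ k                                   ≡⟨ *-^ (suc a) t k ⟩
      suc a ℕ.^ k ℕ.* t ℕ.^ k                               ≤⟨ ℕ.*-mono-≤ ([1+a]^k≤ k a) b ⟩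
      k ℕ.^ k ℕ.* 2 ℕ.^ a ℕ.* ((k ℕ.^ k) ℕ.^ f ℕ.* n′)      ≤⟨ ℕ.*-monoˡ-≤ _ (ℕ.*-monoʳ-≤ (k ℕ.^ k) (ℕ.^-monoˡ-≤ a 2≤j)) ⟩
      k ℕ.^ k ℕ.* j ℕ.^ a ℕ.* ((k ℕ.^ k) ℕ.^ f ℕ.* n′)      ≡⟨ lem (k ℕ.^ k) (j ℕ.^ a) ((k ℕ.^ k) ℕ.^ f) n′ ⟩
      (k ℕ.^ k) ℕ.^ suc f ℕ.* (j ℕ.^ a ℕ.* n′)              ∎)
    where
    open ℕ.≤-Reasoning
    lem : ∀ x y z w → x ℕ.* y ℕ.* (z ℕ.* w) ≡ x ℕ.* z ℕ.* (y ℕ.* w)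
    lem = ℕSolver.solve-∀

-- This is τ(n) ≪ n^(1/k), stated for k-th powers to stay in ℕ. The constant pays k ^ k for each of
-- the 2 ^ k candidates 2, ..., 2 ^ k + 1.
divisorBound : ∀ k .{{_ : NonZero k}} → ∃[ c ] ∀ n .{{_ : NonZero n}} → ∃[ t ] AtMost (ℕ._∣ n) t × t ℕ.^ k ℕ.≤ c ℕ.* n
divisorBound k = (k ℕ.^ k) ℕ.^ (2 ℕ.^ k) , λ n → roughDivisors′ k (2 ℕ.^ k) 2 ℕ.≤-refl refl n 2-rough

module LatticePairs where

  open import Data.Integer using (_+_; _*_; _-_; -_)

  -- Divisibility of integers

  private
    +∣i∣≡s*i : ∀ i → ∃[ s ] + ℤ.∣ i ∣ ≡ s * i
    +∣i∣≡s*i (+ n)    = + 1 , sym (ℤ.*-identityˡ (+ n))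
    +∣i∣≡s*i -[1+ n ] = -[1+ 0 ] , sym (ℤ.-1*i≡-i -[1+ n ])

  bézout : ∀ a b → ∃[ g ] (+ g ∣ a) × (+ g ∣ b) × ∃[ x ] ∃[ y ] + g ≡ x * a + y * b
  bézout a b = g , ℤ.∣ᵤ⇒∣ (GCD.gcd[m,n]∣m m n) , ℤ.∣ᵤ⇒∣ (GCD.gcd[m,n]∣n m n) , identity (Bézout.identity (GCD.gcd-GCD m n))
    where
    m = ℤ.∣ a ∣
    n = ℤ.∣ b ∣
    g = gcd m n
    s = proj₁ (+∣i∣≡s*i a)
    t = proj₁ (+∣i∣≡s*i b)
    as : ∀ u → + (u ℕ.* m) ≡ + u * (s * a)
    as u = trans (ℤ.pos-* u m) (cong (λ k → + u * k) (proj₂ (+∣i∣≡s*i a)))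
    bs : ∀ u → + (u ℕ.* n) ≡ + u * (t * b)
    bs u = trans (ℤ.pos-* u n) (cong (λ k → + u * k) (proj₂ (+∣i∣≡s*i b)))
    solveˡ : ∀ {g x y} → g + y ≡ x → g ≡ x - y
    solveˡ {g} {x} {y} refl = lem g y
      where
      lem : ∀ g y → g ≡ g + y - y
      lem = ℤSolver.solve-∀
    identity : Bézout.Identity g m n → ∃[ x ] ∃[ y ] + g ≡ x * a + y * b
    identity (Bézout.+- u v eq) = + u * s , - (+ v * t) ,
      trans (solveˡ (trans (cong (λ k → + g + k) (sym (bs v))) (trans (cong +_ eq) (as u)))) (lem (+ u) s a (+ v) t b)
      where
      lem : ∀ u s a v t b → u * (s * a) - v * (t * b) ≡ u * s * a + - (v * t) * b
      lem = ℤSolver.solve-∀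
    identity (Bézout.-+ u v eq) = - (+ u * s) , + v * t ,
      trans (solveˡ (trans (cong (λ k → + g + k) (sym (as u))) (trans (cong +_ eq) (bs v)))) (lem (+ u) s a (+ v) t b)
      where
      lem : ∀ u s a v t b → v * (t * b) - u * (s * a) ≡ - (u * s) * a + v * t * b
      lem = ℤSolver.solve-∀

  bézout₃ : ∀ a b c → ∃[ g ] (+ g ∣ a) × (+ g ∣ b) × (+ g ∣ c) × ∃[ x ] ∃[ y ] ∃[ z ] + g ≡ x * a + y * b + z * c
  bézout₃ a b c =
    let (h , h∣a , h∣b , x , y , eq) = bézout a b
        (g , g∣h , g∣c , s , t , eq′) = bézout (+ h) c
    in g , ℤ.∣-trans g∣h h∣a , ℤ.∣-trans g∣h h∣b , g∣c , s * x , s * y , t ,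
       trans eq′ (trans (cong (λ k → s * k + t * c) eq) (lem s x a y b t c))
    where
    lem : ∀ s x a y b t c → s * (x * a + y * b) + t * c ≡ s * x * a + s * y * b + t * c
    lem = ℤSolver.solve-∀

  coprime⇒∣ : ∀ f p₁ p₂ X x y z → 1ℤ ≡ x * p₁ + y * p₂ + z * f → f ∣ p₁ * X → f ∣ p₂ * X → f ∣ X
  coprime⇒∣ f p₁ p₂ X x y z one h₁ h₂ = subst (f ∣_)
    (trans (lem x p₁ y p₂ z f X) (trans (cong (_* X) (sym one)) (ℤ.*-identityˡ X)))
    (ℤ.∣m∣n⇒∣m+n (ℤ.∣m∣n⇒∣m+n (ℤ.∣n⇒∣m*n x h₁) (ℤ.∣n⇒∣m*n y h₂)) (ℤ.∣n⇒∣m*n (z * X) ℤ.∣-refl))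
    where
    lem : ∀ x p₁ y p₂ z f X → x * (p₁ * X) + y * (p₂ * X) + z * X * f ≡ (x * p₁ + y * p₂ + z * f) * X
    lem = ℤSolver.solve-∀

  -- Gauss's lemma modulo `f`: the product of p₁ + p₂ T and q₁ + q₂ T vanishes, and the first factor
  -- is primitive. Both p₁² q₂ and p₁ p₂ q₂ are multiples of `f`, hence so is p₁ q₂, and then q₂.
  coprime⇒∣q₂ : ∀ f p₁ p₂ q₁ q₂ x y z → 1ℤ ≡ x * p₁ + y * p₂ + z * f →
                f ∣ p₁ * q₁ → f ∣ p₂ * q₂ → f ∣ p₁ * q₂ + p₂ * q₁ → f ∣ q₂
  coprime⇒∣q₂ f p₁ p₂ q₁ q₂ x y z one h₁ h₂ h₃ = coprime⇒∣ f p₁ p₂ q₂ x y z one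
    (coprime⇒∣ f p₁ p₂ (p₁ * q₂) x y z one
      (subst (f ∣_) (lem₁ p₁ p₂ q₁ q₂) (ℤ.∣m∣n⇒∣m-n (ℤ.∣n⇒∣m*n p₁ h₃) (ℤ.∣n⇒∣m*n p₂ h₁)))
      (subst (f ∣_) (lem₂ p₁ p₂ q₂) (ℤ.∣n⇒∣m*n p₁ h₂)))
    h₂
    where
    lem₁ : ∀ p₁ p₂ q₁ q₂ → p₁ * (p₁ * q₂ + p₂ * q₁) - p₂ * (p₁ * q₁) ≡ p₁ * (p₁ * q₂)
    lem₁ = ℤSolver.solve-∀
    lem₂ : ∀ p₁ p₂ q₂ → p₁ * (p₂ * q₂) ≡ p₂ * (p₁ * q₂)
    lem₂ = ℤSolver.solve-∀

  private
    cancelFactor : ∀ e .{{_ : NonZero e}} f X {Y} → Y ≡ X * + e → + (f ℕ.* e) ∣ Y → + f ∣ X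
    cancelFactor e f X Y≡ h = ℤ.*-cancelʳ-∣ (+ e) (subst₂ _∣_ (ℤ.pos-* f e) Y≡ h)

  -- Take e = gcd(P₁, P₂, m) and f = m / e. Dividing the three divisibilities by e leaves linear
  -- forms P / e, primitive modulo f, and Q, to which Gauss's lemma applies.
  splitModulus : ∀ m .{{_ : NonZero m}} P₁ P₂ Q₁ Q₂ → + m ∣ P₁ * Q₁ → + m ∣ P₂ * Q₂ → + m ∣ P₁ * Q₂ + P₂ * Q₁ →
    ∃[ e ] ∃[ f ] m ≡ f ℕ.* e × (+ e ∣ P₁) × (+ e ∣ P₂) × (+ f ∣ Q₁) × (+ f ∣ Q₂)
  splitModulus m P₁ P₂ Q₁ Q₂ h₁ h₂ h₃ =
    let (e , e∣P₁ , e∣P₂ , e∣m , x , y , z , eq) = bézout₃ P₁ P₂ (+ m)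
        ℕ.divides f m≡fe = ℤ.∣⇒∣ᵤ e∣m
        (f∣Q₁ , f∣Q₂) = go e f m≡fe e∣P₁ e∣P₂ x y z eq
    in e , f , m≡fe , e∣P₁ , e∣P₂ , f∣Q₁ , f∣Q₂
    where
    go : ∀ e f → m ≡ f ℕ.* e → + e ∣ P₁ → + e ∣ P₂ → ∀ x y z → + e ≡ x * P₁ + y * P₂ + z * + m → (+ f ∣ Q₁) × (+ f ∣ Q₂)
    go e f m≡fe (divides p₁ eq₁) (divides p₂ eq₂) x y z eq =
      coprime⇒∣q₂ (+ f) p₂ p₁ Q₂ Q₁ y x z one′ f∣p₂Q₂ f∣p₁Q₁ (subst (+ f ∣_) (ℤ.+-comm (p₁ * Q₂) (p₂ * Q₁)) f∣sum) ,
      coprime⇒∣q₂ (+ f) p₁ p₂ Q₁ Q₂ x y z one f∣p₁Q₁ f∣p₂Q₂ f∣sum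
      where
      instance
        e≢0 : NonZero e
        e≢0 = ℕ.m*n≢0⇒n≢0 f {{subst NonZero m≡fe (ℕ.>-nonZero (ℕ.n≢0⇒n>0 (ℕ.≢-nonZero⁻¹ m)))}}
      swap : ∀ p e q → p * e * q ≡ p * q * e
      swap = ℤSolver.solve-∀
      swap₂ : ∀ p e q r s → p * e * q + r * e * s ≡ (p * q + r * s) * e
      swap₂ = ℤSolver.solve-∀
      collect : ∀ x y z p₁ p₂ f e → x * (p₁ * e) + y * (p₂ * e) + z * (f * e) ≡ (x * p₁ + y * p₂ + z * f) * e
      collect = ℤSolver.solve-∀
      reduce : ∀ X {Y} → Y ≡ X * + e → + m ∣ Y → + f ∣ X
      reduce X Y≡ h = cancelFactor e f X Y≡ (subst (λ k → + k ∣ _) m≡fe h)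
      f∣p₁Q₁ : + f ∣ p₁ * Q₁
      f∣p₁Q₁ = reduce (p₁ * Q₁) (trans (cong (_* Q₁) eq₁) (swap p₁ (+ e) Q₁)) h₁
      f∣p₂Q₂ : + f ∣ p₂ * Q₂
      f∣p₂Q₂ = reduce (p₂ * Q₂) (trans (cong (_* Q₂) eq₂) (swap p₂ (+ e) Q₂)) h₂
      f∣sum : + f ∣ p₁ * Q₂ + p₂ * Q₁
      f∣sum = reduce (p₁ * Q₂ + p₂ * Q₁) (trans (cong₂ (λ u v → u * Q₂ + v * Q₁) eq₁ eq₂) (swap₂ p₁ (+ e) Q₂ p₂ Q₁)) h₃
      one : 1ℤ ≡ x * p₁ + y * p₂ + z * + f
      one = ℤ.*-cancelʳ-≡ 1ℤ (x * p₁ + y * p₂ + z * + f) (+ e) (trans (ℤ.*-identityˡ (+ e)) (trans eq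
        (trans (cong₂ _+_ (cong₂ (λ u v → x * u + y * v) eq₁ eq₂) (cong (z *_) (trans (cong +_ m≡fe) (ℤ.pos-* f e))))
          (collect x y z p₁ p₂ (+ f) (+ e)))))
      one′ : 1ℤ ≡ y * p₂ + x * p₁ + z * + f
      one′ = trans one (cong (_+ z * + f) (ℤ.+-comm (x * p₁) (y * p₂)))

  -- The lcm of e and f is e f / gcd(e, f), and the gcd divides 2.
  ∣∧∣⇒∣2* : ∀ e f X → + e ∣ X → + f ∣ X → (∀ {d} → d ∣ + e → d ∣ + f → d ∣ + 2) → + (e ℕ.* f) ∣ + 2 * X
  ∣∧∣⇒∣2* e f X (divides q eq) (divides r eq′) gcd∣2 with bézout (+ e) (+ f)
  ... | g , g∣e , g∣f , x , y , eqg with gcd∣2 g∣e g∣f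
  ...   | divides k eq2 = divides (k * (x * r + y * q)) (begin
    + 2 * X                                                    ≡⟨ cong (_* X) (trans eq2 (cong (k *_) eqg)) ⟩
    k * (x * + e + y * + f) * X                                ≡⟨ split k x (+ e) y (+ f) X ⟩
    k * (x * (+ e * X) + y * (+ f * X))                        ≡⟨ cong₂ (λ u v → k * (x * (+ e * u) + y * (+ f * v))) eq′ eq ⟩
    k * (x * (+ e * (r * + f)) + y * (+ f * (q * + e)))        ≡⟨ collect k x (+ e) y (+ f) r q ⟩
    k * (x * r + y * q) * (+ e * + f)                          ≡⟨ cong (k * (x * r + y * q) *_) (sym (ℤ.pos-* e f)) ⟩
    k * (x * r + y * q) * + (e ℕ.* f)                          ∎)
    where
    open ≡-Reasoning
    split : ∀ k x e y f X → k * (x * e + y * f) * X ≡ k * (x * (e * X) + y * (f * X))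
    split = ℤSolver.solve-∀
    collect : ∀ k x e y f r q → k * (x * (e * (r * f)) + y * (f * (q * e))) ≡ k * (x * r + y * q) * (e * f)
    collect = ℤSolver.solve-∀

  -- Bases of sublattices of ℤ³ with a given Gram matrix

  -- As a record, unlike `Vec`, vectors enjoy eta, so that coordinatewise identities over variables
  -- settle vector identities.
  record V : Set where
    constructor ⟨_,_,_⟩
    field x₁ x₂ x₃ : ℤ
  open V

  infixl 8 _∙_ _⨯_
  _∙_ : V → V → ℤ
  v ∙ w = x₁ v * x₁ w + x₂ v * x₂ w + x₃ v * x₃ w

  _⨯_ : V → V → V
  v ⨯ w = ⟨ x₂ v * x₃ w - x₃ v * x₂ w , x₃ v * x₁ w - x₁ v * x₃ w , x₁ v * x₂ w - x₂ v * x₁ w ⟩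

  e₁ e₂ e₃ : V
  e₁ = ⟨ + 1 , + 0 , + 0 ⟩
  e₂ = ⟨ + 0 , + 1 , + 0 ⟩
  e₃ = ⟨ + 0 , + 0 , + 1 ⟩

  V-≡ : ∀ {v w} → x₁ v ≡ x₁ w → x₂ v ≡ x₂ w → x₃ v ≡ x₃ w → v ≡ w
  V-≡ refl refl refl = refl

  ∙-comm : ∀ v w → v ∙ w ≡ w ∙ v
  ∙-comm v w = raw (x₁ v) (x₂ v) (x₃ v) (x₁ w) (x₂ w) (x₃ w)
    where
    raw : ∀ a b c d e f → a * d + b * e + c * f ≡ d * a + e * b + f * c
    raw = ℤSolver.solve-∀

  ∙e₁ : ∀ v → v ∙ e₁ ≡ x₁ v
  ∙e₁ v = raw (x₁ v) (x₂ v) (x₃ v)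
    where
    raw : ∀ a b c → a * + 1 + b * + 0 + c * + 0 ≡ a
    raw = ℤSolver.solve-∀

  ∙e₂ : ∀ v → v ∙ e₂ ≡ x₂ v
  ∙e₂ v = raw (x₁ v) (x₂ v) (x₃ v)
    where
    raw : ∀ a b c → a * + 0 + b * + 1 + c * + 0 ≡ b
    raw = ℤSolver.solve-∀

  ∙e₃ : ∀ v → v ∙ e₃ ≡ x₃ v
  ∙e₃ v = raw (x₁ v) (x₂ v) (x₃ v)
    where
    raw : ∀ a b c → a * + 0 + b * + 0 + c * + 1 ≡ c
    raw = ℤSolver.solve-∀

  lagrange : ∀ a b → (a ⨯ b) ∙ (a ⨯ b) ≡ (a ∙ a) * (b ∙ b) - (a ∙ b) * (a ∙ b)
  lagrange a b = raw (x₁ a) (x₂ a) (x₃ a) (x₁ b) (x₂ b) (x₃ b)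
    where
    raw : ∀ a b c d e f →
      (b * f - c * e) * (b * f - c * e) + (c * d - a * f) * (c * d - a * f) + (a * e - b * d) * (a * e - b * d) ≡
      (a * a + b * b + c * c) * (d * d + e * e + f * f) - (a * d + b * e + c * f) * (a * d + b * e + c * f)
    raw = ℤSolver.solve-∀

  -- The Gram determinant of (a, b, z) against (a, b, z′), expanded along its last row and column.
  gram : ∀ a b z z′ → let A = a ∙ a; B = a ∙ b; C = b ∙ b in
    (A * C - B * B) * (z ∙ z′) ≡
    (C * (a ∙ z) - B * (b ∙ z)) * (a ∙ z′) + (A * (b ∙ z) - B * (a ∙ z)) * (b ∙ z′) + ((a ⨯ b) ∙ z) * ((a ⨯ b) ∙ z′)
  gram a b z z′ = raw (x₁ a) (x₂ a) (x₃ a) (x₁ b) (x₂ b) (x₃ b) (x₁ z) (x₂ z) (x₃ z) (x₁ z′) (x₂ z′) (x₃ z′)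
    where
    raw : ∀ a b c d e f x y z p q r →
      let A = a * a + b * b + c * c
          B = a * d + b * e + c * f
          C = d * d + e * e + f * f
          α = a * x + b * y + c * z
          β = d * x + e * y + f * z
          α′ = a * p + b * q + c * r
          β′ = d * p + e * q + f * r
      in (A * C - B * B) * (x * p + y * q + z * r) ≡
         (C * α - B * β) * α′ + (A * β - B * α) * β′ +
         ((b * f - c * e) * x + (c * d - a * f) * y + (a * e - b * d) * z) *
         ((b * f - c * e) * p + (c * d - a * f) * q + (a * e - b * d) * r)
    raw = ℤSolver.solve-∀

  combination : V → V → ℤ → ℤ → ℤ → V
  combination a b p q r = ⟨ entry x₁ , entry x₂ , entry x₃ ⟩
    where
    entry : (V → ℤ) → ℤ
    entry π = p * π a + q * π b + r * π (a ⨯ b)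

  combination-∙ : ∀ a b p q r z → combination a b p q r ∙ z ≡ p * (a ∙ z) + q * (b ∙ z) + r * ((a ⨯ b) ∙ z)
  combination-∙ a b p q r z = raw p q r (x₁ a) (x₂ a) (x₃ a) (x₁ b) (x₂ b) (x₃ b)
      (x₁ (a ⨯ b)) (x₂ (a ⨯ b)) (x₃ (a ⨯ b)) (x₁ z) (x₂ z) (x₃ z)
    where
    raw : ∀ p q r a b c d e f g h i x y z →
      (p * a + q * d + r * g) * x + (p * b + q * e + r * h) * y + (p * c + q * f + r * i) * z ≡
      p * (a * x + b * y + c * z) + q * (d * x + e * y + f * z) + r * (g * x + h * y + i * z)
    raw = ℤSolver.solve-∀

  [a⨯b]∙a : ∀ a b → (a ⨯ b) ∙ a ≡ 0ℤ
  [a⨯b]∙a a b = raw (x₁ a) (x₂ a) (x₃ a) (x₁ b) (x₂ b) (x₃ b)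
    where
    raw : ∀ a b c d e f → (b * f - c * e) * a + (c * d - a * f) * b + (a * e - b * d) * c ≡ + 0
    raw = ℤSolver.solve-∀

  [a⨯b]∙b : ∀ a b → (a ⨯ b) ∙ b ≡ 0ℤ
  [a⨯b]∙b a b = raw (x₁ a) (x₂ a) (x₃ a) (x₁ b) (x₂ b) (x₃ b)
    where
    raw : ∀ a b c d e f → (b * f - c * e) * d + (c * d - a * f) * e + (a * e - b * d) * f ≡ + 0
    raw = ℤSolver.solve-∀

  -- Primitivity is carried as a Bézout vector; for a ⨯ b this is the vector from which ρ and σ are
  -- computed.
  Coprime : V → Set
  Coprime v = ∃[ w ] v ∙ w ≡ 1ℤ

  -- (a, b) is a basis of (a ⨯ b)^⊥ ∩ ℤ³ with Gram matrix (A B; B C).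
  record Basis (A B C : ℤ) (a b : V) : Set where
    constructor basis
    field
      a∙a≡A   : a ∙ a ≡ A
      a∙b≡B   : a ∙ b ≡ B
      b∙b≡C   : b ∙ b ≡ C
      coprime : Coprime (a ⨯ b)

    w = proj₁ coprime
    α = a ∙ w
    β = b ∙ w
    W = w ∙ w

    -- a ⨯ b ≡ ρ a + σ b modulo m = A C − B².  The pair (ρ, σ) modulo m is the invariant that
    -- determines (a, b) up to the finite group of integral isometries.
    ρ σ : ℤ
    ρ = B * β - C * α
    σ = B * α - A * β

  open Basis using (ρ; σ)

  module _ {A B C : ℤ} {m : ℕ} (m≡ : + m ≡ A * C - B * B) {a b : V} (h : Basis A B C a b) where
    open Basis h hiding (ρ; σ)
    open ≡-Reasoning

    gram′ : ∀ z z′ → + m * (z ∙ z′) ≡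
      (C * (a ∙ z) - B * (b ∙ z)) * (a ∙ z′) + (A * (b ∙ z) - B * (a ∙ z)) * (b ∙ z′) + ((a ⨯ b) ∙ z) * ((a ⨯ b) ∙ z′)
    gram′ z z′ = trans (cong (_* (z ∙ z′)) m≡) (subst (λ ABC → let (A , B , C) = ABC in (A * C - B * B) * (z ∙ z′) ≡
      (C * (a ∙ z) - B * (b ∙ z)) * (a ∙ z′) + (A * (b ∙ z) - B * (a ∙ z)) * (b ∙ z′) + ((a ⨯ b) ∙ z) * ((a ⨯ b) ∙ z′))
      (cong₂ _,_ a∙a≡A (cong₂ _,_ a∙b≡B b∙b≡C)) (gram a b z z′))

    -- `gram′` at z = z′ = w, where (a ⨯ b) ∙ w = 1. It expresses gcd(m, ρ, σ) = 1.
    one≡ : 1ℤ ≡ + m * W + (ρ h * α + σ h * β)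
    one≡ = begin
      1ℤ                                                                             ≡⟨ cancel (C * α - B * β) α (A * β - B * α) β ⟩
      (p * α + q * β + 1ℤ * 1ℤ) + ((- p) * α + (- q) * β)                    ≡⟨ cong (λ o → (p * α + q * β + o * o) + ((- p) * α + (- q) * β)) (sym (proj₂ coprime)) ⟩
      (p * α + q * β + γ * γ) + ((- p) * α + (- q) * β)                      ≡⟨ cong₂ _+_ (sym (gram′ w w)) (negate A B C α β) ⟩
      + m * W + (ρ h * α + σ h * β)                                            ∎
      where
      p = C * α - B * β
      q = A * β - B * α
      γ = (a ⨯ b) ∙ w
      cancel : ∀ p α q β → + 1 ≡ (p * α + q * β + + 1 * + 1) + ((- p) * α + (- q) * β)
      cancel = ℤSolver.solve-∀
      negate : ∀ A B C α β → (- (C * α - B * β)) * α + (- (A * β - B * α)) * β ≡ (B * β - C * α) * α + (B * α - A * β) * β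
      negate = ℤSolver.solve-∀

    -- `gram′` at (w, z): the congruence of a ⨯ b with ρ a + σ b modulo m, tested against z.
    [a⨯b]∙z≡ : ∀ z → (a ⨯ b) ∙ z ≡ + m * (w ∙ z) + (ρ h * (a ∙ z) + σ h * (b ∙ z))
    [a⨯b]∙z≡ z = begin
      γ                                                                                      ≡⟨ cancel A B C α β (a ∙ z) (b ∙ z) γ ⟩
      ((C * α - B * β) * (a ∙ z) + (A * β - B * α) * (b ∙ z) + 1ℤ * γ) + (ρ h * (a ∙ z) + σ h * (b ∙ z))
        ≡⟨ cong (λ o → ((C * α - B * β) * (a ∙ z) + (A * β - B * α) * (b ∙ z) + o * γ) + (ρ h * (a ∙ z) + σ h * (b ∙ z))) (sym (proj₂ coprime)) ⟩
      ((C * α - B * β) * (a ∙ z) + (A * β - B * α) * (b ∙ z) + (a ⨯ b) ∙ w * γ) + (ρ h * (a ∙ z) + σ h * (b ∙ z))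
        ≡⟨ cong (_+ (ρ h * (a ∙ z) + σ h * (b ∙ z))) (sym (gram′ w z)) ⟩
      + m * (w ∙ z) + (ρ h * (a ∙ z) + σ h * (b ∙ z))                                      ∎
      where
      γ = (a ⨯ b) ∙ z
      cancel : ∀ A B C α β x y γ → γ ≡ ((C * α - B * β) * x + (A * β - B * α) * y + + 1 * γ) + ((B * β - C * α) * x + (B * α - A * β) * y)
      cancel = ℤSolver.solve-∀

    -- Multiplying C by `one≡` turns the claim into a polynomial identity. The quotient is the Gram
    -- determinant of (b, w); the next two lemmas have the other minors of the Gram matrix of (a, b,
    -- w).
    m∣ρρ+C : + m ∣ ρ h * ρ h + C
    m∣ρρ+C = divides (C * W - β * β) (begin
      ρ h * ρ h + C                                                      ≡⟨ cong (λ o → ρ h * ρ h + o) (trans (sym (ℤ.*-identityʳ C)) (cong (C *_) one≡)) ⟩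
      ρ h * ρ h + C * (+ m * W + (ρ h * α + σ h * β))              ≡⟨ cong (λ k → ρ h * ρ h + C * (k * W + (ρ h * α + σ h * β))) m≡ ⟩
      ρ h * ρ h + C * ((A * C - B * B) * W + (ρ h * α + σ h * β))  ≡⟨ raw A B C α β W ⟩
      (C * W - β * β) * (A * C - B * B)                            ≡⟨ cong ((C * W - β * β) *_) (sym m≡) ⟩
      (C * W - β * β) * + m                                        ∎)
      where
      raw : ∀ A B C α β W → let ρ = B * β - C * α; σ = B * α - A * β; m = A * C - B * B in
        ρ * ρ + C * (m * W + (ρ * α + σ * β)) ≡ (C * W - β * β) * m
      raw = ℤSolver.solve-∀

    m∣σσ+A : + m ∣ σ h * σ h + A
    m∣σσ+A = divides (A * W - α * α) (begin
      σ h * σ h + A                                                      ≡⟨ cong (λ o → σ h * σ h + o) (trans (sym (ℤ.*-identityʳ A)) (cong (A *_) one≡)) ⟩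
      σ h * σ h + A * (+ m * W + (ρ h * α + σ h * β))              ≡⟨ cong (λ k → σ h * σ h + A * (k * W + (ρ h * α + σ h * β))) m≡ ⟩
      σ h * σ h + A * ((A * C - B * B) * W + (ρ h * α + σ h * β))  ≡⟨ raw A B C α β W ⟩
      (A * W - α * α) * (A * C - B * B)                            ≡⟨ cong ((A * W - α * α) *_) (sym m≡) ⟩
      (A * W - α * α) * + m                                        ∎)
      where
      raw : ∀ A B C α β W → let ρ = B * β - C * α; σ = B * α - A * β; m = A * C - B * B in
        σ * σ + A * (m * W + (ρ * α + σ * β)) ≡ (A * W - α * α) * m
      raw = ℤSolver.solve-∀

    m∣ρσ-B : + m ∣ ρ h * σ h - B
    m∣ρσ-B = divides (α * β - B * W) (begin
      ρ h * σ h - B                                                      ≡⟨ cong (λ o → ρ h * σ h - o) (trans (sym (ℤ.*-identityʳ B)) (cong (B *_) one≡)) ⟩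
      ρ h * σ h - B * (+ m * W + (ρ h * α + σ h * β))              ≡⟨ cong (λ k → ρ h * σ h - B * (k * W + (ρ h * α + σ h * β))) m≡ ⟩
      ρ h * σ h - B * ((A * C - B * B) * W + (ρ h * α + σ h * β))  ≡⟨ raw A B C α β W ⟩
      (α * β - B * W) * (A * C - B * B)                            ≡⟨ cong ((α * β - B * W) *_) (sym m≡) ⟩
      (α * β - B * W) * + m                                        ∎)
      where
      raw : ∀ A B C α β W → let ρ = B * β - C * α; σ = B * α - A * β; m = A * C - B * B in
        ρ * σ - B * (m * W + (ρ * α + σ * β)) ≡ (α * β - B * W) * m
      raw = ℤSolver.solve-∀

    private
      γ≡ : ∀ z → (a ⨯ b) ∙ z ≡ + m * (z ∙ w) - (C * (a ∙ z) - B * (b ∙ z)) * α - (A * (b ∙ z) - B * (a ∙ z)) * β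
      γ≡ z = sym (begin
        + m * (z ∙ w) - P - Q                            ≡⟨ cong (λ k → k - P - Q) (gram′ z w) ⟩
        P + Q + (a ⨯ b) ∙ z * ((a ⨯ b) ∙ w) - P - Q      ≡⟨ cong (λ k → P + Q + (a ⨯ b) ∙ z * k - P - Q) (proj₂ coprime) ⟩
        P + Q + (a ⨯ b) ∙ z * 1ℤ - P - Q                 ≡⟨ raw P Q ((a ⨯ b) ∙ z) ⟩
        (a ⨯ b) ∙ z                                      ∎)
        where
        P = (C * (a ∙ z) - B * (b ∙ z)) * α
        Q = (A * (b ∙ z) - B * (a ∙ z)) * β
        raw : ∀ P Q g → P + Q + g * + 1 - P - Q ≡ g
        raw = ℤSolver.solve-∀

    -- By `gram′`, m z has coordinates p, q, γ with respect to a, b, a ⨯ b. This lemma and the next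
    -- say that modulo m they are γ times (-ρ, -σ, 1).
    m∣p+ργ : ∀ z → + m ∣ C * (a ∙ z) - B * (b ∙ z) + ρ h * ((a ⨯ b) ∙ z)
    m∣p+ργ z = divides (p * W + ρ h * Z + β * (α * y - β * x)) (begin
      p + ρ h * γ                                                                    ≡⟨ cong₂ (λ o g → o + ρ h * g) (trans (sym (ℤ.*-identityʳ p)) (cong (p *_) one≡)) (γ≡ z) ⟩
      p * (+ m * W + (ρ h * α + σ h * β)) + ρ h * (+ m * Z - p * α - q * β)          ≡⟨ cong (λ k → p * (k * W + (ρ h * α + σ h * β)) + ρ h * (k * Z - p * α - q * β)) m≡ ⟩
      p * ((A * C - B * B) * W + (ρ h * α + σ h * β)) + ρ h * ((A * C - B * B) * Z - p * α - q * β) ≡⟨ raw A B C α β x y W Z ⟩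
      (p * W + ρ h * Z + β * (α * y - β * x)) * (A * C - B * B)                      ≡⟨ cong ((p * W + ρ h * Z + β * (α * y - β * x)) *_) (sym m≡) ⟩
      (p * W + ρ h * Z + β * (α * y - β * x)) * + m                                  ∎)
      where
      x = a ∙ z
      y = b ∙ z
      p = C * x - B * y
      q = A * y - B * x
      γ = (a ⨯ b) ∙ z
      Z = z ∙ w
      raw : ∀ A B C α β x y W Z → let ρ = B * β - C * α; σ = B * α - A * β; m = A * C - B * B; p = C * x - B * y; q = A * y - B * x in
        p * (m * W + (ρ * α + σ * β)) + ρ * (m * Z - p * α - q * β) ≡ (p * W + ρ * Z + β * (α * y - β * x)) * m
      raw = ℤSolver.solve-∀

    m∣q+σγ : ∀ z → + m ∣ A * (b ∙ z) - B * (a ∙ z) + σ h * ((a ⨯ b) ∙ z)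
    m∣q+σγ z = divides (q * W + σ h * Z - α * (α * y - β * x)) (begin
      q + σ h * γ                                                                    ≡⟨ cong₂ (λ o g → o + σ h * g) (trans (sym (ℤ.*-identityʳ q)) (cong (q *_) one≡)) (γ≡ z) ⟩
      q * (+ m * W + (ρ h * α + σ h * β)) + σ h * (+ m * Z - p * α - q * β)          ≡⟨ cong (λ k → q * (k * W + (ρ h * α + σ h * β)) + σ h * (k * Z - p * α - q * β)) m≡ ⟩
      q * ((A * C - B * B) * W + (ρ h * α + σ h * β)) + σ h * ((A * C - B * B) * Z - p * α - q * β) ≡⟨ raw A B C α β x y W Z ⟩
      (q * W + σ h * Z - α * (α * y - β * x)) * (A * C - B * B)                      ≡⟨ cong ((q * W + σ h * Z - α * (α * y - β * x)) *_) (sym m≡) ⟩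
      (q * W + σ h * Z - α * (α * y - β * x)) * + m                                  ∎)
      where
      x = a ∙ z
      y = b ∙ z
      p = C * x - B * y
      q = A * y - B * x
      γ = (a ⨯ b) ∙ z
      Z = z ∙ w
      raw : ∀ A B C α β x y W Z → let ρ = B * β - C * α; σ = B * α - A * β; m = A * C - B * B; p = C * x - B * y; q = A * y - B * x in
        q * (m * W + (ρ * α + σ * β)) + σ * (m * Z - p * α - q * β) ≡ (q * W + σ * Z - α * (α * y - β * x)) * m
      raw = ℤSolver.solve-∀

    -- Twice `one≡`. Sums and differences of two invariants give access only to 2ρ and 2σ.
    gcd∣2 : ∀ {d} → d ∣ + m → d ∣ + 2 * ρ h → d ∣ + 2 * σ h → d ∣ + 2
    gcd∣2 {d} d∣m d∣2ρ d∣2σ = subst (d ∣_) (trans (raw (+ m) (ρ h) (σ h) W α β) (trans (cong (λ o → + 2 * o) (sym one≡)) refl))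
      (ℤ.∣m∣n⇒∣m+n (ℤ.∣n⇒∣m*n (+ 2 * W) d∣m) (ℤ.∣m∣n⇒∣m+n (ℤ.∣n⇒∣m*n α d∣2ρ) (ℤ.∣n⇒∣m*n β d∣2σ)))
      where
      raw : ∀ m ρ σ W α β → + 2 * W * m + (α * (+ 2 * ρ) + β * (+ 2 * σ)) ≡ + 2 * (m * W + (ρ * α + σ * β))
      raw = ℤSolver.solve-∀

  -- Integral vectors of bounded length

  ∣i∣² : ∀ i → i * i ≡ + (ℤ.∣ i ∣ ℕ.* ℤ.∣ i ∣)
  ∣i∣² (+ n)    = sym (ℤ.pos-* n n)
  ∣i∣² -[1+ n ] = refl

  sq : ℤ → ℕ
  sq i = ℤ.∣ i ∣ ℕ.* ℤ.∣ i ∣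

  norm : V → ℕ
  norm v = sq (x₁ v) ℕ.+ sq (x₂ v) ℕ.+ sq (x₃ v)

  v∙v≡norm : ∀ v → v ∙ v ≡ + norm v
  v∙v≡norm v = cong₂ _+_ (cong₂ _+_ (∣i∣² (x₁ v)) (∣i∣² (x₂ v))) (∣i∣² (x₃ v))

  m*m≤n*n⇒m≤n : ∀ {m n} → m ℕ.* m ℕ.≤ n ℕ.* n → m ℕ.≤ n
  m*m≤n*n⇒m≤n {m} {n} h with m ℕ.≤? n
  ... | yes m≤n = m≤n
  ... | no  m≰n = contradiction h (ℕ.<⇒≱ (ℕ.*-mono-< (ℕ.≰⇒> m≰n) (ℕ.≰⇒> m≰n)))

  module _ {n} (v : V) (n²≡ : v ∙ v ≡ + (n ℕ.* n)) where
    private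
      norm≡ : norm v ≡ n ℕ.* n
      norm≡ = ℤ.+-injective (trans (sym (v∙v≡norm v)) n²≡)

    ∣x₁∣≤ : ℤ.∣ x₁ v ∣ ℕ.≤ n
    ∣x₁∣≤ = m*m≤n*n⇒m≤n (subst (sq (x₁ v) ℕ.≤_) norm≡ (ℕ.≤-trans (ℕ.m≤m+n _ (sq (x₂ v))) (ℕ.m≤m+n _ (sq (x₃ v)))))

    ∣x₂∣≤ : ℤ.∣ x₂ v ∣ ℕ.≤ n
    ∣x₂∣≤ = m*m≤n*n⇒m≤n (subst (sq (x₂ v) ℕ.≤_) norm≡ (ℕ.≤-trans (ℕ.m≤n+m _ (sq (x₁ v))) (ℕ.m≤m+n _ (sq (x₃ v)))))

    ∣x₃∣≤ : ℤ.∣ x₃ v ∣ ℕ.≤ n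
    ∣x₃∣≤ = m*m≤n*n⇒m≤n (subst (sq (x₃ v) ℕ.≤_) norm≡ (ℕ.m≤n+m (sq (x₃ v)) (sq (x₁ v) ℕ.+ sq (x₂ v))))

  smallℤ : List ℤ
  smallℤ = -[1+ 1 ] ∷ -[1+ 0 ] ∷ + 0 ∷ + 1 ∷ + 2 ∷ []

  ∈-smallℤ : ∀ i → ℤ.∣ i ∣ ℕ.≤ 2 → i ∈ˡ smallℤ
  ∈-smallℤ (+ 0)      _ = there (there (here refl))
  ∈-smallℤ (+ 1)      _ = there (there (there (here refl)))
  ∈-smallℤ (+ 2)      _ = there (there (there (there (here refl))))
  ∈-smallℤ (+ suc (suc (suc _)))  (ℕ.s≤s (ℕ.s≤s ()))
  ∈-smallℤ -[1+ 0 ]   _ = there (here refl)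
  ∈-smallℤ -[1+ 1 ]   _ = here refl
  ∈-smallℤ -[1+ suc (suc _) ] (ℕ.s≤s (ℕ.s≤s ()))

  smallV : List V
  smallV = List.cartesianProductWith (λ i v → ⟨ i , x₂ v , x₃ v ⟩) smallℤ
             (List.cartesianProductWith (λ j k → ⟨ + 0 , j , k ⟩) smallℤ smallℤ)

  ∈-smallV : ∀ v → ℤ.∣ x₁ v ∣ ℕ.≤ 2 → ℤ.∣ x₂ v ∣ ℕ.≤ 2 → ℤ.∣ x₃ v ∣ ℕ.≤ 2 → v ∈ˡ smallV
  ∈-smallV v h₁ h₂ h₃ = Mem.∈-cartesianProductWith⁺ (λ i v → ⟨ i , x₂ v , x₃ v ⟩) (∈-smallℤ (x₁ v) h₁)
    (Mem.∈-cartesianProductWith⁺ (λ j k → ⟨ + 0 , j , k ⟩) (∈-smallℤ (x₂ v) h₂) (∈-smallℤ (x₃ v) h₃))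

  abstract
    -- This is 125³: three vectors with entries from -2 to 2. It is abstract so that the number is
    -- never evaluated; only the inequality below is used.
    κ : ℕ
    κ = length smallV ℕ.* (length smallV ℕ.* (length smallV ℕ.* 1))

    smallV³≤κ : length smallV ℕ.* (length smallV ℕ.* (length smallV ℕ.* 1)) ℕ.≤ κ
    smallV³≤κ = ℕ.≤-refl

  -- The number of bases with a given Gram matrix

  module _ {A B C : ℤ} {m : ℕ} .{{_ : NonZero m}} (m≡ : + m ≡ A * C - B * B) where

    -- Twice the column m⁻¹ L of the isometry taking (a₁, b₁) to (a, b) is integral, hence small.
    module _ {a₁ b₁ a b : V} (h₁ : Basis A B C a₁ b₁) (h : Basis A B C a b)
             (ρ≡ : + m ∣ + 2 * (ρ h₁ - ρ h)) (σ≡ : + m ∣ + 2 * (σ h₁ - σ h)) (z : V) (z∙z≡1 : z ∙ z ≡ 1ℤ) where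
      open ≡-Reasoning
      private
        x = a ∙ z
        y = b ∙ z
        p = C * x - B * y
        q = A * y - B * x
        γ = (a ⨯ b) ∙ z
        -- `L` has in a₁, b₁, a₁ ⨯ b₁ the coordinates of m z in a, b, a ⨯ b, so m⁻¹ L is the image
        -- of z under the rotation taking (a, b) to (a₁, b₁).
        L = combination a₁ b₁ p q γ

        L∙a₁ : L ∙ a₁ ≡ + m * x
        L∙a₁ = begin
          L ∙ a₁                                                     ≡⟨ combination-∙ a₁ b₁ p q γ a₁ ⟩
          p * (a₁ ∙ a₁) + q * (b₁ ∙ a₁) + γ * ((a₁ ⨯ b₁) ∙ a₁)       ≡⟨ cong₂ _+_ (cong₂ (λ s t → p * s + q * t) (Basis.a∙a≡A h₁) (trans (∙-comm b₁ a₁) (Basis.a∙b≡B h₁)))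
                                                                          (cong (γ *_) ([a⨯b]∙a a₁ b₁)) ⟩
          p * A + q * B + γ * 0ℤ                                     ≡⟨ raw A B C x y γ ⟩
          (A * C - B * B) * x                                        ≡⟨ cong (_* x) (sym m≡) ⟩
          + m * x                                                    ∎
          where
          raw : ∀ A B C x y γ → (C * x - B * y) * A + (A * y - B * x) * B + γ * + 0 ≡ (A * C - B * B) * x
          raw = ℤSolver.solve-∀

        L∙b₁ : L ∙ b₁ ≡ + m * y
        L∙b₁ = begin
          L ∙ b₁                                                     ≡⟨ combination-∙ a₁ b₁ p q γ b₁ ⟩
          p * (a₁ ∙ b₁) + q * (b₁ ∙ b₁) + γ * ((a₁ ⨯ b₁) ∙ b₁)       ≡⟨ cong₂ _+_ (cong₂ (λ s t → p * s + q * t) (Basis.a∙b≡B h₁) (Basis.b∙b≡C h₁))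
                                                                          (cong (γ *_) ([a⨯b]∙b a₁ b₁)) ⟩
          p * B + q * C + γ * 0ℤ                                     ≡⟨ raw A B C x y γ ⟩
          (A * C - B * B) * y                                        ≡⟨ cong (_* y) (sym m≡) ⟩
          + m * y                                                    ∎
          where
          raw : ∀ A B C x y γ → (C * x - B * y) * B + (A * y - B * x) * C + γ * + 0 ≡ (A * C - B * B) * y
          raw = ℤSolver.solve-∀

        L∙u₁ : L ∙ (a₁ ⨯ b₁) ≡ + m * γ
        L∙u₁ = begin
          L ∙ u₁                                                     ≡⟨ combination-∙ a₁ b₁ p q γ u₁ ⟩
          p * (a₁ ∙ u₁) + q * (b₁ ∙ u₁) + γ * (u₁ ∙ u₁)              ≡⟨ cong₂ _+_ (cong₂ (λ s t → p * s + q * t) (trans (∙-comm a₁ u₁) ([a⨯b]∙a a₁ b₁)) (trans (∙-comm b₁ u₁) ([a⨯b]∙b a₁ b₁)))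
                                                                          (cong (γ *_) u₁∙u₁) ⟩
          p * 0ℤ + q * 0ℤ + γ * + m                                  ≡⟨ raw p q γ (+ m) ⟩
          + m * γ                                                    ∎
          where
          u₁ = a₁ ⨯ b₁
          raw : ∀ p q γ m → p * + 0 + q * + 0 + γ * m ≡ m * γ
          raw = ℤSolver.solve-∀
          u₁∙u₁ : u₁ ∙ u₁ ≡ + m
          u₁∙u₁ = trans (lagrange a₁ b₁) (trans (cong₂ _-_ (cong₂ _*_ (Basis.a∙a≡A h₁) (Basis.b∙b≡C h₁))
                    (cong₂ _*_ (Basis.a∙b≡B h₁) (Basis.a∙b≡B h₁))) (sym m≡))

        L∙L : L ∙ L ≡ + (m ℕ.* m)
        L∙L = begin
          L ∙ L                                                      ≡⟨ combination-∙ a₁ b₁ p q γ L ⟩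
          p * (a₁ ∙ L) + q * (b₁ ∙ L) + γ * ((a₁ ⨯ b₁) ∙ L)          ≡⟨ cong₂ _+_ (cong₂ (λ s t → p * s + q * t) (trans (∙-comm a₁ L) L∙a₁) (trans (∙-comm b₁ L) L∙b₁))
                                                                          (cong (γ *_) (trans (∙-comm (a₁ ⨯ b₁) L) L∙u₁)) ⟩
          p * (+ m * x) + q * (+ m * y) + γ * (+ m * γ)              ≡⟨ raw p x q y γ (+ m) ⟩
          + m * (p * x + q * y + γ * γ)                              ≡⟨ cong (λ k → + m * k) (sym (gram′ m≡ h z z)) ⟩
          + m * (+ m * (z ∙ z))                                      ≡⟨ cong (λ k → + m * k) (trans (cong (λ k → + m * k) z∙z≡1) (ℤ.*-identityʳ (+ m))) ⟩
          + m * + m                                                  ≡⟨ sym (ℤ.pos-* m m) ⟩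
          + (m ℕ.* m)                                                ∎
          where
          raw : ∀ p x q y γ m → p * (m * x) + q * (m * y) + γ * (m * γ) ≡ m * (p * x + q * y + γ * γ)
          raw = ℤSolver.solve-∀

        -- Modulo m, L ≡ γ ((ρ₁ - ρ) a₁ + (σ₁ - σ) b₁), by the congruences for p and q and the one
        -- for a₁ ⨯ b₁; twice this vanishes by hypothesis.
        m∣2L : ∀ v → + m ∣ + 2 * (L ∙ v)
        m∣2L v = subst (+ m ∣_) (sym eq) (ℤ.∣m∣n⇒∣m+n
          (ℤ.∣m∣n⇒∣m+n (ℤ.∣m∣n⇒∣m+n (ℤ.∣n⇒∣m*n (+ 2 * x₁′) (m∣p+ργ m≡ h z)) (ℤ.∣n⇒∣m*n (+ 2 * y₁′) (m∣q+σγ m≡ h z)))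
                       (ℤ.∣n⇒∣m*n (+ 2 * γ * Z₁) ℤ.∣-refl))
          (ℤ.∣m∣n⇒∣m+n (ℤ.∣n⇒∣m*n (γ * x₁′) ρ≡) (ℤ.∣n⇒∣m*n (γ * y₁′) σ≡)))
          where
          x₁′ = a₁ ∙ v
          y₁′ = b₁ ∙ v
          Z₁ = Basis.w h₁ ∙ v
          raw : ∀ p q γ x y Z m ρ₁ σ₁ ρ σ → + 2 * (p * x + q * y + γ * (m * Z + (ρ₁ * x + σ₁ * y))) ≡
            + 2 * x * (p + ρ * γ) + + 2 * y * (q + σ * γ) + + 2 * γ * Z * m + (γ * x * (+ 2 * (ρ₁ - ρ)) + γ * y * (+ 2 * (σ₁ - σ)))
          raw = ℤSolver.solve-∀
          eq = trans (cong (λ k → + 2 * k) (trans (combination-∙ a₁ b₁ p q γ v) (cong (λ k → p * x₁′ + q * y₁′ + γ * k) ([a⨯b]∙z≡ m≡ h₁ v))))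
                 (raw p q γ x₁′ y₁′ Z₁ (+ m) (ρ h₁) (σ h₁) (ρ h) (σ h))

        halfInteger : ∀ l → ℤ.∣ l ∣ ℕ.≤ m → + m ∣ + 2 * l → ∃[ c ] ℤ.∣ c ∣ ℕ.≤ 2 × + 2 * l ≡ c * + m
        halfInteger l l≤m (divides c eq) = c , ℕ.*-cancelʳ-≤ ℤ.∣ c ∣ 2 m
          (subst (ℕ._≤ 2 ℕ.* m) (trans (sym (ℤ.abs-* (+ 2) l)) (trans (cong ℤ.∣_∣ eq) (ℤ.abs-* c (+ m)))) (ℕ.*-monoʳ-≤ 2 l≤m)) , eq

      -- `c` is 2 m⁻¹ L. Its products with a₁ and b₁ are twice the z-coordinates of a and b, so the
      -- three vectors obtained from e₁, e₂, e₃ determine (a, b).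
      column : ∃[ c ] c ∈ˡ smallV × (+ 2 * x ≡ c ∙ a₁) × (+ 2 * y ≡ c ∙ b₁)
      column =
        let (c₁ , s₁ , eq₁) = halfInteger (x₁ L) (∣x₁∣≤ L L∙L) (subst (λ k → + m ∣ + 2 * k) (∙e₁ L) (m∣2L e₁))
            (c₂ , s₂ , eq₂) = halfInteger (x₂ L) (∣x₂∣≤ L L∙L) (subst (λ k → + m ∣ + 2 * k) (∙e₂ L) (m∣2L e₂))
            (c₃ , s₃ , eq₃) = halfInteger (x₃ L) (∣x₃∣≤ L L∙L) (subst (λ k → + m ∣ + 2 * k) (∙e₃ L) (m∣2L e₃))
        in ⟨ c₁ , c₂ , c₃ ⟩ , ∈-smallV ⟨ c₁ , c₂ , c₃ ⟩ s₁ s₂ s₃ , descale c₁ c₂ c₃ eq₁ eq₂ eq₃ a₁ x L∙a₁ , descale c₁ c₂ c₃ eq₁ eq₂ eq₃ b₁ y L∙b₁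
        where
        descale : ∀ c₁ c₂ c₃ → + 2 * x₁ L ≡ c₁ * + m → + 2 * x₂ L ≡ c₂ * + m → + 2 * x₃ L ≡ c₃ * + m →
                  ∀ v k → L ∙ v ≡ + m * k → + 2 * k ≡ ⟨ c₁ , c₂ , c₃ ⟩ ∙ v
        descale c₁ c₂ c₃ eq₁ eq₂ eq₃ v k eq = ℤ.*-cancelʳ-≡ (+ 2 * k) (⟨ c₁ , c₂ , c₃ ⟩ ∙ v) (+ m) (begin
          + 2 * k * + m                                                               ≡⟨ raw₁ k (+ m) ⟩
          + 2 * (+ m * k)                                                             ≡⟨ cong (λ k → + 2 * k) (sym eq) ⟩
          + 2 * (L ∙ v)                                                               ≡⟨ raw₂ (x₁ L) (x₂ L) (x₃ L) (x₁ v) (x₂ v) (x₃ v) ⟩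
          + 2 * x₁ L * x₁ v + + 2 * x₂ L * x₂ v + + 2 * x₃ L * x₃ v                   ≡⟨ cong₂ _+_ (cong₂ (λ s t → s * x₁ v + t * x₂ v) eq₁ eq₂) (cong (_* x₃ v) eq₃) ⟩
          c₁ * + m * x₁ v + c₂ * + m * x₂ v + c₃ * + m * x₃ v                         ≡⟨ raw₃ c₁ c₂ c₃ (x₁ v) (x₂ v) (x₃ v) (+ m) ⟩
          ⟨ c₁ , c₂ , c₃ ⟩ ∙ v * + m                                                  ∎)
          where
          raw₁ : ∀ k m → + 2 * k * m ≡ + 2 * (m * k)
          raw₁ = ℤSolver.solve-∀
          raw₂ : ∀ a b c x y z → + 2 * (a * x + b * y + c * z) ≡ + 2 * a * x + + 2 * b * y + + 2 * c * z
          raw₂ = ℤSolver.solve-∀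
          raw₃ : ∀ a b c x y z m → a * m * x + b * m * y + c * m * z ≡ (a * x + b * y + c * z) * m
          raw₃ = ℤSolver.solve-∀

    Isometric : ∀ {a₁ b₁} → Basis A B C a₁ b₁ → V × V → Set
    Isometric h₁ (a , b) = Σ[ h ∈ Basis A B C a b ] (+ m ∣ + 2 * (ρ h₁ - ρ h)) × (+ m ∣ + 2 * (σ h₁ - σ h))

    atMost-isometric : ∀ {a₁ b₁} (h₁ : Basis A B C a₁ b₁) → AtMost (Isometric h₁) κ
    atMost-isometric {a₁} {b₁} h₁ = atMost-mono
      (λ (h , r , s) → let (c₁ , ∈₁ , eq₁) = column h₁ h r s e₁ refl
                           (c₂ , ∈₂ , eq₂) = column h₁ h r s e₂ refl
                           (c₃ , ∈₃ , eq₃) = column h₁ h r s e₃ refl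
                       in c₁ , ∈₁ , c₂ , ∈₂ , c₃ , ∈₃ , eq₁ , eq₂ , eq₃)
      smallV³≤κ
      (atMost-⋃ smallV λ {c₁} _ → atMost-⋃ smallV λ {c₂} _ → atMost-⋃ smallV λ {c₃} _ → atMost-one {P = Image c₁ c₂ c₃}
        λ ((p₁ , q₁) , (p₂ , q₂) , (p₃ , q₃)) ((p₁′ , q₁′) , (p₂′ , q₂′) , (p₃′ , q₃′)) →
          cong₂ _,_ (equal (trans p₁ (sym p₁′)) (trans p₂ (sym p₂′)) (trans p₃ (sym p₃′)))
                    (equal (trans q₁ (sym q₁′)) (trans q₂ (sym q₂′)) (trans q₃ (sym q₃′))))
      where
      Image : V → V → V → V × V → Set
      Image c₁ c₂ c₃ (a , b) = ((+ 2 * (a ∙ e₁) ≡ c₁ ∙ a₁) × (+ 2 * (b ∙ e₁) ≡ c₁ ∙ b₁)) ×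
                               ((+ 2 * (a ∙ e₂) ≡ c₂ ∙ a₁) × (+ 2 * (b ∙ e₂) ≡ c₂ ∙ b₁)) ×
                               ((+ 2 * (a ∙ e₃) ≡ c₃ ∙ a₁) × (+ 2 * (b ∙ e₃) ≡ c₃ ∙ b₁))
      equal : ∀ {v w} → + 2 * (v ∙ e₁) ≡ + 2 * (w ∙ e₁) → + 2 * (v ∙ e₂) ≡ + 2 * (w ∙ e₂) → + 2 * (v ∙ e₃) ≡ + 2 * (w ∙ e₃) → v ≡ w
      equal {v} {w} eq₁ eq₂ eq₃ = V-≡
        (trans (sym (∙e₁ v)) (trans (ℤ.*-cancelˡ-≡ (+ 2) (v ∙ e₁) (w ∙ e₁) eq₁) (∙e₁ w)))
        (trans (sym (∙e₂ v)) (trans (ℤ.*-cancelˡ-≡ (+ 2) (v ∙ e₂) (w ∙ e₂) eq₂) (∙e₂ w)))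
        (trans (sym (∙e₃ v)) (trans (ℤ.*-cancelˡ-≡ (+ 2) (v ∙ e₃) (w ∙ e₃) eq₃) (∙e₃ w)))

    Split : ∀ {a₀ b₀} → Basis A B C a₀ b₀ → ℕ → V × V → Set
    Split h₀ e (a , b) = Σ[ h ∈ Basis A B C a b ] ∃[ f ] m ≡ f ℕ.* e × (+ e ∣ ρ h - ρ h₀) × (+ e ∣ σ h - σ h₀) ×
                                       (+ f ∣ ρ h + ρ h₀) × (+ f ∣ σ h + σ h₀)

    split : ∀ {a₀ b₀ a b} (h₀ : Basis A B C a₀ b₀) → Basis A B C a b → ∃[ e ] e ∈ˡ divisors m × Split h₀ e (a , b)
    split h₀ h =
      let (e , f , m≡fe , rest) = splitModulus m (ρ h - ρ h₀) (σ h - σ h₀) (ρ h + ρ h₀) (σ h + σ h₀)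
            (subst (+ m ∣_) (raw₁ (ρ h) (ρ h₀) C) (ℤ.∣m∣n⇒∣m-n (m∣ρρ+C m≡ h) (m∣ρρ+C m≡ h₀)))
            (subst (+ m ∣_) (raw₁ (σ h) (σ h₀) A) (ℤ.∣m∣n⇒∣m-n (m∣σσ+A m≡ h) (m∣σσ+A m≡ h₀)))
            (subst (+ m ∣_) (raw₂ (ρ h) (ρ h₀) (σ h) (σ h₀) B) (ℤ.∣n⇒∣m*n (+ 2) (ℤ.∣m∣n⇒∣m-n (m∣ρσ-B m≡ h) (m∣ρσ-B m≡ h₀))))
      in e , ∈-divisors (ℕ.divides f m≡fe) , h , f , m≡fe , rest
      where
      raw₁ : ∀ r s c → (r * r + c) - (s * s + c) ≡ (r - s) * (r + s)
      raw₁ = ℤSolver.solve-∀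
      raw₂ : ∀ r r′ s s′ b → + 2 * ((r * s - b) - (r′ * s′ - b)) ≡ (r - r′) * (s + s′) + (s - s′) * (r + r′)
      raw₂ = ℤSolver.solve-∀

    -- The divisor e also fixes f, so two invariants with the same e agree modulo e and modulo f. A
    -- common divisor of e and f divides (ρ₁ + ρ₀) - (ρ₁ - ρ₀) = 2ρ₀ and likewise 2σ₀, hence divides
    -- 2.
    split⇒isometric : ∀ {a₀ b₀ e a₁ b₁} (h₀ : Basis A B C a₀ b₀) (s₁ : Split h₀ e (a₁ , b₁)) →
                      Split h₀ e ⊆ Isometric (proj₁ s₁)
    split⇒isometric {e = e} h₀ (h₁ , f , m≡fe , e∣ρ₁ , e∣σ₁ , f∣ρ₁ , f∣σ₁) (h , f′ , m≡f′e , e∣ρ , e∣σ , f′∣ρ , f′∣σ) =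
      h , twice (ρ h₁ - ρ h)
            (subst (+ e ∣_) (raw₁ (ρ h₁) (ρ h) (ρ h₀)) (ℤ.∣m∣n⇒∣m-n e∣ρ₁ e∣ρ))
            (subst (+ f ∣_) (raw₂ (ρ h₁) (ρ h) (ρ h₀)) (ℤ.∣m∣n⇒∣m-n f∣ρ₁ (subst (λ k → + k ∣ _) f′≡f f′∣ρ)))
        , twice (σ h₁ - σ h)
            (subst (+ e ∣_) (raw₁ (σ h₁) (σ h) (σ h₀)) (ℤ.∣m∣n⇒∣m-n e∣σ₁ e∣σ))
            (subst (+ f ∣_) (raw₂ (σ h₁) (σ h) (σ h₀)) (ℤ.∣m∣n⇒∣m-n f∣σ₁ (subst (λ k → + k ∣ _) f′≡f f′∣σ)))
      where
      raw₁ : ∀ r s t → (r - t) - (s - t) ≡ r - s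
      raw₁ = ℤSolver.solve-∀
      raw₂ : ∀ r s t → (r + t) - (s + t) ≡ r - s
      raw₂ = ℤSolver.solve-∀
      raw₃ : ∀ r t → (r + t) - (r - t) ≡ + 2 * t
      raw₃ = ℤSolver.solve-∀
      instance
        e≢0 : NonZero e
        e≢0 = ℕ.m*n≢0⇒n≢0 f {{subst NonZero m≡fe (ℕ.>-nonZero (ℕ.n≢0⇒n>0 (ℕ.≢-nonZero⁻¹ m)))}}
      f′≡f : f′ ≡ f
      f′≡f = ℕ.*-cancelʳ-≡ f′ f e (trans (sym m≡f′e) m≡fe)
      common∣2 : ∀ {d} → d ∣ + f → d ∣ + e → d ∣ + 2
      common∣2 {d} d∣f d∣e = gcd∣2 m≡ h₀
        (subst (d ∣_) (trans (sym (ℤ.pos-* f e)) (cong +_ (sym m≡fe))) (ℤ.∣n⇒∣m*n (+ f) d∣e))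
        (subst (d ∣_) (raw₃ (ρ h₁) (ρ h₀)) (ℤ.∣m∣n⇒∣m-n (ℤ.∣-trans d∣f f∣ρ₁) (ℤ.∣-trans d∣e e∣ρ₁)))
        (subst (d ∣_) (raw₃ (σ h₁) (σ h₀)) (ℤ.∣m∣n⇒∣m-n (ℤ.∣-trans d∣f f∣σ₁) (ℤ.∣-trans d∣e e∣σ₁)))
      twice : ∀ X → + e ∣ X → + f ∣ X → + m ∣ + 2 * X
      twice X e∣X f∣X = subst (λ k → + k ∣ + 2 * X) (sym m≡fe) (∣∧∣⇒∣2* f e X f∣X e∣X common∣2)

    -- Two kinds of reference basis: `h₀` assigns to every basis a divisor e, and then, for each e,
    -- one basis in that class serves for comparison with the rest of the class.
    atMost-basis : ∀ {t} → length (divisors m) ℕ.≤ t → AtMost (λ (a , b) → Basis A B C a b) (t ℕ.* κ)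
    atMost-basis τ≤t = atMost-witness λ _ h₀ → atMost-mono (split h₀) (ℕ.*-monoˡ-≤ κ τ≤t)
      (atMost-⋃ (divisors m) λ _ → atMost-witness λ _ s₁ → atMost-mono (split⇒isometric h₀ s₁) ℕ.≤-refl (atMost-isometric (proj₁ s₁)))

  -- Reduction of pairs of vectors to bases

  lin : ℤ → V → ℤ → V → V
  lin k a l b = ⟨ entry x₁ , entry x₂ , entry x₃ ⟩
    where
    entry : (V → ℤ) → ℤ
    entry π = k * π a + l * π b

  infixl 7 _•_
  _•_ : ℤ → V → V
  g • a = ⟨ g * x₁ a , g * x₂ a , g * x₃ a ⟩

  lin-∙ : ∀ k a l b z → lin k a l b ∙ z ≡ k * (a ∙ z) + l * (b ∙ z)
  lin-∙ k a l b z = raw k (x₁ a) (x₂ a) (x₃ a) l (x₁ b) (x₂ b) (x₃ b) (x₁ z) (x₂ z) (x₃ z)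
    where
    raw : ∀ k a b c l d e f x y z → (k * a + l * d) * x + (k * b + l * e) * y + (k * c + l * f) * z ≡
          k * (a * x + b * y + c * z) + l * (d * x + e * y + f * z)
    raw = ℤSolver.solve-∀

  •-∙ : ∀ g a z → (g • a) ∙ z ≡ g * (a ∙ z)
  •-∙ g a z = raw g (x₁ a) (x₂ a) (x₃ a) (x₁ z) (x₂ z) (x₃ z)
    where
    raw : ∀ g a b c x y z → g * a * x + g * b * y + g * c * z ≡ g * (a * x + b * y + c * z)
    raw = ℤSolver.solve-∀

  module _ {a y b : V} (k l : ℤ) (y≡ : y ≡ lin k a l b) where
    open ≡-Reasoning

    a∙y≡ : a ∙ y ≡ k * (a ∙ a) + l * (a ∙ b)
    a∙y≡ = trans (∙-comm a y) (trans (cong (_∙ a) y≡) (trans (lin-∙ k a l b a) (cong (λ c → k * (a ∙ a) + l * c) (∙-comm b a))))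

    y∙y≡ : y ∙ y ≡ k * k * (a ∙ a) + + 2 * k * l * (a ∙ b) + l * l * (b ∙ b)
    y∙y≡ = begin
      y ∙ y                                                                              ≡⟨ cong (_∙ y) y≡ ⟩
      lin k a l b ∙ y                                                                    ≡⟨ lin-∙ k a l b y ⟩
      k * (a ∙ y) + l * (b ∙ y)                                                          ≡⟨ cong₂ (λ s t → k * s + l * t) a∙y≡ b∙y≡ ⟩
      k * (k * (a ∙ a) + l * (a ∙ b)) + l * (k * (a ∙ b) + l * (b ∙ b))                  ≡⟨ raw k l (a ∙ a) (a ∙ b) (b ∙ b) ⟩
      k * k * (a ∙ a) + + 2 * k * l * (a ∙ b) + l * l * (b ∙ b)                          ∎
      where
      b∙y≡ : b ∙ y ≡ k * (a ∙ b) + l * (b ∙ b)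
      b∙y≡ = trans (∙-comm b y) (trans (cong (_∙ b) y≡) (lin-∙ k a l b b))
      raw : ∀ k l A B C → k * (k * A + l * B) + l * (k * B + l * C) ≡ k * k * A + + 2 * k * l * B + l * l * C
      raw = ℤSolver.solve-∀

    discriminant : l * l * ((a ∙ a) * (b ∙ b) - (a ∙ b) * (a ∙ b)) ≡ (a ∙ a) * (y ∙ y) - (a ∙ y) * (a ∙ y)
    discriminant = sym (trans (cong₂ (λ s t → (a ∙ a) * s - t * t) y∙y≡ a∙y≡) (raw k l (a ∙ a) (a ∙ b) (b ∙ b)))
      where
      raw : ∀ k l A B C → A * (k * k * A + + 2 * k * l * B + l * l * C) - (k * A + l * B) * (k * A + l * B) ≡ l * l * (A * C - B * B)
      raw = ℤSolver.solve-∀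

  norm≡0 : ∀ v → norm v ≡ 0 → v ≡ ⟨ 0ℤ , 0ℤ , 0ℤ ⟩
  norm≡0 v eq = V-≡ (zero! (x₁ v) (ℕ.m+n≡0⇒m≡0 (sq (x₁ v)) both)) (zero! (x₂ v) (ℕ.m+n≡0⇒n≡0 (sq (x₁ v)) both))
                    (zero! (x₃ v) (ℕ.m+n≡0⇒n≡0 (sq (x₁ v) ℕ.+ sq (x₂ v)) eq))
    where
    both = ℕ.m+n≡0⇒m≡0 (sq (x₁ v) ℕ.+ sq (x₂ v)) eq
    zero! : ∀ i → sq i ≡ 0 → i ≡ 0ℤ
    zero! i h = ℤ.∣i∣≡0⇒i≡0 (Sum.[ (λ e → e) , (λ e → e) ]′ (ℕ.m*n≡0⇒m≡0∨n≡0 ℤ.∣ i ∣ h))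

  coprime⇒norm≢0 : ∀ v → Coprime v → NonZero (norm v)
  coprime⇒norm≢0 v (w , eq) = ℕ.≢-nonZero λ n≡0 → contradiction (trans (sym eq) (trans (cong (_∙ w) (norm≡0 v n≡0)) refl)) λ ()

  coprimePart : ∀ v → NonZero (norm v) → ∃[ g ] NonZero g × ∃[ a ] v ≡ + g • a × Coprime a
  coprimePart v v≢0 = let (g , g∣₁ , g∣₂ , g∣₃ , x , y , z , eq) = bézout₃ (x₁ v) (x₂ v) (x₃ v) in go g g∣₁ g∣₂ g∣₃ x y z eq
    where
    go : ∀ g → + g ∣ x₁ v → + g ∣ x₂ v → + g ∣ x₃ v → ∀ x y z → + g ≡ x * x₁ v + y * x₂ v + z * x₃ v →
         ∃[ g ] NonZero g × ∃[ a ] v ≡ + g • a × Coprime a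
    go g (divides p ep) (divides q eq) (divides r er) x y z eg = g , g≢0 , ⟨ p , q , r ⟩ , v≡ , ⟨ x , y , z ⟩ , one
      where
      v≡ : v ≡ + g • ⟨ p , q , r ⟩
      v≡ = V-≡ (trans ep (ℤ.*-comm p (+ g))) (trans eq (ℤ.*-comm q (+ g))) (trans er (ℤ.*-comm r (+ g)))
      g≢0 : NonZero g
      g≢0 = ℕ.≢-nonZero λ g≡0 → ℕ.≢-nonZero⁻¹ (norm v) {{v≢0}} (cong norm (trans v≡ (cong (λ g → + g • ⟨ p , q , r ⟩) g≡0)))
      raw : ∀ p q r x y z g → x * (p * g) + y * (q * g) + z * (r * g) ≡ (p * x + q * y + r * z) * g
      raw = ℤSolver.solve-∀
      one : p * x + q * y + r * z ≡ 1ℤ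
      one = ℤ.*-cancelʳ-≡ (p * x + q * y + r * z) 1ℤ (+ g) {{g≢0}} (trans (sym (raw p q r x y z (+ g)))
        (trans (sym (cong₂ _+_ (cong₂ (λ s t → x * s + y * t) ep eq) (cong (z *_) er))) (trans (sym eg) (sym (ℤ.*-identityˡ (+ g))))))

  -- Hermite normal form of the pair (a, y) with respect to a basis (a, b) of its saturation.
  record Reduced (l k : ℕ) (a y : V) : Set where
    constructor reduced
    field
      b       : V
      y≡      : y ≡ lin (+ k) a (+ l) b
      coprime : Coprime (a ⨯ b)

  -- Write a ⨯ y = l u with u primitive. As a ∙ w = 1 and a ∙ u = 0, the triple product formula
  -- gives a ⨯ (u ⨯ w) = u and y = (w ∙ y) a + l (u ⨯ w). Division of w ∙ y by l with remainder k
  -- moves the quotient j into b = u ⨯ w + j a.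
  reduce : ∀ {a y} → Coprime a → NonZero (norm (a ⨯ y)) → ∃[ l ] NonZero l × ∃[ k ] k ℕ.< l × Reduced l k a y
  reduce {a} {y} (w , a∙w≡1) a⨯y≢0 =
    let (l , l≢0 , u , a⨯y≡ , u-coprime) = coprimePart (a ⨯ y) a⨯y≢0 in go l l≢0 u a⨯y≡ u-coprime
    where
    go : ∀ l → NonZero l → ∀ u → a ⨯ y ≡ + l • u → Coprime u → ∃[ l ] NonZero l × ∃[ k ] k ℕ.< l × Reduced l k a y
    go l l≢0 u a⨯y≡ u-coprime = l , l≢0 , k , ℤD.n%ℕd<d k₀ l {{l≢0}} , reduced b y≡ (subst Coprime (sym a⨯b≡u) u-coprime)
      where
      open ≡-Reasoning
      k₀ = w ∙ y
      k = ℤD._%ℕ_ k₀ l {{l≢0}}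
      j = ℤD._/ℕ_ k₀ l {{l≢0}}
      b₀ = u ⨯ w
      b = lin 1ℤ b₀ j a
      a∙u≡0 : u ∙ a ≡ 0ℤ
      a∙u≡0 = ℤ.*-cancelˡ-≡ (+ l) (u ∙ a) 0ℤ {{l≢0}} (trans (sym (•-∙ (+ l) u a)) (trans (cong (_∙ a) (sym a⨯y≡))
        (trans ([a⨯b]∙a a y) (sym (ℤ.*-zeroʳ (+ l))))))
      a⨯b≡u : a ⨯ b ≡ u
      a⨯b≡u = V-≡
        (scalar (x₁ u) (x₁ w) (raw₁ (x₁ a) (x₂ a) (x₃ a) (x₁ u) (x₂ u) (x₃ u) (x₁ w) (x₂ w) (x₃ w) j))
        (scalar (x₂ u) (x₂ w) (raw₂ (x₁ a) (x₂ a) (x₃ a) (x₁ u) (x₂ u) (x₃ u) (x₁ w) (x₂ w) (x₃ w) j))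
        (scalar (x₃ u) (x₃ w) (raw₃ (x₁ a) (x₂ a) (x₃ a) (x₁ u) (x₂ u) (x₃ u) (x₁ w) (x₂ w) (x₃ w) j))
        where
        scalar : ∀ {t} p q → t ≡ (a ∙ w) * p - (u ∙ a) * q → t ≡ p
        scalar p q eq = trans eq (trans (cong₂ (λ s t → s * p - t * q) a∙w≡1 a∙u≡0) (simplify p q))
          where
          simplify : ∀ p q → + 1 * p - + 0 * q ≡ p
          simplify = ℤSolver.solve-∀
        raw₁ : ∀ a b c d e f x y z j →
          b * (+ 1 * (d * y - e * x) + j * c) - c * (+ 1 * (f * x - d * z) + j * b) ≡ (a * x + b * y + c * z) * d - (d * a + e * b + f * c) * x
        raw₁ = ℤSolver.solve-∀
        raw₂ : ∀ a b c d e f x y z j →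
          c * (+ 1 * (e * z - f * y) + j * a) - a * (+ 1 * (d * y - e * x) + j * c) ≡ (a * x + b * y + c * z) * e - (d * a + e * b + f * c) * y
        raw₂ = ℤSolver.solve-∀
        raw₃ : ∀ a b c d e f x y z j →
          a * (+ 1 * (f * x - d * z) + j * b) - b * (+ 1 * (e * z - f * y) + j * a) ≡ (a * x + b * y + c * z) * f - (d * a + e * b + f * c) * z
        raw₃ = ℤSolver.solve-∀
      y≡ : y ≡ lin (+ k) a (+ l) b
      y≡ = V-≡
        (assemble (x₁ a) (x₁ y) (x₂ w) (x₃ w) (cong x₂ a⨯y≡) (cong x₃ a⨯y≡) (raw₁ (x₁ a) (x₂ a) (x₃ a) (x₁ y) (x₂ y) (x₃ y) (x₁ w) (x₂ w) (x₃ w)))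
        (assemble (x₂ a) (x₂ y) (x₃ w) (x₁ w) (cong x₃ a⨯y≡) (cong x₁ a⨯y≡) (raw₂ (x₁ a) (x₂ a) (x₃ a) (x₁ y) (x₂ y) (x₃ y) (x₁ w) (x₂ w) (x₃ w)))
        (assemble (x₃ a) (x₃ y) (x₁ w) (x₂ w) (cong x₁ a⨯y≡) (cong x₂ a⨯y≡) (raw₃ (x₁ a) (x₂ a) (x₃ a) (x₁ y) (x₂ y) (x₃ y) (x₁ w) (x₂ w) (x₃ w)))
        where
        raw₁ : ∀ a b c d e f x y z → (a * x + b * y + c * z) * d ≡ (x * d + y * e + z * f) * a + ((c * d - a * f) * z - (a * e - b * d) * y)
        raw₁ = ℤSolver.solve-∀
        raw₂ : ∀ a b c d e f x y z → (a * x + b * y + c * z) * e ≡ (x * d + y * e + z * f) * b + ((a * e - b * d) * x - (b * f - c * e) * z)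
        raw₂ = ℤSolver.solve-∀
        raw₃ : ∀ a b c d e f x y z → (a * x + b * y + c * z) * f ≡ (x * d + y * e + z * f) * c + ((b * f - c * e) * y - (c * d - a * f) * x)
        raw₃ = ℤSolver.solve-∀
        assemble : ∀ aᵢ yᵢ wⱼ wₖ {cⱼ cₖ uⱼ uₖ} → cⱼ ≡ + l * uⱼ → cₖ ≡ + l * uₖ →
          (a ∙ w) * yᵢ ≡ k₀ * aᵢ + (cⱼ * wₖ - cₖ * wⱼ) →
          yᵢ ≡ + k * aᵢ + + l * (+ 1 * (uⱼ * wₖ - uₖ * wⱼ) + j * aᵢ)
        assemble aᵢ yᵢ wⱼ wₖ {cⱼ} {cₖ} {uⱼ} {uₖ} refl refl eq = begin
          yᵢ                                                                ≡⟨ sym (ℤ.*-identityˡ yᵢ) ⟩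
          1ℤ * yᵢ                                                           ≡⟨ cong (_* yᵢ) (sym a∙w≡1) ⟩
          (a ∙ w) * yᵢ                                                      ≡⟨ eq ⟩
          k₀ * aᵢ + (+ l * uⱼ * wₖ - + l * uₖ * wⱼ)                         ≡⟨ cong (λ t → t * aᵢ + (+ l * uⱼ * wₖ - + l * uₖ * wⱼ)) (ℤD.a≡a%ℕn+[a/ℕn]*n k₀ l {{l≢0}}) ⟩
          (+ k + j * + l) * aᵢ + (+ l * uⱼ * wₖ - + l * uₖ * wⱼ)            ≡⟨ raw (+ k) j (+ l) aᵢ uⱼ uₖ wⱼ wₖ ⟩
          + k * aᵢ + + l * (+ 1 * (uⱼ * wₖ - uₖ * wⱼ) + j * aᵢ)             ∎
          where
          raw : ∀ k j l a u v w z → (k + j * l) * a + (l * u * z - l * v * w) ≡ k * a + l * (+ 1 * (u * z - v * w) + j * a)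
          raw = ℤSolver.solve-∀

  reducedDiscriminant : ∀ {l k a y} (R : Reduced l k a y) →
    + (l ℕ.* l ℕ.* norm (a ⨯ Reduced.b R)) ≡ (a ∙ a) * (y ∙ y) - (a ∙ y) * (a ∙ y)
  reducedDiscriminant {l} {k} {a} {y} (reduced b y≡ _) = begin
    + (l ℕ.* l ℕ.* norm (a ⨯ b))                         ≡⟨ trans (ℤ.pos-* (l ℕ.* l) (norm (a ⨯ b))) (cong (_* + norm (a ⨯ b)) (ℤ.pos-* l l)) ⟩
    + l * + l * + norm (a ⨯ b)                           ≡⟨ cong (+ l * + l *_) (trans (sym (v∙v≡norm (a ⨯ b))) (lagrange a b)) ⟩
    + l * + l * ((a ∙ a) * (b ∙ b) - (a ∙ b) * (a ∙ b))  ≡⟨ discriminant (+ k) (+ l) y≡ ⟩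
    (a ∙ a) * (y ∙ y) - (a ∙ y) * (a ∙ y)                ∎
    where open ≡-Reasoning

  -- Pairs with prescribed norms, inner product and normal form

  residue-unique : ∀ {A d l i i₀} .{{_ : NonZero d}} X → ℕC.Coprime l A → i ℕ.< l → i₀ ℕ.< l →
                   (+ i - + i₀) * + (A ℕ.* d) ≡ + (l ℕ.* d) * X → i ≡ i₀
  residue-unique {A} {d} {l} {i} {i₀} X cop i<l i₀<l eq = ℤ.+-injective (ℤ.i-j≡0⇒i≡j (+ i) (+ i₀) (ℤ.∣i∣≡0⇒i≡0 ∣δ∣≡0))
    where
    open ≡-Reasoning
    δ = + i - + i₀
    eq′ : δ * + A ≡ X * + l
    eq′ = ℤ.*-cancelʳ-≡ (δ * + A) (X * + l) (+ d) (begin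
      δ * + A * + d      ≡⟨ ℤ.*-assoc δ (+ A) (+ d) ⟩
      δ * (+ A * + d)    ≡⟨ cong (δ *_) (sym (ℤ.pos-* A d)) ⟩
      δ * + (A ℕ.* d)    ≡⟨ eq ⟩
      + (l ℕ.* d) * X    ≡⟨ cong (_* X) (ℤ.pos-* l d) ⟩
      + l * + d * X      ≡⟨ raw (+ l) (+ d) X ⟩
      X * + l * + d      ∎)
      where
      raw : ∀ l d X → l * d * X ≡ X * l * d
      raw = ℤSolver.solve-∀
    l∣∣δ∣ : l ℕ.∣ ℤ.∣ δ ∣
    l∣∣δ∣ = ℕC.coprime-divisor {o = ℤ.∣ δ ∣} cop (subst (l ℕ.∣_) (trans (ℤ.abs-* δ (+ A)) (ℕ.*-comm ℤ.∣ δ ∣ A)) (ℤ.∣⇒∣ᵤ (divides X eq′)))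
    ∣δ∣<l : ℤ.∣ δ ∣ ℕ.< l
    ∣δ∣<l = ℕ.≤-<-trans (subst (λ z → ℤ.∣ z ∣ ℕ.≤ i ℕ.⊔ i₀) (sym (ℤ.m-n≡m⊖n i i₀)) (ℤ.∣m⊝n∣≤m⊔n i i₀)) (ℕ.⊔-lub i<l i₀<l)
    ∣δ∣≡0 : ℤ.∣ δ ∣ ≡ 0
    ∣δ∣≡0 with ℤ.∣ δ ∣ | l∣∣δ∣ | ∣δ∣<l
    ... | zero  | _ | _  = refl
    ... | suc n | h | lt = contradiction (ℕ.∣⇒≤ h) (ℕ.<⇒≱ lt)

  -- Here l d is the index of the normal form, its k is i + j l, and d is meant as gcd(|a|², l d).
  -- In s = k A d + l d (a ∙ b) the residue i is forced once l and A are coprime, so it is a field;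
  -- the quotient j stays free and is a parameter.
  record Slice (A d l j : ℕ) (s Y : ℤ) (a y : V) : Set where
    constructor slice
    field
      a∙a≡Ad : a ∙ a ≡ + (A ℕ.* d)
      a∙y≡s  : a ∙ y ≡ s
      y∙y≡Y  : y ∙ y ≡ Y
      i      : ℕ
      i<l    : i ℕ.< l
      ld,k   : Reduced (l ℕ.* d) (i ℕ.+ j ℕ.* l) a y

  sliceDiscriminant : ∀ {A d l j s Y a y} (S : Slice A d l j s Y a y) →
    + ((l ℕ.* d) ℕ.* (l ℕ.* d) ℕ.* norm (a ⨯ Reduced.b (Slice.ld,k S))) ≡ + (A ℕ.* d) * Y - s * s
  sliceDiscriminant (slice a∙a≡ a∙y≡s y∙y≡Y _ _ R) = trans (reducedDiscriminant R)
    (cong₂ _-_ (cong₂ _*_ a∙a≡ y∙y≡Y) (cong₂ _*_ a∙y≡s a∙y≡s))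

  module _ {A d l j t : ℕ} {s Y : ℤ} {{l≢0 : NonZero l}} {{d≢0 : NonZero d}} (cop : ℕC.Coprime l A)
    (τ≤t : ∀ m .{{_ : NonZero m}} → + ((l ℕ.* d) ℕ.* (l ℕ.* d) ℕ.* m) ≡ + (A ℕ.* d) * Y - s * s → length (divisors m) ℕ.≤ t) where

    private
      L = l ℕ.* d
      instance
        L≢0 : NonZero L
        L≢0 = ℕ.m*n≢0 l d
        +L*L≢0 : ℤ.NonZero (+ L * + L)
        +L*L≢0 = ℤ.i*j≢0 (+ L) (+ L)

    -- Compare with one slice: subtracting the two expressions for s gives (i - i₀) A d as a
    -- multiple of l d, so i = i₀. Then s and Y determine a ∙ b and b ∙ b, and only bases with one
    -- Gram matrix remain.
    atMost-slice : AtMost (Product.uncurry (Slice A d l j s Y)) (t ℕ.* κ)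
    atMost-slice = atMost-witness (λ (a₀ , y₀) S₀ → go a₀ y₀ S₀)
      where
      open ≡-Reasoning
      go : ∀ a₀ y₀ → Slice A d l j s Y a₀ y₀ → AtMost (Product.uncurry (Slice A d l j s Y)) (t ℕ.* κ)
      go a₀ y₀ S₀@(slice a₀∙a₀≡ a₀∙y₀≡ y₀∙y₀≡ i₀ i₀<l (reduced b₀ y₀≡ cop₀)) =
        atMost-mono toBasis ℕ.≤-refl (atMost-image (λ (a , b) → a , lin (+ k) a (+ L) b)
          (atMost-basis {+ (A ℕ.* d)} {B} {C} {m} {{coprime⇒norm≢0 (a₀ ⨯ b₀) cop₀}} m≡ (τ≤t m {{coprime⇒norm≢0 (a₀ ⨯ b₀) cop₀}} (sliceDiscriminant S₀))))
        where
        k = i₀ ℕ.+ j ℕ.* l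
        B = a₀ ∙ b₀
        C = b₀ ∙ b₀
        m = norm (a₀ ⨯ b₀)
        m≡ : + m ≡ + (A ℕ.* d) * C - B * B
        m≡ = trans (sym (v∙v≡norm (a₀ ⨯ b₀))) (trans (lagrange a₀ b₀) (cong (λ z → z * C - B * B) a₀∙a₀≡))
        s≡₀ : s ≡ + k * + (A ℕ.* d) + + L * B
        s≡₀ = trans (sym a₀∙y₀≡) (trans (a∙y≡ (+ k) (+ L) y₀≡) (cong (λ z → + k * z + + L * B) a₀∙a₀≡))
        Y≡₀ : Y ≡ + k * + k * + (A ℕ.* d) + + 2 * + k * + L * B + + L * + L * C
        Y≡₀ = trans (sym y₀∙y₀≡) (trans (y∙y≡ (+ k) (+ L) y₀≡) (cong (λ z → + k * + k * z + + 2 * + k * + L * B + + L * + L * C) a₀∙a₀≡))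
        sameGram : ∀ {a y b} → a ∙ a ≡ + (A ℕ.* d) → a ∙ y ≡ s → y ∙ y ≡ Y → y ≡ lin (+ k) a (+ L) b → Coprime (a ⨯ b) → Basis (+ (A ℕ.* d)) B C a b
        sameGram {a} {y} {b} a∙a≡ a∙y≡s y∙y≡Y y≡ cop′ = basis a∙a≡ a∙b≡B b∙b≡C cop′
          where
          cancel+ : ∀ {x y} z → z + x ≡ z + y → x ≡ y
          cancel+ {x} {y} z eq = trans (raw z x) (trans (cong (_- z) eq) (sym (raw z y)))
            where
            raw : ∀ z x → x ≡ z + x - z
            raw = ℤSolver.solve-∀
          a∙b≡B : a ∙ b ≡ B
          a∙b≡B = ℤ.*-cancelˡ-≡ (+ L) (a ∙ b) B (cancel+ (+ k * + (A ℕ.* d))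
            (trans (cong (λ z → + k * z + + L * (a ∙ b)) (sym a∙a≡)) (trans (sym (a∙y≡ (+ k) (+ L) y≡)) (trans a∙y≡s s≡₀))))
          b∙b≡C : b ∙ b ≡ C
          b∙b≡C = ℤ.*-cancelˡ-≡ (+ L * + L) (b ∙ b) C (cancel+ (+ k * + k * + (A ℕ.* d) + + 2 * + k * + L * B)
            (trans (cong₂ (λ z w → + k * + k * z + + 2 * + k * + L * w + + L * + L * (b ∙ b)) (sym a∙a≡) (sym a∙b≡B))
              (trans (sym (y∙y≡ (+ k) (+ L) y≡)) (trans y∙y≡Y Y≡₀))))
        toBasis : ∀ {ay} → Slice A d l j s Y (proj₁ ay) (proj₂ ay) →
                  ∃[ ab ] Basis (+ (A ℕ.* d)) B C (proj₁ ab) (proj₂ ab) × ay ≡ (proj₁ ab , lin (+ k) (proj₁ ab) (+ L) (proj₂ ab))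
        toBasis {a , y} (slice a∙a≡ a∙y≡s y∙y≡Y i i<l (reduced b y≡ cop′)) =
          (a , b) , sameGram a∙a≡ a∙y≡s y∙y≡Y y≡₀ cop′ , cong (a ,_) y≡₀
          where
          k′ = i ℕ.+ j ℕ.* l
          s≡ : s ≡ + k′ * + (A ℕ.* d) + + L * (a ∙ b)
          s≡ = trans (sym a∙y≡s) (trans (a∙y≡ (+ k′) (+ L) y≡) (cong (λ z → + k′ * z + + L * (a ∙ b)) a∙a≡))
          move : ∀ i i₀ j A L B b → (i + j) * A + L * b ≡ (i₀ + j) * A + L * B → (i - i₀) * A ≡ L * (B - b)
          move i i₀ j A L B b eq = trans (raw₁ i i₀ j A L b) (trans (cong (λ z → z - (i₀ + j) * A - L * b) eq) (raw₂ i₀ j A L B b))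
            where
            raw₁ : ∀ i i₀ j A L b → (i - i₀) * A ≡ (i + j) * A + L * b - (i₀ + j) * A - L * b
            raw₁ = ℤSolver.solve-∀
            raw₂ : ∀ i₀ j A L B b → (i₀ + j) * A + L * B - (i₀ + j) * A - L * b ≡ L * (B - b)
            raw₂ = ℤSolver.solve-∀
          i≡i₀ : i ≡ i₀
          i≡i₀ = residue-unique {A} {d} (B - a ∙ b) cop i<l i₀<l
            (move (+ i) (+ i₀) (+ (j ℕ.* l)) (+ (A ℕ.* d)) (+ L) B (a ∙ b) (trans (sym s≡) s≡₀))
          y≡₀ : y ≡ lin (+ k) a (+ L) b
          y≡₀ = trans y≡ (cong (λ i → lin (+ (i ℕ.+ j ℕ.* l)) a (+ L) b) i≡i₀)

  -- Lattice points on circles and spheres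

  module _ {A₀ : ℕ} {s Y : ℤ} {a y : V} (a∙a≡ : a ∙ a ≡ + A₀) (a∙y≡s : a ∙ y ≡ s) (y∙y≡Y : y ∙ y ≡ Y)
           (a-coprime : Coprime a) (a⨯y≢0 : NonZero (norm (a ⨯ y))) where

    -- d = gcd(A₀, L) for the normal form with parameters L and k. It divides s = k A₀ + L (a ∙ b),
    -- the fact that later makes it divide the gap.
    toSlice : ∃[ d ] ∃[ A ] ∃[ j ] ∃[ l ] NonZero d × NonZero l × A₀ ≡ A ℕ.* d × ℕC.Coprime l A × j ℕ.< d × (+ d ∣ s) × Slice A d l j s Y a y
    toSlice = let (L , L≢0 , k , k<L , red) = reduce a-coprime a⨯y≢0 in go L k L≢0 k<L red
      where
      SliceOf = ∃[ d ] ∃[ A ] ∃[ j ] ∃[ l ] NonZero d × NonZero l × A₀ ≡ A ℕ.* d × ℕC.Coprime l A × j ℕ.< d × (+ d ∣ s) × Slice A d l j s Y a y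
      split-gcd : ∀ L k → NonZero L → k ℕ.< L → Reduced L k a y →
                  ∀ d A l → A₀ ≡ A ℕ.* d → L ≡ l ℕ.* d → (∀ {c} → c ℕ.∣ A₀ → c ℕ.∣ L → c ℕ.∣ d) → SliceOf
      split-gcd L k L≢0 k<L red@(reduced b y≡ _) d A l A₀≡ L≡ greatest =
        d , A , k ℕ./ l , l , d≢0 , l≢0 , A₀≡ , coprime , ℕ.m<n*o⇒m/o<n (subst (k ℕ.<_) (trans L≡ (ℕ.*-comm l d)) k<L) , d∣s ,
        slice (trans a∙a≡ (cong +_ A₀≡)) a∙y≡s y∙y≡Y (k ℕ.% l) (ℕ.m%n<n k l)
          (subst₂ (λ L k → Reduced L k a y) L≡ (ℕ.m≡m%n+[m/n]*n k l) red)
        where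
        d≢0 : NonZero d
        d≢0 = ℕ.m*n≢0⇒n≢0 l {{subst NonZero L≡ L≢0}}
        instance
          l≢0 : NonZero l
          l≢0 = ℕ.m*n≢0⇒m≢0 l {{subst NonZero L≡ L≢0}}
        coprime : ℕC.Coprime l A
        coprime {c} (c∣l , c∣A) = ℕ.∣1⇒≡1 (ℕ.*-cancelʳ-∣ d {{d≢0}} (subst (c ℕ.* d ℕ.∣_) (sym (ℕ.*-identityˡ d))
          (greatest (subst (c ℕ.* d ℕ.∣_) (sym A₀≡) (ℕ.*-monoˡ-∣ d c∣A)) (subst (c ℕ.* d ℕ.∣_) (sym L≡) (ℕ.*-monoˡ-∣ d c∣l)))))
        d∣s : + d ∣ s
        d∣s = subst (+ d ∣_) (trans (sym (a∙y≡ (+ k) (+ L) y≡)) a∙y≡s)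
          (ℤ.∣m∣n⇒∣m+n (ℤ.∣n⇒∣m*n (+ k) (subst (+ d ∣_) (sym a∙a≡) (ℤ.∣ᵤ⇒∣ (ℕ.divides A A₀≡))))
                       (ℤ.∣m⇒∣m*n {m = + L} (a ∙ b) (ℤ.∣ᵤ⇒∣ (ℕ.divides l L≡))))
      go : ∀ L k → NonZero L → k ℕ.< L → Reduced L k a y → SliceOf
      go L k L≢0 k<L red =
        let ℕ.divides A A₀≡ = GCD.gcd[m,n]∣m A₀ L
            ℕ.divides l L≡ = GCD.gcd[m,n]∣n A₀ L
        in split-gcd L k L≢0 k<L red (gcd A₀ L) A l A₀≡ L≡ GCD.gcd-greatest

  discriminant≤ : ∀ {A Y D s} → + D ≡ + A * + Y - s * s → D ℕ.≤ A ℕ.* Y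
  discriminant≤ {A} {Y} {D} {s} eq = ℕ.m+n≤o⇒m≤o D (ℕ.≤-reflexive (ℤ.+-injective (begin
    + D + + sq s                    ≡⟨ cong₂ _+_ eq (sym (∣i∣² s)) ⟩
    + A * + Y - s * s + s * s       ≡⟨ raw (+ A * + Y) (s * s) ⟩
    + A * + Y                       ≡⟨ sym (ℤ.pos-* A Y) ⟩
    + (A ℕ.* Y)                     ∎)))
    where
    open ≡-Reasoning
    raw : ∀ x y → x - y + y ≡ x
    raw = ℤSolver.solve-∀

  -- With x ∙ y = n - η one has η = g (g A d - a ∙ y), and (q + 1) d is the second factor. It is a
  -- multiple of d because d divides a ∙ y, and positive because η = 0 would make x and y parallel.
  record Skew (n H g d A q j l : ℕ) (x y : V) : Set where
    constructor skew
    field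
      a     : V
      x≡    : x ≡ + g • a
      n≡    : n ≡ g ℕ.* (g ℕ.* (A ℕ.* d))
      d≢0   : NonZero d
      dq≤H  : suc q ℕ.* d ℕ.≤ H
      j<d   : j ℕ.< d
      l≢0   : NonZero l
      cop   : ℕC.Coprime l A
      inner : Slice A d l j (+ (g ℕ.* (A ℕ.* d)) - + (suc q ℕ.* d)) (+ n) a y

  -- Taking the gap `η` in ℕ builds in x ∙ y ≤ n.
  record Close (n H : ℕ) (x y : V) : Set where
    constructor close
    field
      x∙x≡n : x ∙ x ≡ + n
      y∙y≡n : y ∙ y ≡ + n
      η     : ℕ
      η≤H   : η ℕ.≤ H
      x∙y≡  : x ∙ y ≡ + n - + η

  module _ {n H : ℕ} .{{_ : NonZero n}} {x y : V} (c : Close n H x y) where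
    open Close c
    open ≡-Reasoning

    norm[x⨯y] : + norm (x ⨯ y) ≡ + n * + n - (x ∙ y) * (x ∙ y)
    norm[x⨯y] = trans (sym (v∙v≡norm (x ⨯ y))) (trans (lagrange x y) (cong₂ (λ s t → s * t - (x ∙ y) * (x ∙ y)) x∙x≡n y∙y≡n))

    toSkew : NonZero (norm (x ⨯ y)) → ∃[ g ] ∃[ d ] ∃[ A ] ∃[ q ] ∃[ j ] ∃[ l ] Skew n H g d A q j l x y
    toSkew x⨯y≢0 = let (g , g≢0 , a , x≡ , cop) = coprimePart x (subst NonZero n≡norm (ℕ.>-nonZero (ℕ.>-nonZero⁻¹ n)))
                   in go g g≢0 a x≡ cop
      where
      n≡norm : n ≡ norm x
      n≡norm = ℤ.+-injective (trans (sym x∙x≡n) (v∙v≡norm x))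
      go : ∀ g → NonZero g → ∀ a → x ≡ + g • a → Coprime a → ∃[ g ] ∃[ d ] ∃[ A ] ∃[ q ] ∃[ j ] ∃[ l ] Skew n H g d A q j l x y
      go g g≢0 a x≡ cop =
        let (d , A , j , l , d≢0 , l≢0 , A₀≡ , l-cop , j<d , d∣s , S) = toSlice (v∙v≡norm a) refl y∙y≡n cop a⨯y≢0
            (q , gap≡) = gap d A A₀≡ d∣s
        in g , d , A , q , j , l , skew a x≡ (trans n≡ggA (cong (λ k → g ℕ.* (g ℕ.* k)) A₀≡)) d≢0 (small d q gap≡) j<d l≢0 l-cop
             (subst (λ s → Slice A d l j s (+ n) a y) (solve-s (cong (λ k → + (g ℕ.* k)) A₀≡) gap≡) S)
        where
        A₀ = norm a
        s = a ∙ y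
        n≡ggA : n ≡ g ℕ.* (g ℕ.* A₀)
        n≡ggA = ℤ.+-injective (begin
          + n                          ≡⟨ sym x∙x≡n ⟩
          x ∙ x                        ≡⟨ cong (_∙ x) x≡ ⟩
          (+ g • a) ∙ x                ≡⟨ •-∙ (+ g) a x ⟩
          + g * (a ∙ x)                ≡⟨ cong (λ v → + g * v) (trans (∙-comm a x) (trans (cong (_∙ a) x≡) (•-∙ (+ g) a a))) ⟩
          + g * (+ g * (a ∙ a))        ≡⟨ cong (λ v → + g * (+ g * v)) (v∙v≡norm a) ⟩
          + g * (+ g * + A₀)           ≡⟨ cong (λ v → + g * v) (sym (ℤ.pos-* g A₀)) ⟩
          + g * + (g ℕ.* A₀)           ≡⟨ sym (ℤ.pos-* g (g ℕ.* A₀)) ⟩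
          + (g ℕ.* (g ℕ.* A₀))         ∎)
        x∙y≡gs : x ∙ y ≡ + g * s
        x∙y≡gs = trans (cong (_∙ y) x≡) (•-∙ (+ g) a y)
        -- |x ⨯ y|² = g² |a ⨯ y|².
        a⨯y≢0 : NonZero (norm (a ⨯ y))
        a⨯y≢0 = ℕ.≢-nonZero λ eq → ℕ.≢-nonZero⁻¹ (norm (x ⨯ y)) {{x⨯y≢0}} (ℤ.+-injective (begin
          + norm (x ⨯ y)                                       ≡⟨ norm[x⨯y] ⟩
          + n * + n - (x ∙ y) * (x ∙ y)                        ≡⟨ cong₂ (λ u v → u * + n - v * v) (trans (cong +_ n≡ggA) (trans (ℤ.pos-* g (g ℕ.* A₀)) (cong (λ v → + g * v) (ℤ.pos-* g A₀)))) x∙y≡gs ⟩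
          + g * (+ g * + A₀) * + n - + g * s * (+ g * s)       ≡⟨ raw (+ g) (+ A₀) (+ n) s ⟩
          + g * + g * (+ A₀ * + n - s * s)                     ≡⟨ cong (λ v → + g * + g * v) (sym (trans (lagrange a y) (cong₂ (λ u v → u * v - s * s) (v∙v≡norm a) y∙y≡n))) ⟩
          + g * + g * ((a ⨯ y) ∙ (a ⨯ y))                      ≡⟨ cong (λ v → + g * + g * v) (trans (v∙v≡norm (a ⨯ y)) (cong +_ eq)) ⟩
          + g * + g * 0ℤ                                       ≡⟨ ℤ.*-zeroʳ (+ g * + g) ⟩
          + 0                                                  ∎))
          where
          raw : ∀ g A n s → g * (g * A) * n - g * s * (g * s) ≡ g * g * (A * n - s * s)
          raw = ℤSolver.solve-∀
        η≡ : + g * (+ (g ℕ.* A₀) - s) ≡ + η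
        η≡ = begin
          + g * (+ (g ℕ.* A₀) - s)              ≡⟨ raw (+ g) (+ (g ℕ.* A₀)) s ⟩
          + g * + (g ℕ.* A₀) - + g * s          ≡⟨ cong₂ _-_ (trans (sym (ℤ.pos-* g (g ℕ.* A₀))) (cong +_ (sym n≡ggA))) (trans (sym x∙y≡gs) x∙y≡) ⟩
          + n - (+ n - + η)                     ≡⟨ raw′ (+ n) (+ η) ⟩
          + η                                   ∎
          where
          raw : ∀ g A s → g * (A - s) ≡ g * A - g * s
          raw = ℤSolver.solve-∀
          raw′ : ∀ n η → n - (n - η) ≡ η
          raw′ = ℤSolver.solve-∀
        η≢0 : η ≢ 0
        η≢0 eq = ℕ.≢-nonZero⁻¹ (norm (x ⨯ y)) {{x⨯y≢0}} (ℤ.+-injective (begin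
          + norm (x ⨯ y)                                       ≡⟨ norm[x⨯y] ⟩
          + n * + n - (x ∙ y) * (x ∙ y)                        ≡⟨ cong (λ v → + n * + n - v * v) (trans x∙y≡ (cong (λ k → + n - + k) eq)) ⟩
          + n * + n - (+ n - + 0) * (+ n - + 0)                ≡⟨ raw (+ n) ⟩
          + 0                                                  ∎))
          where
          raw : ∀ n → n * n - (n - + 0) * (n - + 0) ≡ + 0
          raw = ℤSolver.solve-∀
        gap : ∀ d A → A₀ ≡ A ℕ.* d → + d ∣ s → ∃[ q ] + (g ℕ.* A₀) - s ≡ + (suc q ℕ.* d)
        gap d A A₀≡ d∣s = positive (ℤ.∣m∣n⇒∣m-n {m = + (g ℕ.* A₀)} (ℤ.∣ᵤ⇒∣ (ℕ.∣n⇒∣m*n g (ℕ.divides A A₀≡))) d∣s)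
          where
          positive : + d ∣ + (g ℕ.* A₀) - s → ∃[ q ] + (g ℕ.* A₀) - s ≡ + (suc q ℕ.* d)
          positive (divides (+ suc q) eq) = q , trans eq (sym (ℤ.pos-* (suc q) d))
          positive (divides (+ zero) eq)  = contradiction
            (ℤ.+-injective (trans (sym η≡) (trans (cong (λ v → + g * v) eq) (ℤ.*-zeroʳ (+ g))))) η≢0
          positive (divides -[1+ c ] eq) = contradiction (trans (sym η≡) (trans (cong (λ v → + g * v) eq) neg)) (absurd η≢0 (g ℕ.* (suc c ℕ.* d)))
            where
            neg : + g * (-[1+ c ] * + d) ≡ - + (g ℕ.* (suc c ℕ.* d))
            neg = trans (raw (+ g) (+ suc c) (+ d)) (cong -_ (trans (cong (λ v → + g * v) (sym (ℤ.pos-* (suc c) d))) (sym (ℤ.pos-* g (suc c ℕ.* d)))))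
              where
              raw : ∀ g c d → g * ((- c) * d) ≡ - (g * (c * d))
              raw = ℤSolver.solve-∀
            absurd : ∀ {η} → η ≢ 0 → ∀ k → + η ≢ - + k
            absurd {zero}  η≢0 _       _  = η≢0 refl
            absurd {suc η} _   zero    ()
            absurd {suc η} _   (suc k) ()
        small : ∀ d q → + (g ℕ.* A₀) - s ≡ + (suc q ℕ.* d) → suc q ℕ.* d ℕ.≤ H
        small d q gap≡ = ℕ.≤-trans (ℕ.m≤n*m (suc q ℕ.* d) g {{g≢0}}) (subst (ℕ._≤ H)
          (ℤ.+-injective (trans (sym η≡) (trans (cong (λ v → + g * v) gap≡) (sym (ℤ.pos-* g (suc q ℕ.* d)))))) η≤H)
        solve-s : ∀ {G G′ δ} → G ≡ G′ → G - s ≡ δ → s ≡ G′ - δ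
        solve-s {G} refl refl = raw G s
          where
          raw : ∀ G s → s ≡ G - (G - s)
          raw = ℤSolver.solve-∀

    -- (n - x ∙ y) (n + x ∙ y) = |x ⨯ y|² = 0, and the two factors are half of |y - x|² and of |y +
    -- x|².
    parallel : norm (x ⨯ y) ≡ 0 → y ≡ x ⊎ y ≡ -1ℤ • x
    parallel eq = Sum.map equal opposite (ℤ.i*j≡0⇒i≡0∨j≡0 (+ n - (x ∙ y)) (begin
        (+ n - (x ∙ y)) * (+ n + (x ∙ y))       ≡⟨ factor (+ n) (x ∙ y) ⟩
        + n * + n - (x ∙ y) * (x ∙ y)           ≡⟨ sym norm[x⨯y] ⟩
        + norm (x ⨯ y)                          ≡⟨ cong +_ eq ⟩
        0ℤ                                      ∎))
      where
      factor : ∀ a b → (a - b) * (a + b) ≡ a * a - b * b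
      factor = ℤSolver.solve-∀
      vanish : ∀ c → (lin 1ℤ y c x) ∙ (lin 1ℤ y c x) ≡ 0ℤ → lin 1ℤ y c x ≡ ⟨ 0ℤ , 0ℤ , 0ℤ ⟩
      vanish c h = norm≡0 (lin 1ℤ y c x) (ℤ.+-injective (trans (sym (v∙v≡norm (lin 1ℤ y c x))) h))
      expand : ∀ c → (lin 1ℤ y c x) ∙ (lin 1ℤ y c x) ≡ + n + + 2 * c * (x ∙ y) + c * c * + n
      expand c = trans (y∙y≡ {y} {lin 1ℤ y c x} {x} 1ℤ c refl) (trans (cong₂ _+_ (cong₂ (λ u v → 1ℤ * 1ℤ * u + + 2 * 1ℤ * c * v) y∙y≡n (∙-comm y x)) (cong (c * c *_) x∙x≡n)) (raw c (+ n) (x ∙ y)))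
        where
        raw : ∀ c n p → + 1 * + 1 * n + + 2 * + 1 * c * p + c * c * n ≡ n + + 2 * c * p + c * c * n
        raw = ℤSolver.solve-∀
      equal : + n - (x ∙ y) ≡ 0ℤ → y ≡ x
      equal h = let v = vanish -1ℤ (trans (expand -1ℤ) (trans (raw (+ n) (x ∙ y)) (cong (λ z → + 2 * z) h)))
                in V-≡ (move (cong x₁ v)) (move (cong x₂ v)) (move (cong x₃ v))
        where
        raw : ∀ n p → n + + 2 * (- + 1) * p + (- + 1) * (- + 1) * n ≡ + 2 * (n - p)
        raw = ℤSolver.solve-∀
        move : ∀ {p q} → 1ℤ * p + -1ℤ * q ≡ 0ℤ → p ≡ q
        move {p} {q} h = trans (raw′ p q) (trans (cong (_+ q) h) (ℤ.+-identityˡ q))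
          where
          raw′ : ∀ p q → p ≡ (+ 1 * p + (- + 1) * q) + q
          raw′ = ℤSolver.solve-∀
      opposite : + n + (x ∙ y) ≡ 0ℤ → y ≡ -1ℤ • x
      opposite h = let v = vanish 1ℤ (trans (expand 1ℤ) (trans (raw (+ n) (x ∙ y)) (cong (λ z → + 2 * z) h)))
                   in V-≡ (move (cong x₁ v)) (move (cong x₂ v)) (move (cong x₃ v))
        where
        raw : ∀ n p → n + + 2 * + 1 * p + + 1 * + 1 * n ≡ + 2 * (n + p)
        raw = ℤSolver.solve-∀
        move : ∀ {p q} → 1ℤ * p + 1ℤ * q ≡ 0ℤ → p ≡ -1ℤ * q
        move {p} {q} h = trans (raw′ p q) (trans (cong (_+ -1ℤ * q) h) (ℤ.+-identityˡ (-1ℤ * q)))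
          where
          raw′ : ∀ p q → p ≡ (+ 1 * p + + 1 * q) + (- + 1) * q
          raw′ = ℤSolver.solve-∀

  -- Counting on circles, on the sphere and over close pairs

  module _ {n t : ℕ} .{{_ : NonZero n}} (τ≤t : ∀ m .{{_ : NonZero m}} → m ℕ.≤ n ℕ.* n → length (divisors m) ℕ.≤ t) where

    private
      -- By the discriminant identity l divides the fixed nonzero number A d n - s², which is at
      -- most n². One factor t counts l, the other the bases in `atMost-slice`.
      atMost-slices : ∀ A d j s .{{_ : NonZero d}} → A ℕ.* d ℕ.≤ n →
        AtMost (λ ay → ∃[ l ] NonZero l × ℕC.Coprime l A × Product.uncurry (Slice A d l j s (+ n)) ay) (t ℕ.* (t ℕ.* κ))
      atMost-slices A d j s Ad≤n = atMost-witness λ (a₀ , y₀) (l₀ , l₀≢0 , _ , S₀) → go l₀ {{l₀≢0}} S₀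
        where
        -- The absolute value matters only when there are no slices: any slice shows that the
        -- expression is positive.
        D = ℤ.∣ + (A ℕ.* d) * + n - s * s ∣
        Q : ℕ → V × V → Set
        Q l ay = NonZero l × ℕC.Coprime l A × Product.uncurry (Slice A d l j s (+ n)) ay
        size : ∀ {D} → + D ≡ + (A ℕ.* d) * + n - s * s → D ℕ.≤ n ℕ.* n
        size eq = ℕ.≤-trans (discriminant≤ {A ℕ.* d} {n} {s = s} eq) (ℕ.*-monoˡ-≤ n Ad≤n)
        atMost-l : ∀ l → AtMost (Q l) (t ℕ.* κ)
        atMost-l l = atMost-witness λ _ (l≢0 , cop , _) → atMost-mono (λ (_ , _ , S) → S) ℕ.≤-refl
          (atMost-slice {{l≢0}} {{ℕ.>-nonZero (ℕ.>-nonZero⁻¹ d)}} cop λ m eq → τ≤t m (ℕ.≤-trans (ℕ.m≤n*m m (l ℕ.* d ℕ.* (l ℕ.* d)) {{LL≢0 l l≢0}}) (size eq)))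
          where
          LL≢0 : ∀ l → NonZero l → NonZero (l ℕ.* d ℕ.* (l ℕ.* d))
          LL≢0 l l≢0 = ℕ.m*n≢0 (l ℕ.* d) (l ℕ.* d) {{ℕ.m*n≢0 l d {{l≢0}}}} {{ℕ.m*n≢0 l d {{l≢0}}}}
        D≡ : ∀ {l a y} .{{_ : NonZero l}} → Slice A d l j s (+ n) a y → + D ≡ + (A ℕ.* d) * + n - s * s × NonZero D × l ℕ.∣ D
        D≡ {l} {a} S = fromCofactor _ (coprime⇒norm≢0 (a ⨯ Reduced.b R) (Reduced.coprime R)) (sliceDiscriminant S)
          where
          R = Slice.ld,k S
          L = l ℕ.* d
          fromCofactor : ∀ m → NonZero m → + (L ℕ.* L ℕ.* m) ≡ + (A ℕ.* d) * + n - s * s →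
                         + D ≡ + (A ℕ.* d) * + n - s * s × NonZero D × l ℕ.∣ D
          fromCofactor m m≢0 eq = trans (cong +_ (sym D′≡D)) eq ,
              subst NonZero D′≡D (ℕ.m*n≢0 (L ℕ.* L) m {{ℕ.m*n≢0 L L {{ℕ.m*n≢0 l d}} {{ℕ.m*n≢0 l d}}}} {{m≢0}}) ,
              subst (l ℕ.∣_) D′≡D (ℕ.∣m⇒∣m*n m (ℕ.∣m⇒∣m*n L (ℕ.m∣m*n d)))
            where
            D′≡D : L ℕ.* L ℕ.* m ≡ D
            D′≡D = cong ℤ.∣_∣ eq
        go : ∀ l₀ {{_ : NonZero l₀}} {a₀ y₀} → Slice A d l₀ j s (+ n) a₀ y₀ →
             AtMost (λ ay → ∃[ l ] NonZero l × ℕC.Coprime l A × Product.uncurry (Slice A d l j s (+ n)) ay) (t ℕ.* (t ℕ.* κ))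
        go l₀ S₀ = let (eq , D≢0 , _) = D≡ S₀ in atMost-mono
          (λ (l , l≢0 , cop , S) → l , ∈-divisors {{D≢0}} (proj₂ (proj₂ (D≡ {{l≢0}} S))) , l≢0 , cop , S)
          (ℕ.*-monoˡ-≤ (t ℕ.* κ) (τ≤t D {{D≢0}} (size eq)))
          (atMost-⋃ (divisors D) (λ {l} _ → atMost-l l))

    -- The term 1 is the point (s, 0, 0) parallel to e₁. Every other y forms a slice with a = e₁,
    -- where |a|² = 1 forces A = d = 1 and j = 0.
    atMost-circle : ∀ s → AtMost (λ y → y ∙ y ≡ + n × e₁ ∙ y ≡ s) (1 ℕ.+ t ℕ.* (t ℕ.* κ))
    atMost-circle s = atMost-mono cases ℕ.≤-refl (atMost-∪ (atMost-one {P = Axis} axis-unique)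
        (atMost-image proj₂ (atMost-slices 1 1 0 s (ℕ.>-nonZero⁻¹ n))))
      where
      Axis : V → Set
      Axis y = y ≡ ⟨ s , 0ℤ , 0ℤ ⟩
      OffAxis : V → Set
      OffAxis y = ∃[ ay ] (∃[ l ] NonZero l × ℕC.Coprime l 1 × Product.uncurry (Slice 1 1 l 0 s (+ n)) ay) × y ≡ proj₂ ay
      axis-unique : ∀ {x y} → Axis x → Axis y → x ≡ y
      axis-unique p q = trans p (sym q)
      toOffAxis : ∀ {y} → y ∙ y ≡ + n → e₁ ∙ y ≡ s → NonZero (norm (e₁ ⨯ y)) → OffAxis y
      toOffAxis {y} y∙y≡n e₁∙y≡s h = let (d , A , j , l , d≢0 , l≢0 , eq , cop , j<d , _ , S) = toSlice refl e₁∙y≡s y∙y≡n (e₁ , refl) h in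
        go d A j l (ℕ.m*n≡1⇒m≡1 A d (sym eq)) (ℕ.m*n≡1⇒n≡1 A d (sym eq)) l≢0 cop j<d S
        where
        go : ∀ d A j l → A ≡ 1 → d ≡ 1 → NonZero l → ℕC.Coprime l A → j ℕ.< d → Slice A d l j s (+ n) e₁ y → OffAxis y
        go d A zero    l refl refl l≢0 cop _ S = (e₁ , y) , (l , l≢0 , cop , S) , refl
        go d A (suc j) l refl refl _ _ (ℕ.s≤s ()) _
      cases : ∀ {y} → y ∙ y ≡ + n × e₁ ∙ y ≡ s → Axis y ⊎ OffAxis y
      cases {y} (y∙y≡n , e₁∙y≡s) with norm (e₁ ⨯ y) in eq
      ... | zero  = inj₁ (V-≡ (trans (sym (∙e₁ y)) (trans (∙-comm y e₁) e₁∙y≡s))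
                      (trans (raw₂ (x₁ y) (x₂ y)) (cong x₃ (norm≡0 (e₁ ⨯ y) eq)))
                      (trans (raw₃ (x₁ y) (x₃ y)) (cong (λ v → - x₂ v) (norm≡0 (e₁ ⨯ y) eq))))
        where
        raw₂ : ∀ x y → y ≡ + 1 * y - + 0 * x
        raw₂ = ℤSolver.solve-∀
        raw₃ : ∀ x y → y ≡ - (+ 0 * x - + 1 * y)
        raw₃ = ℤSolver.solve-∀
      ... | suc _ = inj₂ (toOffAxis y∙y≡n e₁∙y≡s (subst NonZero (sym eq) _))

    atMost-sphere : ∀ r → n ℕ.< suc r ℕ.* suc r → AtMost (λ y → y ∙ y ≡ + n) ((suc r ℕ.+ r) ℕ.* (1 ℕ.+ t ℕ.* (t ℕ.* κ)))
    atMost-sphere r n<r² = atMost-mono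
      (λ {y} y∙y≡n → e₁ ∙ y , ∈-interval (e₁ ∙ y) (bound y y∙y≡n) , y∙y≡n , refl)
      (ℕ.≤-reflexive (cong (ℕ._* (1 ℕ.+ t ℕ.* (t ℕ.* κ))) length-interval))
      (atMost-⋃ interval λ {s} _ → atMost-circle s)
      where
      interval : List ℤ
      interval = List.map +_ (upTo (suc r)) List.++ List.map -[1+_] (upTo r)
      length-interval : length interval ≡ suc r ℕ.+ r
      length-interval = trans (List.length-++ (List.map +_ (upTo (suc r)))) (cong₂ ℕ._+_
        (trans (List.length-map +_ (upTo (suc r))) (List.length-upTo (suc r))) (trans (List.length-map -[1+_] (upTo r)) (List.length-upTo r)))
      ∈-interval : ∀ i → ℤ.∣ i ∣ ℕ.≤ r → i ∈ˡ interval
      ∈-interval (+ i)    i≤r = Mem.∈-++⁺ˡ (Mem.∈-map⁺ +_ (Mem.∈-upTo⁺ (ℕ.s≤s i≤r)))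
      ∈-interval -[1+ i ] i<r = Mem.∈-++⁺ʳ (List.map +_ (upTo (suc r))) (Mem.∈-map⁺ -[1+_] (Mem.∈-upTo⁺ i<r))
      bound : ∀ y → y ∙ y ≡ + n → ℤ.∣ e₁ ∙ y ∣ ℕ.≤ r
      bound y y∙y≡n = subst (λ i → ℤ.∣ i ∣ ℕ.≤ r) (trans (sym (∙e₁ y)) (∙-comm y e₁))
        (ℕ.s≤s⁻¹ (ℕ.≰⇒> λ 1+r≤ → ℕ.<⇒≱ n<r² (ℕ.≤-trans (ℕ.*-mono-≤ 1+r≤ 1+r≤)
          (ℕ.≤-trans (ℕ.≤-trans (ℕ.m≤m+n (sq (x₁ y)) (sq (x₂ y))) (ℕ.m≤m+n _ (sq (x₃ y))))
            (ℕ.≤-reflexive (ℤ.+-injective (trans (sym (v∙v≡norm y)) y∙y≡n)))))))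

    -- d = gcd(|a|², l) divides the gap η/g = (q + 1) d, so the d values of j are paid for by the H / d values of q.
    atMost-skew : ∀ H → AtMost (λ (xy : V × V) → ∃[ g ] ∃[ d ] ∃[ A ] ∃[ q ] ∃[ j ] ∃[ l ] Product.uncurry (Skew n H g d A q j l) xy)
                          (t ℕ.* (t ℕ.* (t ℕ.* (H ℕ.* (t ℕ.* (t ℕ.* κ))))))
    atMost-skew H = atMost-mono (λ (g , d , A , q , j , l , S) → g , ∈-divisors (g∣n S) , d , A , q , j , l , S) (div (t ℕ.* (t ℕ.* (H ℕ.* b))))
      (atMost-⋃ {R = R₁} (divisors n) λ {g} _ → atMost-mono (λ (d , A , q , j , l , S) → d , ∈-divisors (d∣n S) , A , q , j , l , S) (div (t ℕ.* (H ℕ.* b)))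
      (atMost-⋃ {R = R₂ g} (divisors n) λ {d} _ → atMost-mono (λ (A , q , j , l , S) → A , ∈-divisors (A∣n S) , q , j , l , S) (div (H ℕ.* b))
      (atMost-⋃ {R = R₃ g d} (divisors n) λ {A} _ → fixed g d A)))
      where
      b = t ℕ.* (t ℕ.* κ)
      R₃ : ℕ → ℕ → ℕ → V × V → Set
      R₃ g d A xy = ∃[ q ] ∃[ j ] ∃[ l ] Product.uncurry (Skew n H g d A q j l) xy
      R₂ : ℕ → ℕ → V × V → Set
      R₂ g d xy = ∃[ A ] R₃ g d A xy
      R₁ : ℕ → V × V → Set
      R₁ g xy = ∃[ d ] R₂ g d xy
      div : ∀ c → length (divisors n) ℕ.* c ℕ.≤ t ℕ.* c
      div c = ℕ.*-monoˡ-≤ c (τ≤t n (ℕ.m≤m*n n n))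
      g∣n : ∀ {g d A q j l x y} → Skew n H g d A q j l x y → g ℕ.∣ n
      g∣n {g} {d} {A} S = subst (g ℕ.∣_) (sym (Skew.n≡ S)) (ℕ.m∣m*n (g ℕ.* (A ℕ.* d)))
      Ad∣n : ∀ {g d A q j l x y} → Skew n H g d A q j l x y → A ℕ.* d ℕ.∣ n
      Ad∣n {g} {d} {A} S = subst (A ℕ.* d ℕ.∣_) (sym (Skew.n≡ S)) (ℕ.∣n⇒∣m*n g (ℕ.n∣m*n g {A ℕ.* d}))
      d∣n : ∀ {g d A q j l x y} → Skew n H g d A q j l x y → d ℕ.∣ n
      d∣n {A = A} S = ℕ.∣-trans (ℕ.n∣m*n A) (Ad∣n S)
      A∣n : ∀ {g d A q j l x y} → Skew n H g d A q j l x y → A ℕ.∣ n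
      A∣n {d = d} S = ℕ.∣-trans (ℕ.m∣m*n d) (Ad∣n S)
      fixed : ∀ g d A → AtMost (R₃ g d A) (H ℕ.* b)
      -- A witness supplies d ≠ 0 and A d ≤ n.
      fixed g d A = atMost-witness λ _ (_ , _ , _ , S₀) → go {{Skew.d≢0 S₀}} (ℕ.∣⇒≤ (Ad∣n S₀))
        where
        go : {{_ : NonZero d}} → A ℕ.* d ℕ.≤ n → AtMost (R₃ g d A) (H ℕ.* b)
        go Ad≤n = atMost-mono
          (λ (q , j , l , skew a x≡ _ _ dq≤H j<d l≢0 cop S) →
            q , Mem.∈-upTo⁺ (subst (ℕ._≤ H ℕ./ d) (ℕ.m*n/n≡m (suc q) d) (ℕ./-monoˡ-≤ d dq≤H)) , j , Mem.∈-upTo⁺ j<d , (a , _) , (l , l≢0 , cop , S) , cong (_, _) x≡)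
          (begin
            length (upTo (H ℕ./ d)) ℕ.* (length (upTo d) ℕ.* b)  ≡⟨ cong₂ (λ u v → u ℕ.* (v ℕ.* b)) (List.length-upTo (H ℕ./ d)) (List.length-upTo d) ⟩
            H ℕ./ d ℕ.* (d ℕ.* b)                                ≡⟨ sym (ℕ.*-assoc (H ℕ./ d) d b) ⟩
            H ℕ./ d ℕ.* d ℕ.* b                                  ≤⟨ ℕ.*-monoˡ-≤ b (ℕ.m/n*n≤m H d) ⟩
            H ℕ.* b                                              ∎)
          (atMost-⋃ (upTo (H ℕ./ d)) λ {q} _ → atMost-⋃ (upTo d) λ {j} _ →
            atMost-image (λ (a , y) → + g • a , y) (atMost-slices A d j (+ (g ℕ.* (A ℕ.* d)) - + (suc q ℕ.* d)) Ad≤n))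
          where open ℕ.≤-Reasoning

    atMost-close : ∀ r H → n ℕ.< suc r ℕ.* suc r →
      let b = t ℕ.* (t ℕ.* κ); sphere = (suc r ℕ.+ r) ℕ.* (1 ℕ.+ b) in
      AtMost (Product.uncurry (Close n H)) ((sphere ℕ.+ sphere) ℕ.+ t ℕ.* (t ℕ.* (t ℕ.* (H ℕ.* b))))
    atMost-close r H n<r² = atMost-mono cases ℕ.≤-refl (atMost-∪
      (atMost-∪ (atMost-image {Q = λ x → x ∙ x ≡ + n} (λ x → x , x) (atMost-sphere r n<r²)) (atMost-image {Q = λ x → x ∙ x ≡ + n} (λ x → x , -1ℤ • x) (atMost-sphere r n<r²)))
      (atMost-skew H))
      where
      OnLine : V × V → Set
      OnLine xy = (∃[ x ] x ∙ x ≡ + n × xy ≡ (x , x)) ⊎ (∃[ x ] x ∙ x ≡ + n × xy ≡ (x , -1ℤ • x))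
      cases : ∀ {xy} → Product.uncurry (Close n H) xy →
              OnLine xy ⊎ ∃[ g ] ∃[ d ] ∃[ A ] ∃[ q ] ∃[ j ] ∃[ l ] Product.uncurry (Skew n H g d A q j l) xy
      cases {x , y} c with norm (x ⨯ y) in eq
      ... | zero  = inj₁ (Sum.map (λ y≡ → x , Close.x∙x≡n c , cong (x ,_) y≡) (λ y≡ → x , Close.x∙x≡n c , cong (x ,_) y≡) (parallel c eq))
      ... | suc _ = inj₂ (toSkew c (subst NonZero (sym eq) _))

open LatticePairs
open V

-- Growth of the bounds

-- The greatest t with t ^ k ≤ c N serves all m ≤ N at once, since τ(m) ^ k is at most c m.
uniformDivisorBound : ∀ k .{{_ : NonZero k}} → ∃[ c ] NonZero c × ∀ N .{{_ : NonZero N}} → ∃[ t ] NonZero t ×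
  (∀ m .{{_ : NonZero m}} → m ℕ.≤ N → length (divisors m) ℕ.≤ t) × t ℕ.^ k ℕ.≤ c ℕ.* N
uniformDivisorBound k = let (c , bound) = divisorBound k in suc c , _ , λ N → uniform c bound N
  where
  uniform : ∀ c → (∀ n .{{_ : NonZero n}} → ∃[ t ] AtMost (ℕ._∣ n) t × t ℕ.^ k ℕ.≤ c ℕ.* n) →
            ∀ N .{{_ : NonZero N}} → ∃[ t ] NonZero t × (∀ m .{{_ : NonZero m}} → m ℕ.≤ N → length (divisors m) ℕ.≤ t) × t ℕ.^ k ℕ.≤ suc c ℕ.* N
  -- τ(1) = 1 shows that t is nonzero.
  uniform c bound N = t , ℕ.>-nonZero (≤t 1 (ℕ.>-nonZero⁻¹ N)) , ≤t ,
      Sum.[ (λ p → p) , (λ t≡0 → subst P (sym t≡0) (0^k≤ k)) ]′ (greatest-sat {P = P} P? X)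
    where
    X = suc c ℕ.* N
    P : ℕ → Set
    P t = t ℕ.^ k ℕ.≤ X
    P? : Decidable P
    P? t = t ℕ.^ k ℕ.≤? X
    t = greatest P? X
    0^k≤ : ∀ k .{{_ : NonZero k}} → 0 ℕ.^ k ℕ.≤ X
    0^k≤ (suc k) = ℕ.z≤n
    beyond : ∀ m → X ℕ.< m → ¬ P m
    beyond m X<m = ℕ.<⇒≱ (ℕ.<-≤-trans X<m (m≤m^k m))
      where
      m≤m^k : ∀ m → m ℕ.≤ m ℕ.^ k
      m≤m^k zero    = ℕ.z≤n
      m≤m^k (suc m) = subst (ℕ._≤ suc m ℕ.^ k) (ℕ.^-identityʳ (suc m)) (ℕ.^-monoʳ-≤ (suc m) (ℕ.>-nonZero⁻¹ k))
    ≤t : ∀ m .{{_ : NonZero m}} → m ℕ.≤ N → length (divisors m) ℕ.≤ t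
    ≤t m m≤N = let (tₘ , atMost , tₘ^k≤) = bound m in
      ℕ.≤-trans (length-divisors atMost) (ℕ.≮⇒≥ λ t<tₘ → greatest-max {P = P} P? X beyond tₘ t<tₘ
        (ℕ.≤-trans tₘ^k≤ (ℕ.*-mono-≤ (ℕ.n≤1+n c) m≤N)))

sqrtℕ : ∀ n .{{_ : NonZero n}} → ∃[ r ] NonZero r × r ℕ.* r ℕ.≤ n × n ℕ.< suc r ℕ.* suc r
sqrtℕ n = r , ℕ.>-nonZero (ℕ.≮⇒≥ λ r<1 → greatest-max {P = P} P? n beyond 1 r<1 (ℕ.>-nonZero⁻¹ n)) ,
    Sum.[ (λ p → p) , (λ r≡0 → subst P (sym r≡0) ℕ.z≤n) ]′ (greatest-sat {P = P} P? n) ,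
    ℕ.≰⇒> (greatest-max {P = P} P? n beyond (suc r) ℕ.≤-refl)
  where
  P : ℕ → Set
  P r = r ℕ.* r ℕ.≤ n
  P? : Decidable P
  P? r = r ℕ.* r ℕ.≤? n
  r = greatest P? n
  beyond : ∀ m → n ℕ.< m → ¬ P m
  beyond m@(suc _) n<m = ℕ.<⇒≱ (ℕ.<-≤-trans n<m (ℕ.m≤m*n m m))

-- Of the five factors t, three are for g, d and A, one for l and one for the divisor e of the Gram
-- determinant. The 6 comes from the two copies of the sphere, each with 2 r + 1 ≤ 3 r circles.
closeBound : ∀ h r t .{{_ : NonZero r}} .{{_ : NonZero t}} {H} → H ℕ.≤ h ℕ.* r →
  let b = t ℕ.* (t ℕ.* κ); sphere = (suc r ℕ.+ r) ℕ.* (1 ℕ.+ b) in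
  (sphere ℕ.+ sphere) ℕ.+ t ℕ.* (t ℕ.* (t ℕ.* (H ℕ.* b))) ℕ.≤ (6 ℕ.* (1 ℕ.+ κ) ℕ.+ h ℕ.* κ) ℕ.* r ℕ.* t ℕ.^ 5
closeBound h r t {H} H≤hr = begin
  (sphere ℕ.+ sphere) ℕ.+ t ℕ.* (t ℕ.* (t ℕ.* (H ℕ.* b)))
    ≤⟨ ℕ.+-mono-≤ (ℕ.+-mono-≤ sphere≤ sphere≤) (ℕ.*-monoʳ-≤ t (ℕ.*-monoʳ-≤ t (ℕ.*-monoʳ-≤ t (ℕ.*-monoˡ-≤ b H≤hr)))) ⟩
  (3 ℕ.* r ℕ.* (T ℕ.* (1 ℕ.+ κ)) ℕ.+ 3 ℕ.* r ℕ.* (T ℕ.* (1 ℕ.+ κ))) ℕ.+ t ℕ.* (t ℕ.* (t ℕ.* (h ℕ.* r ℕ.* b)))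
    ≡⟨ collect h r t κ ⟩
  (6 ℕ.* (1 ℕ.+ κ) ℕ.+ h ℕ.* κ) ℕ.* r ℕ.* t ℕ.^ 5 ∎
  where
  open ℕ.≤-Reasoning
  b = t ℕ.* (t ℕ.* κ)
  T = t ℕ.* (t ℕ.* (t ℕ.* (t ℕ.* (t ℕ.* 1))))
  sphere = (suc r ℕ.+ r) ℕ.* (1 ℕ.+ b)
  collect : ∀ h r t κ → let T = t ℕ.* (t ℕ.* (t ℕ.* (t ℕ.* (t ℕ.* 1)))) in
    (3 ℕ.* r ℕ.* (T ℕ.* (1 ℕ.+ κ)) ℕ.+ 3 ℕ.* r ℕ.* (T ℕ.* (1 ℕ.+ κ))) ℕ.+ t ℕ.* (t ℕ.* (t ℕ.* (h ℕ.* r ℕ.* (t ℕ.* (t ℕ.* κ))))) ≡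
    (6 ℕ.* (1 ℕ.+ κ) ℕ.+ h ℕ.* κ) ℕ.* r ℕ.* T
  collect = ℕSolver.solve-∀
  2r+1≤3r : suc r ℕ.+ r ℕ.≤ 3 ℕ.* r
  2r+1≤3r = subst (suc r ℕ.+ r ℕ.≤_) (three r) (ℕ.+-monoˡ-≤ r (ℕ.+-monoˡ-≤ r (ℕ.>-nonZero⁻¹ r)))
    where
    three : ∀ r → r ℕ.+ r ℕ.+ r ≡ 3 ℕ.* r
    three = ℕSolver.solve-∀
  1≤T : 1 ℕ.≤ T
  1≤T = ℕ.m^n>0 t 5
  b≤Tκ : b ℕ.≤ T ℕ.* κ
  b≤Tκ = subst₂ ℕ._≤_ (lem₁ t κ) (lem₂ t κ) (ℕ.*-monoˡ-≤ κ (ℕ.*-monoʳ-≤ (t ℕ.* t) (ℕ.m^n>0 t 3)))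
    where
    lem₁ : ∀ t κ → t ℕ.* t ℕ.* 1 ℕ.* κ ≡ t ℕ.* (t ℕ.* κ)
    lem₁ = ℕSolver.solve-∀
    lem₂ : ∀ t κ → t ℕ.* t ℕ.* (t ℕ.* (t ℕ.* (t ℕ.* 1))) ℕ.* κ ≡ t ℕ.* (t ℕ.* (t ℕ.* (t ℕ.* (t ℕ.* 1)))) ℕ.* κ
    lem₂ = ℕSolver.solve-∀
  sphere≤ : sphere ℕ.≤ 3 ℕ.* r ℕ.* (T ℕ.* (1 ℕ.+ κ))
  sphere≤ = ℕ.*-mono-≤ 2r+1≤3r (subst (1 ℕ.+ b ℕ.≤_) (lem T κ) (ℕ.+-mono-≤ 1≤T b≤Tκ))
    where
    lem : ∀ T κ → T ℕ.+ T ℕ.* κ ≡ T ℕ.* (1 ℕ.+ κ)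
    lem = ℕSolver.solve-∀

-- With k = 10 s this bounds a quantity of size r t ^ 5, r ≤ √ n, t ≤ (c n²) ^ (1 / k), by n ^ (1/2 + 1/s).
powerBound : ∀ {a c n r t S} s .{{_ : NonZero s}} .{{_ : NonZero c}} → r ℕ.* r ℕ.≤ n → t ℕ.^ (10 ℕ.* s) ℕ.≤ c ℕ.* (n ℕ.* n) →
  S ℕ.≤ a ℕ.* r ℕ.* t ℕ.^ 5 → S ℕ.^ (s ℕ.* 2) ℕ.≤ (a ℕ.* c) ℕ.^ (s ℕ.* 2) ℕ.* n ℕ.^ (s ℕ.+ 2)
powerBound {a} {c} {n} {r} {t} {S} s r²≤n t^k≤ S≤ = begin
  S ℕ.^ (s ℕ.* 2)                                                 ≤⟨ ℕ.^-monoˡ-≤ (s ℕ.* 2) S≤ ⟩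
  (a ℕ.* r ℕ.* t ℕ.^ 5) ℕ.^ (s ℕ.* 2)                             ≡⟨ trans (*-^ (a ℕ.* r) (t ℕ.^ 5) e) (cong (ℕ._* (t ℕ.^ 5) ℕ.^ e) (*-^ a r e)) ⟩
  a ℕ.^ e ℕ.* r ℕ.^ e ℕ.* (t ℕ.^ 5) ℕ.^ e                         ≤⟨ ℕ.*-mono-≤ (ℕ.*-monoʳ-≤ (a ℕ.^ e) r^e≤) t^≤ ⟩
  a ℕ.^ e ℕ.* n ℕ.^ s ℕ.* (c ℕ.* (n ℕ.* n))                       ≤⟨ ℕ.*-monoʳ-≤ (a ℕ.^ e ℕ.* n ℕ.^ s) (ℕ.*-monoˡ-≤ (n ℕ.* n) c≤c^e) ⟩
  a ℕ.^ e ℕ.* n ℕ.^ s ℕ.* (c ℕ.^ e ℕ.* (n ℕ.* n))                 ≡⟨ collect (a ℕ.^ e) (n ℕ.^ s) (c ℕ.^ e) n ⟩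
  a ℕ.^ e ℕ.* c ℕ.^ e ℕ.* (n ℕ.^ s ℕ.* (n ℕ.* (n ℕ.* 1)))         ≡⟨ sym (cong₂ ℕ._*_ (*-^ a c e) (ℕ.^-distribˡ-+-* n s 2)) ⟩
  (a ℕ.* c) ℕ.^ e ℕ.* n ℕ.^ (s ℕ.+ 2)                             ∎
  where
  open ℕ.≤-Reasoning
  e = s ℕ.* 2
  collect : ∀ a n c m → a ℕ.* n ℕ.* (c ℕ.* (m ℕ.* m)) ≡ a ℕ.* c ℕ.* (n ℕ.* (m ℕ.* (m ℕ.* 1)))
  collect = ℕSolver.solve-∀
  r^e≤ : r ℕ.^ e ℕ.≤ n ℕ.^ s
  r^e≤ = subst (ℕ._≤ n ℕ.^ s) (trans (cong (ℕ._^ s) (cong (r ℕ.*_) (sym (ℕ.*-identityʳ r)))) (trans (ℕ.^-*-assoc r 2 s) (cong (r ℕ.^_) (ℕ.*-comm 2 s)))) (ℕ.^-monoˡ-≤ s r²≤n)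
  t^≤ : (t ℕ.^ 5) ℕ.^ e ℕ.≤ c ℕ.* (n ℕ.* n)
  t^≤ = subst (ℕ._≤ c ℕ.* (n ℕ.* n)) (trans (cong (t ℕ.^_) (ten s)) (sym (ℕ.^-*-assoc t 5 e))) t^k≤
    where
    ten : ∀ s → 10 ℕ.* s ≡ 5 ℕ.* (s ℕ.* 2)
    ten = ℕSolver.solve-∀
  c≤c^e : c ℕ.≤ c ℕ.^ e
  c≤c^e = subst (ℕ._≤ c ℕ.^ e) (ℕ.^-identityʳ c) (ℕ.^-monoʳ-≤ c (ℕ.≤-trans (ℕ.>-nonZero⁻¹ s) (ℕ.m≤m*n s 2)))

-- The sum counts ordered pairs in a common piece. Lists of pairs for inequivalent indices have
-- disjoint first components, so their concatenation is duplicate-free and `AtMost` applies.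
sumSquares≤ : ∀ {ℓ₁ ℓ₂ ℓ₃ ℓ₄ b} {X : Set ℓ₁} {P : Pred (X × X) ℓ₂} (J : Setoid ℓ₃ ℓ₄) → let module J = Setoid J in
  (xs : J.Carrier → List X) → (∀ i → Uniqueˡ (xs i)) → (∀ {i j x} → x ∈ˡ xs i → x ∈ˡ xs j → i J.≈ j) →
  (∀ {i x y} → x ∈ˡ xs i → y ∈ˡ xs i → P (x , y)) → AtMost P b →
  ∀ is → Unique J is → sum (map (λ i → length (xs i) ℕ.^ 2) is) ℕ.≤ b
sumSquares≤ {X = X} {P} J xs uniq disj related atMost is u =
  subst (ℕ._≤ _) (length-pairs is) (atMost (pairs is) (unique is u) (All.tabulate λ ∈pairs → let (_ , _ , x∈ , y∈) = member is ∈pairs in related x∈ y∈))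
  where
  module J = Setoid J
  square : J.Carrier → List (X × X)
  square i = List.cartesianProduct (xs i) (xs i)
  length-product : ∀ us {vs : List X} → length (List.cartesianProduct us vs) ≡ length us ℕ.* length vs
  length-product []            = refl
  length-product (u ∷ us) {vs} = trans (List.length-++ (map (u ,_) vs)) (cong₂ ℕ._+_ (List.length-map (u ,_) vs) (length-product us))
  pairs : List J.Carrier → List (X × X)
  pairs []       = []
  pairs (i ∷ is) = square i List.++ pairs is
  length-pairs : ∀ is → length (pairs is) ≡ sum (map (λ i → length (xs i) ℕ.^ 2) is)
  length-pairs []       = refl
  length-pairs (i ∷ is) = trans (List.length-++ (square i)) (cong₂ ℕ._+_
    (trans (length-product (xs i)) (cong (length (xs i) ℕ.*_) (sym (ℕ.*-identityʳ (length (xs i)))))) (length-pairs is))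
  member : ∀ is {p} → p ∈ˡ pairs is → ∃[ j ] j ∈ˡ is × proj₁ p ∈ˡ xs j × proj₂ p ∈ˡ xs j
  member (i ∷ is) p∈ with Mem.∈-++⁻ (square i) p∈
  ... | inj₁ ∈square = let (x∈ , y∈) = Mem.∈-cartesianProduct⁻ (xs i) (xs i) ∈square in i , here refl , x∈ , y∈
  ... | inj₂ ∈rest   = let (j , j∈ , h) = member is ∈rest in j , there j∈ , h
  unique : ∀ is → Unique J is → Uniqueˡ (pairs is)
  unique []       _          = []
  unique (i ∷ is) (i∉ ∷ u) = Uniqueₚ.++⁺ (Uniqueₚ.cartesianProduct⁺ (uniq i) (uniq i)) (unique is u)
    λ (∈square , ∈rest) → let (x∈ , _) = Mem.∈-cartesianProduct⁻ (xs i) (xs i) ∈square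
                              (j , j∈ , x∈′ , _) = member is ∈rest
                          in All.lookup i∉ j∈ (disj x∈ x∈′)

-- Passage from natural to real numbers

open import Defs
open Aux using (evBound; p≤∣p∣)
open RootAux

-- Rational arithmetic

ι : ℤ → ℚ
ι i = i ℚ./ 1

private
  ι-≃ : ∀ i → toℚᵘ (ι i) ℚᵘ.≃ mkℚᵘ i 0
  ι-≃ i = ℚ.toℚᵘ-fromℚᵘ (mkℚᵘ i 0)

  ℚᵘ-≡ : ∀ {i j d} → i ≡ j → mkℚᵘ i d ℚᵘ.≃ mkℚᵘ j d
  ℚᵘ-≡ refl = ℚᵘ.≃-refl

ι-+ : ∀ i j → ι i ℚ.+ ι j ≡ ι (i ℤ.+ j)
ι-+ i j = ℚ.toℚᵘ-injective (ℚᵘ.≃-trans (ℚ.toℚᵘ-homo-+ (ι i) (ι j)) (ℚᵘ.≃-trans (ℚᵘ.+-cong (ι-≃ i) (ι-≃ j))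
  (ℚᵘ.≃-trans (ℚᵘ-≡ (cong₂ ℤ._+_ (ℤ.*-identityʳ i) (ℤ.*-identityʳ j))) (ℚᵘ.≃-sym (ι-≃ (i ℤ.+ j))))))

ι-* : ∀ i j → ι i ℚ.* ι j ≡ ι (i ℤ.* j)
ι-* i j = ℚ.toℚᵘ-injective (ℚᵘ.≃-trans (ℚ.toℚᵘ-homo-* (ι i) (ι j)) (ℚᵘ.≃-trans (ℚᵘ.*-cong (ι-≃ i) (ι-≃ j)) (ℚᵘ.≃-sym (ι-≃ (i ℤ.* j)))))

ι-neg : ∀ i → ℚ.- ι i ≡ ι (ℤ.- i)
ι-neg i = ℚ.toℚᵘ-injective (ℚᵘ.≃-trans (ℚ.toℚᵘ-homo‿- (ι i)) (ℚᵘ.≃-trans (ℚᵘ.-‿cong (ι-≃ i)) (ℚᵘ.≃-sym (ι-≃ (ℤ.- i)))))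

frac-cancel : ∀ {m k m′ k′} → frac m k ℚ.≤ frac m′ k′ → m ℕ.* suc k′ ℕ.≤ m′ ℕ.* suc k
frac-cancel {m} {k} {m′} {k′} h with ℚᵘ.≤-respˡ-≃ (frac-≃ m k) (ℚᵘ.≤-respʳ-≃ (frac-≃ m′ k′) (ℚ.toℚᵘ-mono-≤ h))
... | ℚᵘ.*≤* r = ℤ.drop‿+≤+ (subst₂ ℤ._≤_ (sym (ℤ.pos-* m (suc k′))) (sym (ℤ.pos-* m′ (suc k))) r)

frac-* : ∀ a k b l → frac a k ℚ.* frac b l ≡ frac (a ℕ.* b) (l ℕ.+ k ℕ.* suc l)
frac-* a k b l = ℚ.toℚᵘ-injective (ℚᵘ.≃-trans (ℚ.toℚᵘ-homo-* (frac a k) (frac b l)) (ℚᵘ.≃-trans (ℚᵘ.*-cong (frac-≃ a k) (frac-≃ b l))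
  (ℚᵘ.≃-trans (ℚᵘ-≡ (sym (ℤ.pos-* a b))) (ℚᵘ.≃-sym (frac-≃ (a ℕ.* b) (l ℕ.+ k ℕ.* suc l))))))

frac-≡ : ∀ {m k m′ k′} → m ℕ.* suc k′ ≡ m′ ℕ.* suc k → frac m k ≡ frac m′ k′
frac-≡ {m} {k} {m′} {k′} eq = ℚ.≤-antisym (frac-mono {m} {k} {m′} {k′} (ℕ.≤-reflexive eq)) (frac-mono {m′} {k′} {m} {k} (ℕ.≤-reflexive (sym eq)))

frac-scale : ∀ a b k → frac a 0 ℚ.* frac b k ≡ frac (a ℕ.* b) k
frac-scale a b k = trans (frac-* a 0 b k) (cong (frac (a ℕ.* b)) (ℕ.+-identityʳ k))

frac-+ : ∀ a b k → frac a k ℚ.+ frac b k ≡ frac (a ℕ.+ b) k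
frac-+ a b k = begin
  frac a k ℚ.+ frac b k                                ≡⟨ sym (cong₂ ℚ._+_ (unit a) (unit b)) ⟩
  frac a 0 ℚ.* frac 1 k ℚ.+ frac b 0 ℚ.* frac 1 k      ≡⟨ sym (ℚ.*-distribʳ-+ (frac 1 k) (frac a 0) (frac b 0)) ⟩
  (frac a 0 ℚ.+ frac b 0) ℚ.* frac 1 k                 ≡⟨ cong (ℚ._* frac 1 k) (ι-+ (+ a) (+ b)) ⟩
  frac (a ℕ.+ b) 0 ℚ.* frac 1 k                        ≡⟨ unit (a ℕ.+ b) ⟩
  frac (a ℕ.+ b) k                                     ∎
  where
  open ≡-Reasoning
  unit : ∀ c → frac c 0 ℚ.* frac 1 k ≡ frac c k
  unit c = trans (frac-scale c 1 k) (cong (λ m → frac m k) (ℕ.*-identityʳ c))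

-- Lower bounds for n ^ x

-- With s = d + 1 the hypothesis is (s + 2) / (2 s) ≤ (a⁺ - a⁻) / b; this is cross-multiplied and
-- the negative part is moved to the left.
exponent≤ : ∀ d q → ½ ℚ.+ frac 1 d ℚ.≤ q →
            (suc d ℕ.+ 2) ℕ.* ↧ₙ q ℕ.+ (↥ q) ⁻ ℕ.* (suc d ℕ.* 2) ℕ.≤ (↥ q) ⁺ ℕ.* (suc d ℕ.* 2)
exponent≤ d (mkℚ a b _) h with ℚᵘ.≤-respˡ-≃ (ℚᵘ.≃-trans (ℚ.toℚᵘ-homo-+ ½ (frac 1 d)) (ℚᵘ.+-congʳ (toℚᵘ ½) (frac-≃ 1 d))) (ℚ.toℚᵘ-mono-≤ h)
... | ℚᵘ.*≤* r = go a r
  where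
  s = suc d
  go : ∀ a → (+ 1 ℤ.* + s ℤ.+ + 1 ℤ.* + 2) ℤ.* + suc b ℤ.≤ a ℤ.* + (2 ℕ.* s) →
       (s ℕ.+ 2) ℕ.* suc b ℕ.+ a ⁻ ℕ.* (s ℕ.* 2) ℕ.≤ a ⁺ ℕ.* (s ℕ.* 2)
  go (+ a) r = subst₂ ℕ._≤_ (sym (ℕ.+-identityʳ ((s ℕ.+ 2) ℕ.* suc b))) (cong (a ℕ.*_) (ℕ.*-comm 2 s)) (ℤ.drop‿+≤+ (subst₂ ℤ._≤_
    (trans (cong (λ z → (z ℤ.+ + 2) ℤ.* + suc b) (ℤ.*-identityˡ (+ s))) (sym (ℤ.pos-* (s ℕ.+ 2) (suc b)))) (sym (ℤ.pos-* a (2 ℕ.* s))) r))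
  go -[1+ a ] ()

-- The hypothesis on S reads S ≤ K n^(1/2 + 1/s) with s = d + 1. Since (v + 1) / (k + 1) bounds n^q
-- from above, the claim follows after raising to the power 2 s b, with b the denominator of q, and
-- clearing n^(-a⁻).
^-lower : ∀ n .{{_ : NonZero n}} d q k {S K} → ½ ℚ.+ frac 1 d ℚ.≤ q →
          S ℕ.^ (suc d ℕ.* 2) ℕ.≤ K ℕ.^ (suc d ℕ.* 2) ℕ.* n ℕ.^ (suc d ℕ.+ 2) → S ℕ.* suc k ℕ.≤ K ℕ.* suc (^-num n q k)
^-lower n d q@(mkℚ _ _ _) k {S} {K} q≥ S≤ = ^-cancelˡ-≤ (Q ℕ.* b) (ℕ.*-cancelʳ-≤ _ _ (n ℕ.^ (a⁻ ℕ.* Q)) {{ℕ.m^n≢0 n (a⁻ ℕ.* Q)}} (begin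
  (S ℕ.* suc k) ℕ.^ (Q ℕ.* b) ℕ.* n ℕ.^ (a⁻ ℕ.* Q)                                ≡⟨ cong (ℕ._* N⁻) (*-^ S (suc k) (Q ℕ.* b)) ⟩
  S ℕ.^ (Q ℕ.* b) ℕ.* suc k ℕ.^ (Q ℕ.* b) ℕ.* N⁻                                  ≡⟨ cong (λ z → z ℕ.* suc k ℕ.^ (Q ℕ.* b) ℕ.* N⁻) (sym (ℕ.^-*-assoc S Q b)) ⟩
  (S ℕ.^ Q) ℕ.^ b ℕ.* suc k ℕ.^ (Q ℕ.* b) ℕ.* N⁻                                  ≤⟨ ℕ.*-monoˡ-≤ N⁻ (ℕ.*-monoˡ-≤ (suc k ℕ.^ (Q ℕ.* b)) (ℕ.^-monoˡ-≤ b S≤)) ⟩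
  (K ℕ.^ Q ℕ.* n ℕ.^ P) ℕ.^ b ℕ.* suc k ℕ.^ (Q ℕ.* b) ℕ.* N⁻                      ≡⟨ cong (λ z → z ℕ.* suc k ℕ.^ (Q ℕ.* b) ℕ.* N⁻) (trans (*-^ (K ℕ.^ Q) (n ℕ.^ P) b) (cong₂ ℕ._*_ (ℕ.^-*-assoc K Q b) (ℕ.^-*-assoc n P b))) ⟩
  K ℕ.^ (Q ℕ.* b) ℕ.* n ℕ.^ (P ℕ.* b) ℕ.* suc k ℕ.^ (Q ℕ.* b) ℕ.* N⁻              ≡⟨ shuffle₁ (K ℕ.^ (Q ℕ.* b)) (n ℕ.^ (P ℕ.* b)) (suc k ℕ.^ (Q ℕ.* b)) N⁻ ⟩
  K ℕ.^ (Q ℕ.* b) ℕ.* (suc k ℕ.^ (Q ℕ.* b) ℕ.* (n ℕ.^ (P ℕ.* b) ℕ.* N⁻))          ≤⟨ ℕ.*-monoʳ-≤ (K ℕ.^ (Q ℕ.* b)) (ℕ.*-monoʳ-≤ (suc k ℕ.^ (Q ℕ.* b)) n-power) ⟩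
  K ℕ.^ (Q ℕ.* b) ℕ.* (suc k ℕ.^ (Q ℕ.* b) ℕ.* n ℕ.^ (a⁺ ℕ.* Q))                  ≤⟨ ℕ.*-monoʳ-≤ (K ℕ.^ (Q ℕ.* b)) root ⟩
  K ℕ.^ (Q ℕ.* b) ℕ.* (suc v ℕ.^ (Q ℕ.* b) ℕ.* N⁻)                                ≡⟨ trans (sym (ℕ.*-assoc (K ℕ.^ (Q ℕ.* b)) _ N⁻)) (cong (ℕ._* N⁻) (sym (*-^ K (suc v) (Q ℕ.* b)))) ⟩
  (K ℕ.* suc v) ℕ.^ (Q ℕ.* b) ℕ.* N⁻                                              ∎))
  where
  open ℕ.≤-Reasoning
  P = suc d ℕ.+ 2
  Q = suc d ℕ.* 2
  b = ↧ₙ q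
  a⁺ = (↥ q) ⁺
  a⁻ = (↥ q) ⁻
  v = ^-num n q k
  N⁻ = n ℕ.^ (a⁻ ℕ.* Q)
  shuffle₁ : ∀ x y z w → x ℕ.* y ℕ.* z ℕ.* w ≡ x ℕ.* (z ℕ.* (y ℕ.* w))
  shuffle₁ = ℕSolver.solve-∀
  n-power : n ℕ.^ (P ℕ.* b) ℕ.* N⁻ ℕ.≤ n ℕ.^ (a⁺ ℕ.* Q)
  n-power = subst (ℕ._≤ n ℕ.^ (a⁺ ℕ.* Q)) (ℕ.^-distribˡ-+-* n (P ℕ.* b) (a⁻ ℕ.* Q)) (ℕ.^-monoʳ-≤ n (exponent≤ d q q≥))
  push : ∀ x y → (x ℕ.^ b ℕ.* n ℕ.^ y) ℕ.^ Q ≡ x ℕ.^ (Q ℕ.* b) ℕ.* n ℕ.^ (y ℕ.* Q)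
  push x y = trans (*-^ (x ℕ.^ b) (n ℕ.^ y) Q) (cong₂ ℕ._*_ (trans (ℕ.^-*-assoc x b Q) (cong (x ℕ.^_) (ℕ.*-comm b Q))) (ℕ.^-*-assoc n y Q))
  root : suc k ℕ.^ (Q ℕ.* b) ℕ.* n ℕ.^ (a⁺ ℕ.* Q) ℕ.≤ suc v ℕ.^ (Q ℕ.* b) ℕ.* N⁻
  root = subst₂ ℕ._≤_ (push (suc k) a⁺) (push (suc v) a⁻)
    (ℕ.^-monoˡ-≤ Q (subst (ℕ._≤ suc v ℕ.^ b ℕ.* n ℕ.^ a⁻) (ℕ.*-comm (n ℕ.^ a⁺) (suc k ℕ.^ b)) (^-hi n q k)))

-- `^-lower` has v + 1 where the sequence has v. The excess K / (k + 1) is at most δ once k ≥ K (e +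
-- 1) with 1 / (e + 1) ≤ δ.
fromℕ≤ : ∀ n .{{_ : NonZero n}} d (ε : ℝ) {S K} → (∃[ N ] ∀ k → N ℕ.≤ k → frac 1 d ℚ.≤ seq ε k) →
         S ℕ.^ (suc d ℕ.* 2) ℕ.≤ K ℕ.^ (suc d ℕ.* 2) ℕ.* n ℕ.^ (suc d ℕ.+ 2) → fromℕ S ≤ fromℕ K * n ^ (fromℚ ½ + ε)
fromℕ≤ n d ε {S} {K} (N , ε≥) S≤ δ δ>0 = let (e , 1/e≤δ) = unit≤ δ δ>0 in
  N ℕ.⊔ (K ℕ.* suc e) , λ k k≥ →
    let q = ½ ℚ.+ seq ε k
        v = ^-num n q k
        k≥N = ℕ.m⊔n≤o⇒m≤o N (K ℕ.* suc e) k≥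
        k≥Ke = ℕ.m⊔n≤o⇒n≤o N (K ℕ.* suc e) k≥
        low = ^-lower n d q k {S} {K} (ℚ.+-monoʳ-≤ ½ (ε≥ k k≥N)) S≤
    in ℚ.≤-trans
      (subst (frac S 0 ℚ.≤_) (trans (cong (λ m → frac m k) (trans (ℕ.*-suc K v) (ℕ.+-comm K (K ℕ.* v))))
                               (trans (sym (frac-+ (K ℕ.* v) K k)) (cong (ℚ._+ frac K k) (sym (frac-scale K v k)))))
        (frac-mono {S} {0} {K ℕ.* suc v} {k} (subst (S ℕ.* suc k ℕ.≤_) (sym (ℕ.*-identityʳ (K ℕ.* suc v))) low)))
      (ℚ.+-monoʳ-≤ (frac K 0 ℚ.* frac v k) (ℚ.≤-trans
        (frac-mono {K} {k} {1} {e} (subst (K ℕ.* suc e ℕ.≤_) (sym (ℕ.*-identityˡ (suc k))) (ℕ.m≤n⇒m≤1+n k≥Ke))) 1/e≤δ))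

-- Distances between lattice points

toV : ℤ³ → V
toV (x ∷ y ∷ z ∷ []) = ⟨ x , y , z ⟩

fromV : V → ℤ³
fromV ⟨ x , y , z ⟩ = x ∷ y ∷ z ∷ []

fromV-toV : ∀ x → fromV (toV x) ≡ x
fromV-toV (x ∷ y ∷ z ∷ []) = refl

_⊖_ : V → V → V
v ⊖ w = ⟨ x₁ v ℤ.- x₁ w , x₂ v ℤ.- x₂ w , x₃ v ℤ.- x₃ w ⟩

norm-⊖ : ∀ v w → + norm (v ⊖ w) ≡ (v ∙ v ℤ.+ w ∙ w) ℤ.- + 2 ℤ.* (v ∙ w)
norm-⊖ v w = trans (sym (v∙v≡norm (v ⊖ w))) (raw (x₁ v) (x₂ v) (x₃ v) (x₁ w) (x₂ w) (x₃ w))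
  where
  raw : ∀ a b c d e f → (a ℤ.- d) ℤ.* (a ℤ.- d) ℤ.+ (b ℤ.- e) ℤ.* (b ℤ.- e) ℤ.+ (c ℤ.- f) ℤ.* (c ℤ.- f) ≡
    ((a ℤ.* a ℤ.+ b ℤ.* b ℤ.+ c ℤ.* c) ℤ.+ (d ℤ.* d ℤ.+ e ℤ.* e ℤ.+ f ℤ.* f)) ℤ.- + 2 ℤ.* (a ℤ.* d ℤ.+ b ℤ.* e ℤ.+ c ℤ.* f)
  raw = ℤSolver.solve-∀

private
  distSquared : ℚ → ℚ → ℚ → ℚ → ℚ → ℚ → ℚ
  distSquared p q r p′ q′ r′ = (p ℚ.+ ℚ.- p′) ℚ.* (p ℚ.+ ℚ.- p′) ℚ.+ (q ℚ.+ ℚ.- q′) ℚ.* (q ℚ.+ ℚ.- q′) ℚ.+ (r ℚ.+ ℚ.- r′) ℚ.* (r ℚ.+ ℚ.- r′)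

ι-dist² : ∀ x₁ x₂ x₃ y₁ y₂ y₃ → distSquared (ι x₁) (ι x₂) (ι x₃) (ι y₁) (ι y₂) (ι y₃) ≡ frac (norm (⟨ x₁ , x₂ , x₃ ⟩ ⊖ ⟨ y₁ , y₂ , y₃ ⟩)) 0
ι-dist² x₁ x₂ x₃ y₁ y₂ y₃ = trans (cong₂ ℚ._+_ (cong₂ ℚ._+_ (square x₁ y₁) (square x₂ y₂)) (square x₃ y₃))
  (trans (cong (ℚ._+ ι (+ sq (x₃ ℤ.- y₃))) (ι-+ (+ sq (x₁ ℤ.- y₁)) (+ sq (x₂ ℤ.- y₂))))
         (ι-+ (+ (sq (x₁ ℤ.- y₁) ℕ.+ sq (x₂ ℤ.- y₂))) (+ sq (x₃ ℤ.- y₃))))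
  where
  square : ∀ i j → (ι i ℚ.+ ℚ.- ι j) ℚ.* (ι i ℚ.+ ℚ.- ι j) ≡ ι (+ sq (i ℤ.- j))
  square i j = trans (cong (λ z → z ℚ.* z) (trans (cong (ι i ℚ.+_) (ι-neg j)) (ι-+ i (ℤ.- j))))
    (trans (ι-* (i ℤ.- j) (i ℤ.- j)) (cong ι (∣i∣² (i ℤ.- j))))

private
  -- The entries are generalised to variables tied by equations, so that the claim is definitional
  -- while the arithmetic of ℚ at integers stays folded.
  seq-dist₀ : ∀ a b c a′ b′ c′ k {p q r p′ q′ r′ s} → seq a k ≡ p → seq b k ≡ q → seq c k ≡ r → seq a′ k ≡ p′ → seq b′ k ≡ q′ → seq c′ k ≡ r′ →
    distSquared p q r p′ q′ r′ ≡ s → seq (dist (a ∷ b ∷ c ∷ []) (a′ ∷ b′ ∷ c′ ∷ [])) k ≡ frac (√-num s k) k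
  seq-dist₀ a b c a′ b′ c′ k refl refl refl refl refl refl refl = refl

  seq-fromℤ : ∀ i k → seq (fromℤ i) k ≡ ι i
  seq-fromℤ i k = refl

  seq-dist₁ : ∀ u v x y k → toℝ³ x ≡ u → toℝ³ y ≡ v → seq (dist (toℝ³ x) (toℝ³ y)) k ≡ seq (dist u v) k
  seq-dist₁ u v x y k refl refl = refl

  seq-dist₂ : ∀ x₁ x₂ x₃ y₁ y₂ y₃ k s → distSquared (ι x₁) (ι x₂) (ι x₃) (ι y₁) (ι y₂) (ι y₃) ≡ s →
    seq (dist (fromℤ x₁ ∷ fromℤ x₂ ∷ fromℤ x₃ ∷ []) (fromℤ y₁ ∷ fromℤ y₂ ∷ fromℤ y₃ ∷ [])) k ≡ frac (√-num s k) k
  seq-dist₂ x₁ x₂ x₃ y₁ y₂ y₃ k s = seq-dist₀ (fromℤ x₁) (fromℤ x₂) (fromℤ x₃) (fromℤ y₁) (fromℤ y₂) (fromℤ y₃) k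
    {ι x₁} {ι x₂} {ι x₃} {ι y₁} {ι y₂} {ι y₃} {s}
    (seq-fromℤ x₁ k) (seq-fromℤ x₂ k) (seq-fromℤ x₃ k) (seq-fromℤ y₁ k) (seq-fromℤ y₂ k) (seq-fromℤ y₃ k)

seq-dist : ∀ x y h k → norm (toV x ⊖ toV y) ≡ h → seq (dist (toℝ³ x) (toℝ³ y)) k ≡ frac (√-num (frac h 0) k) k
seq-dist x@(x₁ ∷ x₂ ∷ x₃ ∷ []) y@(y₁ ∷ y₂ ∷ y₃ ∷ []) h k eq = trans
  (seq-dist₁ (fromℤ x₁ ∷ fromℤ x₂ ∷ fromℤ x₃ ∷ []) (fromℤ y₁ ∷ fromℤ y₂ ∷ fromℤ y₃ ∷ []) x y k refl refl)
  (seq-dist₂ x₁ x₂ x₃ y₁ y₂ y₃ k (frac h 0) (trans (ι-dist² x₁ x₂ x₃ y₁ y₂ y₃) (cong (λ h → frac h 0) eq)))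

-- The size of h is read off a single term of the Cauchy sequences: h ≤ (E v / (k + 1) + 2)² with (v / (k + 1))⁴ ≤ n.
gap≤ : ∀ {n r E h v w k} .{{_ : NonZero r}} → n ℕ.< suc r ℕ.* suc r → v ℕ.^ 4 ℕ.≤ n ℕ.* suc k ℕ.^ 4 →
       w ℕ.≤ E ℕ.* v ℕ.+ 2 ℕ.* suc k → h ℕ.* (suc k ℕ.* suc k) ℕ.≤ w ℕ.* w → h ℕ.≤ (4 ℕ.* (E ℕ.* E) ℕ.+ 8) ℕ.* r
gap≤ {n} {r} {E} {h} {v} {w} {k} n<r² v⁴≤ w≤ h≤ = ℕ.*-cancelʳ-≤ h _ (κ′ ℕ.* κ′) (begin
  h ℕ.* (κ′ ℕ.* κ′)                                                     ≤⟨ h≤ ⟩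
  w ℕ.* w                                                               ≤⟨ ℕ.*-mono-≤ w≤ w≤ ⟩
  (E ℕ.* v ℕ.+ 2 ℕ.* κ′) ℕ.* (E ℕ.* v ℕ.+ 2 ℕ.* κ′)                     ≤⟨ square-sum≤ (E ℕ.* v) (2 ℕ.* κ′) ⟩
  2 ℕ.* (E ℕ.* v ℕ.* (E ℕ.* v)) ℕ.+ 2 ℕ.* (2 ℕ.* κ′ ℕ.* (2 ℕ.* κ′))     ≡⟨ collect₁ E v κ′ ⟩
  2 ℕ.* (E ℕ.* E) ℕ.* (v ℕ.* v) ℕ.+ 8 ℕ.* (κ′ ℕ.* κ′)                   ≤⟨ ℕ.+-mono-≤ (ℕ.*-monoʳ-≤ (2 ℕ.* (E ℕ.* E)) v²≤) (ℕ.*-monoʳ-≤ 8 (ℕ.m≤n*m (κ′ ℕ.* κ′) r)) ⟩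
  2 ℕ.* (E ℕ.* E) ℕ.* ((r ℕ.+ r) ℕ.* (κ′ ℕ.* κ′)) ℕ.+ 8 ℕ.* (r ℕ.* (κ′ ℕ.* κ′)) ≡⟨ collect₂ E r κ′ ⟩
  (4 ℕ.* (E ℕ.* E) ℕ.+ 8) ℕ.* r ℕ.* (κ′ ℕ.* κ′)                         ∎)
  where
  open ℕ.≤-Reasoning
  κ′ = suc k
  collect₁ : ∀ E v κ → 2 ℕ.* (E ℕ.* v ℕ.* (E ℕ.* v)) ℕ.+ 2 ℕ.* (2 ℕ.* κ ℕ.* (2 ℕ.* κ)) ≡ 2 ℕ.* (E ℕ.* E) ℕ.* (v ℕ.* v) ℕ.+ 8 ℕ.* (κ ℕ.* κ)
  collect₁ = ℕSolver.solve-∀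
  collect₂ : ∀ E r κ → 2 ℕ.* (E ℕ.* E) ℕ.* ((r ℕ.+ r) ℕ.* (κ ℕ.* κ)) ℕ.+ 8 ℕ.* (r ℕ.* (κ ℕ.* κ)) ≡ (4 ℕ.* (E ℕ.* E) ℕ.+ 8) ℕ.* r ℕ.* (κ ℕ.* κ)
  collect₂ = ℕSolver.solve-∀
  square-sum≤ : ∀ x y → (x ℕ.+ y) ℕ.* (x ℕ.+ y) ℕ.≤ 2 ℕ.* (x ℕ.* x) ℕ.+ 2 ℕ.* (y ℕ.* y)
  square-sum≤ x y = Sum.[ (λ x≤y → below x≤y) , (λ y≤x → subst₂ ℕ._≤_ (cong₂ ℕ._*_ (ℕ.+-comm y x) (ℕ.+-comm y x)) (ℕ.+-comm (2 ℕ.* (y ℕ.* y)) _) (below y≤x)) ]′ (ℕ.≤-total x y)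
    where
    below : ∀ {x y} → x ℕ.≤ y → (x ℕ.+ y) ℕ.* (x ℕ.+ y) ℕ.≤ 2 ℕ.* (x ℕ.* x) ℕ.+ 2 ℕ.* (y ℕ.* y)
    below {x} {y} x≤y = subst (λ y → (x ℕ.+ y) ℕ.* (x ℕ.+ y) ℕ.≤ 2 ℕ.* (x ℕ.* x) ℕ.+ 2 ℕ.* (y ℕ.* y)) (ℕ.m+[n∸m]≡n x≤y)
      (subst ((x ℕ.+ (x ℕ.+ z)) ℕ.* (x ℕ.+ (x ℕ.+ z)) ℕ.≤_) (raw x z) (ℕ.m≤m+n _ (z ℕ.* z)))
      where
      z = y ℕ.∸ x
      raw : ∀ x z → (x ℕ.+ (x ℕ.+ z)) ℕ.* (x ℕ.+ (x ℕ.+ z)) ℕ.+ z ℕ.* z ≡ 2 ℕ.* (x ℕ.* x) ℕ.+ 2 ℕ.* ((x ℕ.+ z) ℕ.* (x ℕ.+ z))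
      raw = ℕSolver.solve-∀
  -- v⁴ ≤ n κ′⁴ is at most the square of (r + 1) κ′², and r + 1 ≤ 2 r.
  v²≤ : v ℕ.* v ℕ.≤ (r ℕ.+ r) ℕ.* (κ′ ℕ.* κ′)
  v²≤ = ℕ.≤-trans (m*m≤n*n⇒m≤n (begin
    v ℕ.* v ℕ.* (v ℕ.* v)                                               ≡⟨ fourth v ⟩
    v ℕ.* (v ℕ.* (v ℕ.* (v ℕ.* 1)))                                     ≤⟨ v⁴≤ ⟩
    n ℕ.* κ′ ℕ.^ 4                                                      ≤⟨ ℕ.*-monoˡ-≤ (κ′ ℕ.^ 4) (ℕ.<⇒≤ n<r²) ⟩
    suc r ℕ.* suc r ℕ.* κ′ ℕ.^ 4                                        ≡⟨ regroup (suc r) κ′ ⟩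
    suc r ℕ.* (κ′ ℕ.* κ′) ℕ.* (suc r ℕ.* (κ′ ℕ.* κ′))                   ∎))
    (ℕ.*-monoˡ-≤ (κ′ ℕ.* κ′) (ℕ.+-monoˡ-≤ r (ℕ.>-nonZero⁻¹ r)))
    where
    fourth : ∀ v → v ℕ.* v ℕ.* (v ℕ.* v) ≡ v ℕ.* (v ℕ.* (v ℕ.* (v ℕ.* 1)))
    fourth = ℕSolver.solve-∀
    regroup : ∀ r κ → r ℕ.* r ℕ.* (κ ℕ.* (κ ℕ.* (κ ℕ.* (κ ℕ.* 1)))) ≡ r ℕ.* (κ ℕ.* κ) ℕ.* (r ℕ.* (κ ℕ.* κ))
    regroup = ℕSolver.solve-∀

^-quarter : ∀ n q k → ↧ₙ q ≡ 4 → ↥ q ≡ + 1 → ^-num n q k ℕ.^ 4 ℕ.≤ n ℕ.* suc k ℕ.^ 4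
^-quarter n q k den num = subst₂ ℕ._≤_
  (trans (cong₂ (λ d i → v ℕ.^ d ℕ.* n ℕ.^ (i ⁻)) den num) (ℕ.*-identityʳ (v ℕ.^ 4)))
  (trans (cong₂ (λ d i → n ℕ.^ (i ⁺) ℕ.* suc k ℕ.^ d) den num) (cong (ℕ._* suc k ℕ.^ 4) (ℕ.*-identityʳ n))) (^-lo n q k)
  where v = ^-num n q k

private
  seq-*^ : ∀ C n .{{_ : NonZero n}} q k → seq (C * n ^ fromℚ q) k ≡ seq C k ℚ.* frac (^-num n q k) k
  seq-*^ C n q k = refl

  -- u / (k + 1) and v / (k + 1) stand for √h and n^(1/4) rounded down. In the bound E v + 2 (k + 1)
  -- for u + 1, one k + 1 is the slack 1 allowed in the comparison and the other absorbs the
  -- rounding.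
  estimate : ∀ {n r} .{{_ : NonZero r}} E h k c u v → n ℕ.< suc r ℕ.* suc r → c ℚ.≤ frac E 0 → v ℕ.^ 4 ℕ.≤ n ℕ.* suc k ℕ.^ 4 →
    frac h 0 ℚ.≤ frac (suc u) k ℚ.* frac (suc u) k → frac u k ℚ.≤ c ℚ.* frac v k ℚ.+ frac 1 0 → h ℕ.≤ (4 ℕ.* (E ℕ.* E) ℕ.+ 8) ℕ.* r
  estimate {n} {r} E h k c u v n<r² c≤E v⁴≤ h≤ℚ u≤c = gap≤ {n} {r} {E} {h} {v} {suc u} {k} n<r² v⁴≤ u≤ h≤
    where
    h≤ : h ℕ.* (suc k ℕ.* suc k) ℕ.≤ suc u ℕ.* suc u
    h≤ = subst (h ℕ.* (suc k ℕ.* suc k) ℕ.≤_) (ℕ.*-identityʳ (suc u ℕ.* suc u))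
      (frac-cancel {h} {0} {suc u ℕ.* suc u} {k ℕ.+ k ℕ.* suc k} (subst (frac h 0 ℚ.≤_) (frac-* (suc u) k (suc u) k) h≤ℚ))
    u≤ℚ : frac u k ℚ.≤ frac (E ℕ.* v ℕ.+ suc k) k
    u≤ℚ = ℚ.≤-trans u≤c (ℚ.≤-trans (ℚ.+-monoˡ-≤ (frac 1 0) (ℚ.*-monoʳ-≤-nonNeg (frac v k) {{ℚ.nonNegative (0≤frac v k)}} c≤E))
      (ℚ.≤-reflexive (trans (cong₂ ℚ._+_ (frac-scale E v k) (frac-≡ {1} {0} {suc k} {k} (ℕ.*-comm 1 (suc k)))) (frac-+ (E ℕ.* v) (suc k) k))))
    u≤ : suc u ℕ.≤ E ℕ.* v ℕ.+ 2 ℕ.* suc k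
    u≤ = ℕ.≤-trans (ℕ.+-mono-≤ (ℕ.s≤s (ℕ.z≤n {k})) (ℕ.*-cancelʳ-≤ u (E ℕ.* v ℕ.+ suc k) (suc k) (frac-cancel {u} {k} {E ℕ.* v ℕ.+ suc k} {k} u≤ℚ)))
      (ℕ.≤-reflexive (raw (suc k) (E ℕ.* v)))
      where
      raw : ∀ κ z → κ ℕ.+ (z ℕ.+ κ) ≡ z ℕ.+ 2 ℕ.* κ
      raw = ℕSolver.solve-∀

-- `q` is 1/4, known only through its numerator and denominator. The real inequality is used once,
-- with slack 1, at an index where C is already bounded by E.
distBound : ∀ C q → ↧ₙ q ≡ 4 → ↥ q ≡ + 1 → ∃[ c ] ∀ n .{{_ : NonZero n}} r .{{_ : NonZero r}} x y → n ℕ.< suc r ℕ.* suc r →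
  dist (toℝ³ x) (toℝ³ y) ≤ C * n ^ fromℚ q → norm (toV x ⊖ toV y) ℕ.≤ c ℕ.* r
distBound C q den num = 4 ℕ.* (E ℕ.* E) ℕ.+ 8 , λ n r x y n<r² dist≤ → go n r x y n<r² dist≤ _ refl
  where
  B = proj₁ (evBound C)
  N₀ = proj₁ (proj₂ (proj₂ (evBound C)))
  C≤B : ∀ k → N₀ ℕ.≤ k → ℚ.∣ seq C k ∣ ℚ.≤ B
  C≤B = proj₂ (proj₂ (proj₂ (evBound C)))
  E = ℤ.∣ ↥ B ∣
  go : ∀ n .{{_ : NonZero n}} r .{{_ : NonZero r}} x y → n ℕ.< suc r ℕ.* suc r → dist (toℝ³ x) (toℝ³ y) ≤ C * n ^ fromℚ q →
       ∀ h → norm (toV x ⊖ toV y) ≡ h → h ℕ.≤ (4 ℕ.* (E ℕ.* E) ℕ.+ 8) ℕ.* r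
  go n r x y n<r² dist≤ h eq = estimate E h k (seq C k) (√-num (frac h 0) k) (^-num n q k) n<r²
      (ℚ.≤-trans (p≤∣p∣ (seq C k)) (ℚ.≤-trans (C≤B k (ℕ.m≤m⊔n N₀ N₁)) (≤num B)))
      (^-quarter n q k den num) (√-hi (frac h 0) k)
      (subst₂ (λ u v → u ℚ.≤ v ℚ.+ frac 1 0) (seq-dist x y h k eq) (seq-*^ C n q k) (proj₂ (dist≤ (frac 1 0) (frac-pos 0)) k (ℕ.m≤n⊔m N₀ N₁)))
    where
    N₁ = proj₁ (dist≤ (frac 1 0) (frac-pos 0))
    k = N₀ ℕ.⊔ N₁

𝓔⇒∙ : ∀ {n} x → x ∈ 𝓔 n → toV x ∙ toV x ≡ + n
𝓔⇒∙ (_ ∷ _ ∷ _ ∷ []) h = h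

-- |v - w|² = 2 (n - v ∙ w), so the gap is non-negative and at most |v - w|².
toClose : ∀ {n H v w} → v ∙ v ≡ + n → w ∙ w ≡ + n → norm (v ⊖ w) ℕ.≤ H → Close n H v w
toClose {n} {H} {v} {w} v∙v≡n w∙w≡n h≤H = fromGap (+ n ℤ.- v ∙ w) refl
  where
  double : + norm (v ⊖ w) ≡ + 2 ℤ.* (+ n ℤ.- v ∙ w)
  double = trans (norm-⊖ v w) (trans (cong₂ (λ s t → s ℤ.+ t ℤ.- + 2 ℤ.* (v ∙ w)) v∙v≡n w∙w≡n) (raw (+ n) (v ∙ w)))
    where
    raw : ∀ n p → n ℤ.+ n ℤ.- + 2 ℤ.* p ≡ + 2 ℤ.* (n ℤ.- p)
    raw = ℤSolver.solve-∀
  fromGap : ∀ i → + n ℤ.- v ∙ w ≡ i → Close n H v w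
  fromGap (+ η) eq = close v∙v≡n w∙w≡n η
    (ℕ.≤-trans (ℕ.m≤n*m η 2) (subst (ℕ._≤ H) (ℤ.+-injective (trans double (trans (cong (λ i → + 2 ℤ.* i) eq) (sym (ℤ.pos-* 2 η))))) h≤H))
    (trans (raw (+ n) (v ∙ w)) (cong (λ i → + n ℤ.- i) eq))
    where
    raw : ∀ n p → p ≡ n ℤ.- (n ℤ.- p)
    raw = ℤSolver.solve-∀
  fromGap -[1+ η ] eq = contradiction (trans double (cong (λ i → + 2 ℤ.* i) eq)) λ ()

mainTheorem10 : ∀ {j ℓ a : Level} (C : ℝ) → 0ℝ < C → (ε : ℝ) → 0ℝ < ε →
  ∃[ K ] ((n : ℕ) .{{_ : NonZero n}} (J : Setoid j ℓ) (A : Setoid.Carrier J → Pred ℝ³ a) →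
    IsPartition J (Sphere (√ fromℕ n)) A →
    (∀ i → DiameterAtMost (A i) (C * n ^ fromℚ (+ 1 ℚ./ 4))) →
    -- # i is the number of points of A i ∩ 𝓔 n
    (# : Setoid.Carrier J → ℕ) →
    (∀ i → HasCardinality ((λ x → toℝ³ x ∈ A i) ∩ 𝓔 n) (# i)) →
    -- a sum of non-negative terms over an arbitrary index set is at most a bound
    -- when all its finite partial sums are
    (is : List (Setoid.Carrier J)) → Unique J is →
    fromℕ (sum (map (λ i → # i ℕ.^ 2) is)) ≤ K * n ^ (fromℚ ½ + ε))
mainTheorem10 C _ ε (δ , δ>0 , N , ε≥) =
  let (d , 1/d≤δ) = unit≤ δ δ>0
      (h , h-bound) = distBound C (+ 1 ℚ./ 4) refl refl
      (c , c≢0 , divisor-bound) = uniformDivisorBound (10 ℕ.* suc d)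
      a = 6 ℕ.* (1 ℕ.+ κ) ℕ.+ h ℕ.* κ
  -- h depends only on C, c only on ε, and κ is absolute.
  in fromℕ (a ℕ.* c) , λ n J A partition diameter # card is unique →
    let module P = IsPartition partition
        (r , r≢0 , r²≤n , n<r²) = sqrtℕ n
        -- n² bounds all numbers whose divisors are counted: n itself, A d n - s² and the Gram
        -- determinants.
        (t , t≢0 , τ≤t , t^k≤) = divisor-bound (n ℕ.* n) {{ℕ.m*n≢0 n n}}
        points i = proj₁ (card i)
        in-piece : ∀ {i x} → x ∈ˡ points i → toℝ³ x ∈ A i
        in-piece {i} {x} x∈ = proj₁ (Equivalence.to (proj₁ (proj₂ (proj₂ (card i))) x) x∈)
        on-sphere : ∀ {i x} → x ∈ˡ points i → toV x ∙ toV x ≡ + n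
        on-sphere {i} {x} x∈ = 𝓔⇒∙ x (proj₂ (Equivalence.to (proj₁ (proj₂ (proj₂ (card i))) x) x∈))
        close-points : ∀ {i x y} → x ∈ˡ points i → y ∈ˡ points i →
          ∃[ vw ] Product.uncurry (Close n (h ℕ.* r)) vw × (x , y) ≡ Product.map fromV fromV vw
        close-points {i} {x} {y} x∈ y∈ = (toV x , toV y) ,
          toClose (on-sphere x∈) (on-sphere y∈) (h-bound n r {{r≢0}} x y n<r² (diameter i (in-piece x∈) (in-piece y∈))) ,
          sym (cong₂ _,_ (fromV-toV x) (fromV-toV y))
        count = sumSquares≤ J points (λ i → proj₁ (proj₂ (card i))) (λ x∈ x∈′ → P.disjoint (in-piece x∈) (in-piece x∈′)) close-points
          (atMost-image (Product.map fromV fromV) (atMost-close τ≤t r (h ℕ.* r) n<r²)) is unique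
        S = sum (map (λ i → # i ℕ.^ 2) is)
        sum≡ = cong sum (List.map-cong (λ i → cong (ℕ._^ 2) (proj₂ (proj₂ (proj₂ (card i))))) is)
    in fromℕ≤ n d ε {S} {a ℕ.* c} (N , λ k k≥N → ℚ.≤-trans 1/d≤δ (subst (ℚ._≤ seq ε k) (ℚ.+-identityˡ δ) (ε≥ k k≥N)))
         (powerBound {a} {c} {n} {r} {t} {S} (suc d) {{_}} {{c≢0}} r²≤n t^k≤
           (ℕ.≤-trans (subst (ℕ._≤ _) sum≡ count) (closeBound h r t {{r≢0}} {{t≢0}} ℕ.≤-refl)))
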